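{- Let $\omega$ be a primitive cubic root of unity and $|q|<1$. Then $$\sum_{n=0}^\infty \frac{(-\omega;q)_n(-\omega^2;q^2)_n}{(\omega^2q;q^2)_n (q^3;q^3)_n}\omega^nq^{n(n+3)/2}=\frac{J_{5,12}}{J_3(\omega q^2;q^4)_\infty},$$ $$\sum_{n=0}^{\infty}\frac{(\omega q^4;q^4)_n}{(q^3;q^3)_n(\omega q;q)_{n+1}(\omega^2q;q^2)_{n+1}}\omega^nq^{n(n+3)/2}=\frac{J_{1,12}}{J_3(\omega q^2;q^4)_\infty}.$$
   Context: Here $q$ is a complex number with $|q|<1$. For a base $p$ with $|p|<1$: $(a;p)_\infty=\prod_{k\ge 0}(1-ap^k)$, $(a;p)_n=\prod_{k=0}^{n-1}(1-ap^k)$ for integers $n\ge 0$, and $(a_1,\dots,a_m;p)_\infty=(a_1;p)_\infty\cdots(a_m;p)_\infty$. Notation: $J_m:=(q^m;q^m)_\infty$ and $J_{a,m}:=(q^a,q^{m-a},q^m;q^m)_\infty$. -}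

module Defs where

open import Data.Nat as ℕ using (ℕ; zero; suc)
import Data.Nat.Properties as ℕₚ
open import Data.Product using (∃; ∃₂; _×_; _,_; proj₁; proj₂)
open import Data.Rational as ℚ using (ℚ; 0ℚ; 1ℚ; ½; ∣_∣)
import Data.Rational.Properties as ℚₚ
open import Data.Rational.Solver using (module +-*-Solver)
open import Relation.Binary.PropositionalEquality
  using (_≡_; refl; sym; trans; cong; subst)
open import Relation.Nullary using (¬_)

------------------------------------------------------------------------
-- Real numbers: Cauchy sequences of rationals, compared up to _≈ʳ_.

IsCauchy : (ℕ → ℚ) → Set
IsCauchy s = ∀ ε → 0ℚ ℚ.< ε →
  ∃ λ N → ∀ m n → N ℕ.≤ m → N ℕ.≤ n → ∣ s m ℚ.- s n ∣ ℚ.< ε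

record ℝ : Set where
  constructor mkℝ
  field
    seq    : ℕ → ℚ
    cauchy : IsCauchy seq

open ℝ public

infix 4 _≈ʳ_ _<ʳ_

record _≈ʳ_ (x y : ℝ) : Set where
  constructor mk≈ʳ
  field
    close : ∀ ε → 0ℚ ℚ.< ε →
      ∃ λ N → ∀ n → N ℕ.≤ n → ∣ seq x n ℚ.- seq y n ∣ ℚ.< ε

open _≈ʳ_ public

-- A fixed positive rational gap is required: x n < y n for all large n
-- would not be invariant under _≈ʳ_.
_<ʳ_ : ℝ → ℝ → Set
x <ʳ y = ∃ λ ε → 0ℚ ℚ.< ε ×
  ∃ λ N → ∀ n → N ℕ.≤ n → seq x n ℚ.+ ε ℚ.< seq y n

private abstract
  half-pos : ∀ {ε} → 0ℚ ℚ.< ε → 0ℚ ℚ.< ½ ℚ.* ε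
  half-pos {ε} 0<ε =
    subst (ℚ._< ½ ℚ.* ε) (ℚₚ.*-zeroʳ ½) (ℚₚ.*-monoʳ-<-pos ½ 0<ε)

  half+half : ∀ ε → ½ ℚ.* ε ℚ.+ ½ ℚ.* ε ≡ ε
  half+half ε =
    trans (sym (ℚₚ.*-distribʳ-+ ε ½ ½)) (ℚₚ.*-identityˡ ε)

  ≤⊔ˡ : ∀ {a} b {n} → a ℕ.⊔ b ℕ.≤ n → a ℕ.≤ n
  ≤⊔ˡ {a} b = ℕₚ.≤-trans (ℕₚ.m≤m⊔n a b)

  ≤⊔ʳ : ∀ a {b n} → a ℕ.⊔ b ℕ.≤ n → b ℕ.≤ n
  ≤⊔ʳ a {b} = ℕₚ.≤-trans (ℕₚ.m≤n⊔m a b)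

  const-cauchy : ∀ p → IsCauchy (λ _ → p)
  const-cauchy p ε 0<ε =
    0 , λ _ _ _ _ → subst (ℚ._< ε) (sym (cong ∣_∣ (ℚₚ.+-inverseʳ p))) 0<ε

  neg-cauchy : ∀ s → IsCauchy s → IsCauchy (λ n → ℚ.- s n)
  neg-cauchy s cs ε 0<ε with cs ε 0<ε
  ... | N , h = N , λ m n N≤m N≤n →
    subst (ℚ._< ε)
      (trans (sym (ℚₚ.∣-p∣≡∣p∣ (s m ℚ.- s n)))
             (cong ∣_∣ (ℚₚ.neg-distrib-+ (s m) (ℚ.- s n))))
      (h m n N≤m N≤n)

  +-cauchy : ∀ s t → IsCauchy s → IsCauchy t → IsCauchy (λ n → s n ℚ.+ t n)
  +-cauchy s t cs ct ε 0<ε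
    with cs (½ ℚ.* ε) (half-pos 0<ε) | ct (½ ℚ.* ε) (half-pos 0<ε)
  ... | M , f | N , g = M ℕ.⊔ N , λ m n p q → begin-strict
    ∣ (s m ℚ.+ t m) ℚ.- (s n ℚ.+ t n) ∣
      ≡⟨ cong ∣_∣ (regroup (s m) (t m) (s n) (t n)) ⟩
    ∣ (s m ℚ.- s n) ℚ.+ (t m ℚ.- t n) ∣
      ≤⟨ ℚₚ.∣p+q∣≤∣p∣+∣q∣ (s m ℚ.- s n) (t m ℚ.- t n) ⟩
    ∣ s m ℚ.- s n ∣ ℚ.+ ∣ t m ℚ.- t n ∣
      <⟨ ℚₚ.+-mono-< (f m n (≤⊔ˡ N p) (≤⊔ˡ N q)) (g m n (≤⊔ʳ M p) (≤⊔ʳ M q)) ⟩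
    ½ ℚ.* ε ℚ.+ ½ ℚ.* ε
      ≡⟨ half+half ε ⟩
    ε ∎
    where
    open ℚₚ.≤-Reasoning
    regroup : ∀ a b c d →
      (a ℚ.+ b) ℚ.- (c ℚ.+ d) ≡ (a ℚ.- c) ℚ.+ (b ℚ.- d)
    regroup = +-*-Solver.solve 4
      (λ a b c d → (a :+ b) :- (c :+ d) := (a :- c) :+ (b :- d)) refl
      where open +-*-Solver

  cauchy-bounded : ∀ s → IsCauchy s →
    ∃ λ B → 0ℚ ℚ.< B × ∃ λ N → ∀ n → N ℕ.≤ n → ∣ s n ∣ ℚ.≤ B
  cauchy-bounded s cs with cs 1ℚ (ℚₚ.positive⁻¹ 1ℚ)
  ... | N , h = 1ℚ ℚ.+ ∣ s N ∣
              , ℚₚ.+-mono-<-≤ (ℚₚ.positive⁻¹ 1ℚ) (ℚₚ.0≤∣p∣ (s N))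
              , N , λ n N≤n → begin
    ∣ s n ∣
      ≡⟨ cong ∣_∣ (split (s n) (s N)) ⟩
    ∣ (s n ℚ.- s N) ℚ.+ s N ∣
      ≤⟨ ℚₚ.∣p+q∣≤∣p∣+∣q∣ (s n ℚ.- s N) (s N) ⟩
    ∣ s n ℚ.- s N ∣ ℚ.+ ∣ s N ∣
      ≤⟨ ℚₚ.+-monoˡ-≤ ∣ s N ∣ (ℚₚ.<⇒≤ (h n N N≤n ℕₚ.≤-refl)) ⟩
    1ℚ ℚ.+ ∣ s N ∣ ∎
    where
    open ℚₚ.≤-Reasoning
    split : ∀ a b → a ≡ (a ℚ.- b) ℚ.+ b
    split = +-*-Solver.solve 2 (λ a b → a := (a :- b) :+ b) refl
      where open +-*-Solver

  divide : ∀ C ε → 0ℚ ℚ.< C → 0ℚ ℚ.< ε → ∃ λ δ → 0ℚ ℚ.< δ × C ℚ.* δ ≡ ε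
  divide C ε 0<C 0<ε =
      ℚ.1/ C ℚ.* ε
    , subst (ℚ._< ℚ.1/ C ℚ.* ε) (ℚₚ.*-zeroʳ (ℚ.1/ C))
        (ℚₚ.*-monoʳ-<-pos (ℚ.1/ C) 0<ε)
    , trans (sym (ℚₚ.*-assoc C (ℚ.1/ C) ε))
        (trans (cong (ℚ._* ε) (ℚₚ.*-inverseʳ C)) (ℚₚ.*-identityˡ ε))
    where
    instance
      C-positive : ℚ.Positive C
      C-positive = ℚ.positive 0<C
      C-nonZero : ℚ.NonZero C
      C-nonZero = ℚₚ.pos⇒nonZero C
      1/C-positive : ℚ.Positive (ℚ.1/ C)
      1/C-positive = ℚₚ.1/pos⇒pos C

  ∣*∣< : ∀ a b A δ → 0ℚ ℚ.< A → ∣ a ∣ ℚ.≤ A → ∣ b ∣ ℚ.< δ →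
         ∣ a ℚ.* b ∣ ℚ.< A ℚ.* δ
  ∣*∣< a b A δ 0<A a≤A b<δ = begin-strict
    ∣ a ℚ.* b ∣
      ≡⟨ ℚₚ.∣p*q∣≡∣p∣*∣q∣ a b ⟩
    ∣ a ∣ ℚ.* ∣ b ∣
      ≤⟨ ℚₚ.*-monoʳ-≤-nonNeg ∣ b ∣ {{ℚ.nonNegative (ℚₚ.0≤∣p∣ b)}} a≤A ⟩
    A ℚ.* ∣ b ∣
      <⟨ ℚₚ.*-monoʳ-<-pos A {{ℚ.positive 0<A}} b<δ ⟩
    A ℚ.* δ ∎
    where open ℚₚ.≤-Reasoning

  ∣*-*∣< : ∀ a b c d A B δ → 0ℚ ℚ.< A → 0ℚ ℚ.< B →
           ∣ a ∣ ℚ.≤ A → ∣ d ∣ ℚ.≤ B → ∣ b ℚ.- d ∣ ℚ.< δ → ∣ a ℚ.- c ∣ ℚ.< δ →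
           ∣ a ℚ.* b ℚ.- c ℚ.* d ∣ ℚ.< (A ℚ.+ B) ℚ.* δ
  ∣*-*∣< a b c d A B δ 0<A 0<B a≤A d≤B b-d<δ a-c<δ = begin-strict
    ∣ a ℚ.* b ℚ.- c ℚ.* d ∣
      ≡⟨ cong ∣_∣ (rearrange a b c d) ⟩
    ∣ a ℚ.* (b ℚ.- d) ℚ.+ d ℚ.* (a ℚ.- c) ∣
      ≤⟨ ℚₚ.∣p+q∣≤∣p∣+∣q∣ (a ℚ.* (b ℚ.- d)) (d ℚ.* (a ℚ.- c)) ⟩
    ∣ a ℚ.* (b ℚ.- d) ∣ ℚ.+ ∣ d ℚ.* (a ℚ.- c) ∣
      <⟨ ℚₚ.+-mono-< (∣*∣< a (b ℚ.- d) A δ 0<A a≤A b-d<δ)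
                     (∣*∣< d (a ℚ.- c) B δ 0<B d≤B a-c<δ) ⟩
    A ℚ.* δ ℚ.+ B ℚ.* δ
      ≡⟨ ℚₚ.*-distribʳ-+ δ A B ⟨
    (A ℚ.+ B) ℚ.* δ ∎
    where
    open ℚₚ.≤-Reasoning
    rearrange : ∀ a b c d →
      a ℚ.* b ℚ.- c ℚ.* d ≡ a ℚ.* (b ℚ.- d) ℚ.+ d ℚ.* (a ℚ.- c)
    rearrange = +-*-Solver.solve 4
      (λ a b c d → a :* b :- c :* d := a :* (b :- d) :+ d :* (a :- c)) refl
      where open +-*-Solver

  *-cauchy : ∀ s t → IsCauchy s → IsCauchy t → IsCauchy (λ n → s n ℚ.* t n)
  *-cauchy s t cs ct ε 0<ε =
    let A , 0<A , K , bs = cauchy-bounded s cs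
        B , 0<B , L , bt = cauchy-bounded t ct
        δ , 0<δ , [A+B]δ≡ε = divide (A ℚ.+ B) ε (ℚₚ.+-mono-< 0<A 0<B) 0<ε
        M , f = cs δ 0<δ
        N , g = ct δ 0<δ
    in (K ℕ.⊔ L) ℕ.⊔ (M ℕ.⊔ N) , λ m n p q →
      let p′ = ≤⊔ʳ (K ℕ.⊔ L) p
          q′ = ≤⊔ʳ (K ℕ.⊔ L) q
      in subst (∣ s m ℚ.* t m ℚ.- s n ℚ.* t n ∣ ℚ.<_) [A+B]δ≡ε
           (∣*-*∣< (s m) (t m) (s n) (t n) A B δ 0<A 0<B
             (bs m (≤⊔ˡ L (≤⊔ˡ (M ℕ.⊔ N) p)))
             (bt n (≤⊔ʳ K (≤⊔ˡ (M ℕ.⊔ N) q)))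
             (g m n (≤⊔ʳ M p′) (≤⊔ʳ M q′))
             (f m n (≤⊔ˡ N p′) (≤⊔ˡ N q′)))

infix  8 -ʳ_
infixl 7 _*ʳ_
infixl 6 _+ʳ_

fromℚ : ℚ → ℝ
fromℚ p = mkℝ (λ _ → p) (const-cauchy p)

_+ʳ_ : ℝ → ℝ → ℝ
x +ʳ y = mkℝ (λ n → seq x n ℚ.+ seq y n) (+-cauchy (seq x) (seq y) (cauchy x) (cauchy y))

_*ʳ_ : ℝ → ℝ → ℝ
x *ʳ y = mkℝ (λ n → seq x n ℚ.* seq y n) (*-cauchy (seq x) (seq y) (cauchy x) (cauchy y))

-ʳ_ : ℝ → ℝ
-ʳ x = mkℝ (λ n → ℚ.- seq x n) (neg-cauchy (seq x) (cauchy x))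

------------------------------------------------------------------------

infix 5 _+i_

record ℂ : Set where
  constructor _+i_
  field
    re : ℝ
    im : ℝ

open ℂ public

infix  4 _≈_ _#0 ∣_∣<_
infix  8 -_
infixl 7 _*_
infixl 6 _+_ _-_
infixr 9 _^_

_≈_ : ℂ → ℂ → Set
z ≈ w = re z ≈ʳ re w × im z ≈ʳ im w

0ℂ 1ℂ : ℂ
0ℂ = fromℚ 0ℚ +i fromℚ 0ℚ
1ℂ = fromℚ 1ℚ +i fromℚ 0ℚ

_+_ : ℂ → ℂ → ℂ
z + w = (re z +ʳ re w) +i (im z +ʳ im w)

_*_ : ℂ → ℂ → ℂ
z * w = (re z *ʳ re w +ʳ -ʳ (im z *ʳ im w)) +i (re z *ʳ im w +ʳ im z *ʳ re w)

-_ : ℂ → ℂ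
- z = (-ʳ re z) +i (-ʳ im z)

_-_ : ℂ → ℂ → ℂ
z - w = z + (- w)

_^_ : ℂ → ℕ → ℂ
z ^ zero  = 1ℂ
z ^ suc n = z ^ n * z

∣_∣² : ℂ → ℝ
∣ z ∣² = re z *ʳ re z +ʳ im z *ʳ im z

-- The modulus bound |z| < r, squared to avoid the square root; it is only
-- meaningful (and only used) for rational r > 0.
∣_∣<_ : ℂ → ℚ → Set
∣ z ∣< r = ∣ z ∣² <ʳ fromℚ (r ℚ.* r)

-- Apartness from zero: constructively, what makes z invertible.
_#0 : ℂ → Set
z #0 = fromℚ 0ℚ <ʳ ∣ z ∣²

IsPrimitiveRoot : ℕ → ℂ → Set
IsPrimitiveRoot n ω =
  ω ^ n ≈ 1ℂ × (∀ k → 0 ℕ.< k → k ℕ.< n → ¬ (ω ^ k ≈ 1ℂ))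

infix 4 _⟶_

_⟶_ : (ℕ → ℂ) → ℂ → Set
s ⟶ l = ∀ ε → 0ℚ ℚ.< ε → ∃ λ N → ∀ n → N ℕ.≤ n → ∣ s n - l ∣< ε

-- ∑< n f = f 0 + ⋯ + f (n - 1), and likewise for products.
∑< ∏< : ℕ → (ℕ → ℂ) → ℂ
∑< zero    f = 0ℂ
∑< (suc n) f = ∑< n f + f n
∏< zero    f = 1ℂ
∏< (suc n) f = ∏< n f * f n

------------------------------------------------------------------------
-- Quotients and infinite sums or products need not exist.  An expression
-- built from them is the predicate "w is a value of this expression";
-- values are unique up to _≈_.

Partialℂ : Set₁
Partialℂ = ℂ → Set

infix  4 _≋_
infixl 7 _·_ _÷_
infix  8 ↑_

↑_ : ℂ → Partialℂ
(↑ z) w = w ≈ z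

_·_ : Partialℂ → Partialℂ → Partialℂ
(X · Y) w = ∃₂ λ x y → X x × Y y × w ≈ x * y

_÷_ : Partialℂ → Partialℂ → Partialℂ
(X ÷ Y) w = ∃₂ λ x y → X x × Y y × y #0 × w * y ≈ x

∑∞ : (ℕ → Partialℂ) → Partialℂ
∑∞ T w = ∃ λ (t : ℕ → ℂ) → (∀ n → T n (t n)) × ((λ n → ∑< n t) ⟶ w)

∏∞ : (ℕ → ℂ) → Partialℂ
∏∞ f w = (λ n → ∏< n f) ⟶ w

-- Both sides are defined, and they are equal.
_≋_ : Partialℂ → Partialℂ → Set
X ≋ Y = ∃ λ w → X w × Y w

------------------------------------------------------------------------
-- q-shifted factorials: ⟨ a ⨟ p ⟩ n is (a;p)_n and ⟨ a ⨟ p ⟩∞ is (a;p)_∞.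

infix 9 ⟨_⨟_⟩_ ⟨_⨟_⟩∞

⟨_⨟_⟩_ : ℂ → ℂ → ℕ → ℂ
⟨ a ⨟ p ⟩ n = ∏< n (λ k → 1ℂ - a * p ^ k)

⟨_⨟_⟩∞ : ℂ → ℂ → Partialℂ
⟨ a ⨟ p ⟩∞ = ∏∞ (λ k → 1ℂ - a * p ^ k)

-- J m q is J_m, and J₂ a m q is the two-index J_{a,m}, for a ≤ m.
J : ℕ → ℂ → Partialℂ
J m q = ⟨ q ^ m ⨟ q ^ m ⟩∞

J₂ : ℕ → ℕ → ℂ → Partialℂ
J₂ a m q = ⟨ q ^ a ⨟ q ^ m ⟩∞ · ⟨ q ^ (m ℕ.∸ a) ⨟ q ^ m ⟩∞ · ⟨ q ^ m ⨟ q ^ m ⟩∞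

{-# OPTIONS --safe #-}
module Submission where

-- With y = q^n, the summands s_n and d_n of the two sums share the factor
--   H_n = ∏_{k<n} (1+ωq^k)(1+ω²q^2k) ωq^(k+1) / ((1−ω²q^(2k+1))(1−q^(3k+3))),
-- and by 1 + ω + ω² = 0 the terms (1+ω) a_n = H_n (1+ωy)² and
-- (1+ω²) b_n = H_n (1+ω²y²) satisfy
--   2ω s_n = (1+ω) a_n − (1+ω²) b_n,
--   2ωq d_n = (1+ω) a_(n+1) + (1+ω²) b_(n+1).
-- So both sums follow from ∑ a_n and ∑ b_n.  Each of these is the value at
-- one point of a series in a parameter x that satisfies a first-order
-- recursion under x ↦ q²x; iterating it leaves a product times the value at
-- x = 0, and that value is read off at another point, where the series
-- terminates.  The triple product is proved in the same way.  With
-- Y = J₃ (ωq²;q⁴)_∞, the triple product in the base −q turns −ωY ∑ a_n and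
-- Y ∑ b_n into (±Q, ±Q², Q³; Q³)_∞ for Q = −q, which is J_{5,12} ± q J_{1,12}
-- when its theta series is split by parity.  The second sum is obtained only
-- after multiplication by q; since ≈ on ℂ is stable under double negation, q
-- may be cancelled and q ≈ 0 treated apart.

-- Two difficulties shape the proof. Letting x tend to 0 along powers of q² interchanges a limit
-- with a sum, so the n-th term at step m must be within C r^(m+n) of its limit, uniformly in both
-- indices; hence bounds are stated for doubly indexed families. Reciprocals are the other
-- difficulty: a commutative ring has no inversion, and the factors 1 - x need inverses with a
-- common bound. Every x that occurs has x⁶ equal to a positive power of q, so 1 - x divides 1 - x⁶,
-- whose inverse is a geometric series. The inverses then enter polynomial identities as further
-- variables.
--
-- Telescoping certificates reduce each recursion to a polynomial identity, for ∑ a_n one modulo 1 +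
-- ω + ω². The series terminate at x = -1 for ∑ b_n and at x = -ω² for ∑ a_n.
--
-- All this takes place in an abstract commutative ring with such bounds; ℂ is shown to be an
-- instance afterwards. That ω differs from 1 is negative information, and 1 + ω + ω² = 0 is drawn
-- from it by the stability of ≈.

open import Level using (0ℓ)
import Algebra.Properties.AbelianGroup
import Algebra.Properties.Ring
import Algebra.Properties.Semiring.Mult.TCOptimised
import Algebra.Solver.Ring
open import Algebra.Bundles using (CommutativeRing)
open import Algebra.Solver.Ring.AlmostCommutativeRing
  using (fromCommutativeRing; _-Raw-AlmostCommutative⟶_)
open import Data.Empty using (⊥-elim)
import Data.Integer.Properties as ℤₚ
open import Data.Maybe using (Maybe; just; nothing)
open import Data.Nat as ℕ using (ℕ; zero; suc)
import Data.Nat.Coprimality as Coprimality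
import Data.Nat.DivMod as ℕ/
import Data.Nat.Properties as ℕₚ
open import Data.Nat.Divisibility using (divides)
open import Data.Nat.Tactic.RingSolver using (solve-∀)
open import Data.Product using (∃; ∃₂; _×_; _,_; proj₁; proj₂)
open import Data.Rational as ℚ using (ℚ; 0ℚ; 1ℚ; ½)
import Data.Rational.Properties as ℚₚ
open import Data.Rational.Solver using (module +-*-Solver)
import Data.Rational.Unnormalised as ℚᵘ
import Data.Rational.Unnormalised.Properties as ℚᵘₚ
open import Data.Sum using (inj₁; inj₂)
import Defs
open import Relation.Binary.PropositionalEquality as ≡ using (_≡_)
import Relation.Binary.Reasoning.Setoid
open import Relation.Binary.Structures using (IsEquivalence)
open import Relation.Nullary using (¬_; yes; no)

-- Polynomial identities with integer coefficients in a commutative ring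

module IntegerSolver (R : CommutativeRing 0ℓ 0ℓ) where
  open import Data.Integer as ℤ using (ℤ; +_; -[1+_]; _⊖_)
  open CommutativeRing R
  open Algebra.Properties.Ring ring
  open Algebra.Properties.AbelianGroup +-abelianGroup using (⁻¹-∙-comm)
  open Algebra.Properties.Semiring.Mult.TCOptimised semiring
    using (1+×; ×-homo-+; ×1-homo-*) renaming (_×_ to infixl 8 _×ᵣ_)
  open Relation.Binary.Reasoning.Setoid setoid

  private
    ⟦_⟧ : ℤ → Carrier
    ⟦ + n ⟧      = n ×ᵣ 1#
    ⟦ -[1+ n ] ⟧ = - (suc n ×ᵣ 1#)

    cancel : ∀ a b → (1# + a) - (1# + b) ≈ a - b
    cancel a b = begin
      (1# + a) - (1# + b)         ≈⟨ +-cong (+-comm 1# a) (sym (⁻¹-∙-comm 1# b)) ⟩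
      (a + 1#) + (- 1# + - b)     ≈⟨ +-assoc a 1# _ ⟩
      a + (1# + (- 1# + - b))     ≈⟨ +-congˡ (+-assoc 1# (- 1#) (- b)) ⟨
      a + ((1# - 1#) + - b)       ≈⟨ +-congˡ (+-congʳ (-‿inverseʳ 1#)) ⟩
      a + (0# + - b)              ≈⟨ +-congˡ (+-identityˡ (- b)) ⟩
      a - b                       ∎

    ⊖-homo : ∀ m n → ⟦ m ⊖ n ⟧ ≈ m ×ᵣ 1# - n ×ᵣ 1#
    ⊖-homo zero    zero    = sym (-‿inverseʳ 0#)
    ⊖-homo zero    (suc n) = sym (+-identityˡ _)
    ⊖-homo (suc m) zero    = sym (trans (+-congˡ -0#≈0#) (+-identityʳ _))
    ⊖-homo (suc m) (suc n) = begin
      ⟦ suc m ⊖ suc n ⟧           ≡⟨ ≡.cong ⟦_⟧ (ℤₚ.[1+m]⊖[1+n]≡m⊖n m n) ⟩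
      ⟦ m ⊖ n ⟧                   ≈⟨ ⊖-homo m n ⟩
      m ×ᵣ 1# - n ×ᵣ 1#             ≈⟨ cancel (m ×ᵣ 1#) (n ×ᵣ 1#) ⟨
      (1# + m ×ᵣ 1#) - (1# + n ×ᵣ 1#)
        ≈⟨ +-cong (1+× m 1#) (-‿cong (1+× n 1#)) ⟨
      suc m ×ᵣ 1# - suc n ×ᵣ 1#     ∎

    neg-homo : ∀ i → ⟦ ℤ.- i ⟧ ≈ - ⟦ i ⟧
    neg-homo (+ zero)  = sym -0#≈0#
    neg-homo (+ suc n) = refl
    neg-homo -[1+ n ]  = sym (-‿involutive _)

    +-homo : ∀ i j → ⟦ i ℤ.+ j ⟧ ≈ ⟦ i ⟧ + ⟦ j ⟧
    +-homo (+ m)    (+ n)    = ×-homo-+ 1# m n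
    +-homo (+ m)    -[1+ n ] = ⊖-homo m (suc n)
    +-homo -[1+ m ] (+ n)    = trans (⊖-homo n (suc m)) (+-comm _ _)
    +-homo -[1+ m ] -[1+ n ] = begin
      - (suc (suc (m ℕ.+ n)) ×ᵣ 1#)        ≡⟨ ≡.cong (λ k → - (suc k ×ᵣ 1#)) (ℕ+ m n) ⟩
      - ((suc m ℕ.+ suc n) ×ᵣ 1#)          ≈⟨ -‿cong (×-homo-+ 1# (suc m) (suc n)) ⟩
      - (suc m ×ᵣ 1# + suc n ×ᵣ 1#)         ≈⟨ ⁻¹-∙-comm _ _ ⟨
      - (suc m ×ᵣ 1#) + - (suc n ×ᵣ 1#)     ∎
      where
      ℕ+ : ∀ m n → suc (m ℕ.+ n) ≡ m ℕ.+ suc n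
      ℕ+ zero    n = ≡.refl
      ℕ+ (suc m) n = ≡.cong suc (ℕ+ m n)

    pos-homo : ∀ m n → ⟦ + m ℤ.* + n ⟧ ≈ m ×ᵣ 1# * n ×ᵣ 1#
    pos-homo m n = trans (reflexive (≡.cong ⟦_⟧ (≡.sym (ℤₚ.pos-* m n)))) (×1-homo-* m n)

    *-homo : ∀ i j → ⟦ i ℤ.* j ⟧ ≈ ⟦ i ⟧ * ⟦ j ⟧
    *-homo (+ m)    (+ n)    = pos-homo m n
    *-homo (+ m)    -[1+ n ] = begin
      ⟦ + m ℤ.* ℤ.- (+ suc n) ⟧     ≡⟨ ≡.cong ⟦_⟧ (ℤₚ.neg-distribʳ-* (+ m) (+ suc n)) ⟨
      ⟦ ℤ.- (+ m ℤ.* + suc n) ⟧     ≈⟨ neg-homo (+ m ℤ.* + suc n) ⟩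
      - ⟦ + m ℤ.* + suc n ⟧         ≈⟨ -‿cong (pos-homo m (suc n)) ⟩
      - (m ×ᵣ 1# * suc n ×ᵣ 1#)       ≈⟨ -‿distribʳ-* _ _ ⟩
      m ×ᵣ 1# * - (suc n ×ᵣ 1#)       ∎
    *-homo -[1+ m ] (+ n)    = begin
      ⟦ ℤ.- (+ suc m) ℤ.* + n ⟧     ≡⟨ ≡.cong ⟦_⟧ (ℤₚ.neg-distribˡ-* (+ suc m) (+ n)) ⟨
      ⟦ ℤ.- (+ suc m ℤ.* + n) ⟧     ≈⟨ neg-homo (+ suc m ℤ.* + n) ⟩
      - ⟦ + suc m ℤ.* + n ⟧         ≈⟨ -‿cong (pos-homo (suc m) n) ⟩
      - (suc m ×ᵣ 1# * n ×ᵣ 1#)       ≈⟨ -‿distribˡ-* _ _ ⟩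
      - (suc m ×ᵣ 1#) * n ×ᵣ 1#       ∎
    *-homo -[1+ m ] -[1+ n ] = begin
      ⟦ + suc m ℤ.* + suc n ⟧             ≈⟨ pos-homo (suc m) (suc n) ⟩
      suc m ×ᵣ 1# * suc n ×ᵣ 1#             ≈⟨ -‿involutive _ ⟨
      - - (suc m ×ᵣ 1# * suc n ×ᵣ 1#)       ≈⟨ -‿cong (-‿distribˡ-* _ _) ⟩
      - (- (suc m ×ᵣ 1#) * suc n ×ᵣ 1#)     ≈⟨ -‿distribʳ-* _ _ ⟩
      - (suc m ×ᵣ 1#) * - (suc n ×ᵣ 1#)     ∎

    morphism : ℤ.+-*-rawRing -Raw-AlmostCommutative⟶ fromCommutativeRing R
    morphism = record
      { ⟦_⟧    = ⟦_⟧
      ; +-homo = +-homo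
      ; *-homo = *-homo
      ; -‿homo = neg-homo
      ; 0-homo = refl
      ; 1-homo = refl
      }

    -- Coefficients are compared as integers, because equality in R is not decidable; this suffices
    -- for identities that hold over ℤ.
    _coeff≟_ : ∀ i j → Maybe (⟦ i ⟧ ≈ ⟦ j ⟧)
    i coeff≟ j with i ℤ.≟ j
    ... | yes i≡j = just (reflexive (≡.cong ⟦_⟧ i≡j))
    ... | no _    = nothing

  open Algebra.Solver.Ring ℤ.+-*-rawRing (fromCommutativeRing R) morphism _coeff≟_ public

  :1 : ∀ {n} → Polynomial n
  :1 = con (+ 1)
  :0 : ∀ {n} → Polynomial n
  :0 = con (+ 0)

-- Limits, sums and products at a uniform geometric rate

-- Geo d x says that ∣ x m n ∣ ≤ C r^(d m n) for all m and n, where the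
-- constant C does not depend on m, n and the ratio 0 < r < 1 is fixed once
-- and for all.  Every limit below is reached at such a geometric rate.
record GeometricBounds (R : CommutativeRing 0ℓ 0ℓ) : Set₁ where
  open CommutativeRing R
  field
    Geo : (ℕ → ℕ → ℕ) → (ℕ → ℕ → Carrier) → Set
    geo-≈ : ∀ {d x y} → (∀ m n → x m n ≈ y m n) → Geo d x → Geo d y
    geo-≤ : ∀ {d e x} → (∀ m n → e m n ℕ.≤ d m n) → Geo d x → Geo e x
    geo-reindex : ∀ {d x} (f g : ℕ → ℕ → ℕ) → Geo d x →
      Geo (λ m n → d (f m n) (g m n)) (λ m n → x (f m n) (g m n))
    geo-+ : ∀ {d x y} → Geo d x → Geo d y → Geo d (λ m n → x m n + y m n)
    geo-neg : ∀ {d x} → Geo d x → Geo d (λ m n → - x m n)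
    geo-* : ∀ {d e x y} → Geo d x → Geo e y →
      Geo (λ m n → d m n ℕ.+ e m n) (λ m n → x m n * y m n)
    geo-0 : ∀ {d} → Geo d (λ _ _ → 0#)
    geo-const : ∀ a → Geo (λ _ _ → 0) (λ _ _ → a)
    geo-separated : ∀ {x} → Geo (λ _ n → n) (λ _ _ → x) → x ≈ 0#
    -- The offset `e m` survives the passage to the limit, so the tails of a family of series stay
    -- small in m as well as in n.
    geo-complete : ∀ (e : ℕ → ℕ) (s : ℕ → ℕ → Carrier) →
      Geo (λ m n → e m ℕ.+ n) (λ m n → s m (suc n) - s m n) →
      ∃ λ (l : ℕ → Carrier) → Geo (λ m n → e m ℕ.+ n) (λ m n → l m - s m n)
    -- The multiplier σ decays, so x divided by r^(e m + n) obeys a recursion that eventually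
    -- contracts; x inherits the rate of the forcing term u.
    geo-recursion : ∀ (e : ℕ → ℕ) {x u σ} →
      Geo (λ m _ → e m) (λ m _ → x m 0) →
      Geo (λ m n → e m ℕ.+ n) u → Geo (λ _ n → n) σ →
      (∀ m n → x m (suc n) ≈ u m n + x m n * σ m n) →
      Geo (λ m n → e m ℕ.+ n) x
    -- Factors near 1 give a product that need not decay, outside the scope of `geo-recursion`. It
    -- is bounded because the sum of the ∣w m n∣ over n is bounded uniformly in m.
    geo-product : ∀ {x w} → Geo (λ _ n → n) w → (∀ m → x m 0 ≈ 1#) →
      (∀ m n → x m (suc n) ≈ x m n * (1# + w m n)) → Geo (λ _ _ → 0) x

module Limits (R : CommutativeRing 0ℓ 0ℓ) (G : GeometricBounds R) where
  open CommutativeRing R public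
  open GeometricBounds G public
  open Relation.Binary.Reasoning.Setoid setoid public
  open IntegerSolver R public using (solve; _:=_; _:+_; _:*_; _:-_; :-_; :1; :0; Polynomial)

  infixr 9 _^_
  _^_ : Carrier → ℕ → Carrier
  z ^ zero  = 1#
  z ^ suc n = z ^ n * z

  ∑< ∏< : ℕ → (ℕ → Carrier) → Carrier
  ∑< zero    f = 0#
  ∑< (suc n) f = ∑< n f + f n
  ∏< zero    f = 1#
  ∏< (suc n) f = ∏< n f * f n

  Bounded Small Small₁ : (ℕ → ℕ → Carrier) → Set
  Bounded = Geo (λ _ _ → 0)
  Small   = Geo (λ _ n → n)
  Small₁  = Geo (λ m _ → m)

  infix 4 _⟶_
  -- The first index is a dummy, so that every rule for `Geo` applies to limits of plain sequences.
  _⟶_ : (ℕ → Carrier) → Carrier → Set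
  s ⟶ l = Small (λ _ n → s n - l)

  geo-bounded : ∀ {d x} → Geo d x → Bounded x
  geo-bounded = geo-≤ (λ _ _ → ℕ.z≤n)

  geo-*ᵇ : ∀ {d x y} → Geo d x → Bounded y → Geo d (λ m n → x m n * y m n)
  geo-*ᵇ {d} gx gy = geo-≤ (λ m n → ℕₚ.m≤m+n (d m n) 0) (geo-* gx gy)

  geo-ᵇ* : ∀ {d x y} → Bounded x → Geo d y → Geo d (λ m n → x m n * y m n)
  geo-ᵇ* gx gy = geo-* gx gy

  geo-- : ∀ {d x y} → Geo d x → Geo d y → Geo d (λ m n → x m n - y m n)
  geo-- gx gy = geo-+ gx (geo-neg gy)

  ⟶-unique : ∀ {s l l′} → s ⟶ l → s ⟶ l′ → l ≈ l′
  ⟶-unique {s} {l} {l′} p p′ = begin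
    l                ≈⟨ solve 2 (λ l l′ → l := (l :- l′) :+ l′) refl l l′ ⟩
    (l - l′) + l′    ≈⟨ +-congʳ (geo-separated (geo-≈ eq (geo-- p′ p))) ⟩
    0# + l′          ≈⟨ +-identityˡ l′ ⟩
    l′               ∎
    where
    eq : ∀ (m n : ℕ) → (s n - l′) - (s n - l) ≈ l - l′
    eq _ n = solve 3 (λ s l l′ → (s :- l′) :- (s :- l) := l :- l′) refl (s n) l l′

  ⟶-cong : ∀ {s t l m} → (∀ n → s n ≈ t n) → l ≈ m → s ⟶ l → t ⟶ m
  ⟶-cong st lm = geo-≈ (λ _ n → +-cong (st n) (-‿cong lm))

  ⟶-seq : ∀ {s t l} → (∀ n → s n ≈ t n) → s ⟶ l → t ⟶ l
  ⟶-seq st = geo-≈ (λ _ n → +-congʳ (st n))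

  ⟶-lim : ∀ {s l k} → l ≈ k → s ⟶ l → s ⟶ k
  ⟶-lim lk = geo-≈ (λ _ n → +-congˡ (-‿cong lk))

  ⟶-bounded : ∀ {s l} → s ⟶ l → Bounded (λ _ n → s n)
  ⟶-bounded {s} {l} p =
    geo-≈ (λ _ n → solve 2 (λ s l → (s :- l) :+ l := s) refl (s n) l)
      (geo-+ (geo-bounded p) (geo-const l))

  ⟶-const : ∀ l → (λ _ → l) ⟶ l
  ⟶-const l = geo-≈ (λ _ _ → sym (-‿inverseʳ l)) geo-0

  ⟶-+ : ∀ {s t l k} → s ⟶ l → t ⟶ k → (λ n → s n + t n) ⟶ l + k
  ⟶-+ {s} {t} {l} {k} p p′ = geo-≈ (λ _ n →
    solve 4 (λ s l t k → (s :- l) :+ (t :- k) := (s :+ t) :- (l :+ k)) refl (s n) l (t n) k)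
    (geo-+ p p′)

  ⟶-* : ∀ {s t l k} → s ⟶ l → t ⟶ k → (λ n → s n * t n) ⟶ l * k
  ⟶-* {s} {t} {l} {k} p p′ = geo-≈ (λ _ n →
    solve 4 (λ s l t k → s :* (t :- k) :+ (s :- l) :* k := s :* t :- l :* k) refl (s n) l (t n) k)
    (geo-+ (geo-ᵇ* (⟶-bounded p) p′) (geo-*ᵇ p (geo-const k)))

  ⟶-scale : ∀ {s l} c → s ⟶ l → (λ n → c * s n) ⟶ c * l
  ⟶-scale c = ⟶-* (⟶-const c)

  ⟶-neg : ∀ {s l} → s ⟶ l → (λ n → - s n) ⟶ - l
  ⟶-neg {s} {l} p = geo-≈ (λ _ n →
    solve 2 (λ s l → :- (s :- l) := (:- s) :- (:- l)) refl (s n) l) (geo-neg p)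

  ⟶-- : ∀ {s t l k} → s ⟶ l → t ⟶ k → (λ n → s n - t n) ⟶ l - k
  ⟶-- p p′ = ⟶-+ p (⟶-neg p′)

  ⟶-sub : ∀ {s l} (f : ℕ → ℕ) → (∀ n → n ℕ.≤ f n) → s ⟶ l → (λ n → s (f n)) ⟶ l
  ⟶-sub f n≤f p = geo-≤ (λ _ → n≤f) (geo-reindex (λ m _ → m) (λ _ → f) p)

  ⟶-suc : ∀ {s l} → s ⟶ l → (λ n → s (suc n)) ⟶ l
  ⟶-suc = ⟶-sub suc ℕₚ.n≤1+n

  n≤n+n : ∀ n → n ℕ.≤ n ℕ.+ n
  n≤n+n n = ℕₚ.m≤m+n n n

  ⟶-double : ∀ {s l} → s ⟶ l → (λ n → s (n ℕ.+ n)) ⟶ l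
  ⟶-double = ⟶-sub (λ n → n ℕ.+ n) n≤n+n

  small⇒⟶0 : ∀ {s} → Small (λ _ n → s n) → s ⟶ 0#
  small⇒⟶0 {s} = geo-≈ (λ _ n → solve 1 (λ s → s := s :- :0) refl (s n))

  ∑-cong : ∀ n {f g} → (∀ k → f k ≈ g k) → ∑< n f ≈ ∑< n g
  ∑-cong zero    fg = refl
  ∑-cong (suc n) fg = +-cong (∑-cong n fg) (fg n)

  ∏-cong : ∀ n {f g} → (∀ k → f k ≈ g k) → ∏< n f ≈ ∏< n g
  ∏-cong zero    fg = refl
  ∏-cong (suc n) fg = *-cong (∏-cong n fg) (fg n)

  ∑-+ : ∀ n f g → ∑< n (λ k → f k + g k) ≈ ∑< n f + ∑< n g
  ∑-+ zero    f g = sym (+-identityˡ 0#)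
  ∑-+ (suc n) f g = trans (+-congʳ (∑-+ n f g))
    (solve 4 (λ a b c d → (a :+ b) :+ (c :+ d) := (a :+ c) :+ (b :+ d)) refl _ _ _ _)

  ∑-* : ∀ n c f → ∑< n (λ k → c * f k) ≈ c * ∑< n f
  ∑-* zero    c f = sym (zeroʳ c)
  ∑-* (suc n) c f = trans (+-congʳ (∑-* n c f)) (sym (distribˡ c _ _))

  ∏-* : ∀ n f g → ∏< n (λ k → f k * g k) ≈ ∏< n f * ∏< n g
  ∏-* zero    f g = sym (*-identityˡ 1#)
  ∏-* (suc n) f g = trans (*-congʳ (∏-* n f g))
    (solve 4 (λ a b c d → (a :* b) :* (c :* d) := (a :* c) :* (b :* d)) refl _ _ _ _)

  ∏-1 : ∀ n {f} → (∀ k → f k ≈ 1#) → ∏< n f ≈ 1#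
  ∏-1 zero    f1 = refl
  ∏-1 (suc n) f1 = trans (*-cong (∏-1 n f1) (f1 n)) (*-identityˡ 1#)

  double-suc : ∀ n → suc n ℕ.+ suc n ≡ suc (suc (n ℕ.+ n))
  double-suc n = ≡.cong suc (ℕₚ.+-suc n n)

  ∑-pairs : ∀ n f → ∑< (n ℕ.+ n) f ≈ ∑< n (λ k → f (k ℕ.+ k) + f (suc (k ℕ.+ k)))
  ∑-pairs zero    f = refl
  ∑-pairs (suc n) f = begin
    ∑< (suc n ℕ.+ suc n) f                                  ≡⟨ ≡.cong (λ k → ∑< k f) (double-suc n) ⟩
    ∑< (n ℕ.+ n) f + f (n ℕ.+ n) + f (suc (n ℕ.+ n))        ≈⟨ +-assoc _ _ _ ⟩
    ∑< (n ℕ.+ n) f + (f (n ℕ.+ n) + f (suc (n ℕ.+ n)))      ≈⟨ +-congʳ (∑-pairs n f) ⟩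
    _ ∎

  ∏-pairs : ∀ n f → ∏< (n ℕ.+ n) f ≈ ∏< n (λ k → f (k ℕ.+ k) * f (suc (k ℕ.+ k)))
  ∏-pairs zero    f = refl
  ∏-pairs (suc n) f = begin
    ∏< (suc n ℕ.+ suc n) f                                  ≡⟨ ≡.cong (λ k → ∏< k f) (double-suc n) ⟩
    ∏< (n ℕ.+ n) f * f (n ℕ.+ n) * f (suc (n ℕ.+ n))        ≈⟨ *-assoc _ _ _ ⟩
    ∏< (n ℕ.+ n) f * (f (n ℕ.+ n) * f (suc (n ℕ.+ n)))      ≈⟨ *-congʳ (∏-pairs n f) ⟩
    _ ∎

  abstract
    ∏-converges : ∀ {w : ℕ → Carrier} → Small (λ _ n → w n) →
      ∃ λ l → (λ n → ∏< n (λ k → 1# + w k)) ⟶ l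
    ∏-converges {w} small =
      let l , p = geo-complete (λ _ → 0) (λ _ → P) (geo-≈ increment (geo-ᵇ* bounded small))
      in l 0 , geo-≈ (λ _ n → solve 2 (λ l s → :- (l :- s) := s :- l) refl (l 0) (P n))
                 (geo-neg (geo-reindex (λ _ _ → 0) (λ _ n → n) p))
      where
      P : ℕ → Carrier
      P n = ∏< n (λ k → 1# + w k)
      bounded : Bounded (λ _ → P)
      bounded = geo-product small (λ _ → refl) (λ _ _ → refl)
      increment : ∀ (_ n : ℕ) → P n * w n ≈ P (suc n) - P n
      increment _ n = solve 2 (λ p w → p :* w := p :* (:1 :+ w) :- p) refl (P n) (w n)

  abstract
    ∑-converges : ∀ (e : ℕ → ℕ) {f : ℕ → ℕ → Carrier} → Geo (λ m n → e m ℕ.+ n) f →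
      ∃ λ (S : ℕ → Carrier) → Geo (λ m n → e m ℕ.+ n) (λ m n → S m - ∑< n (f m))
    ∑-converges e {f} g = geo-complete e (λ m n → ∑< n (f m))
      (geo-≈ (λ m n → solve 2 (λ s f → f := (s :+ f) :- s) refl (∑< n (f m)) (f m n)) g)

  ∑-⟶ : ∀ (e : ℕ → ℕ) {f : ℕ → ℕ → Carrier} {S : ℕ → Carrier} →
    Geo (λ m n → e m ℕ.+ n) (λ m n → S m - ∑< n (f m)) → ∀ m → (λ n → ∑< n (f m)) ⟶ S m
  ∑-⟶ e {f} {S} g m = geo-≈ (λ _ n → solve 2 (λ l s → :- (l :- s) := s :- l) refl (S m) (∑< n (f m)))
    (geo-neg (geo-≤ (λ _ n → ℕₚ.m≤n+m n (e m)) (geo-reindex (λ _ _ → m) (λ _ n → n) g)))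

  telescope : ∀ (c f : ℕ → Carrier) → c 0 ≈ 0# → (∀ n → f n ≈ c (suc n) - c n) →
    ∀ n → ∑< n f ≈ c n
  telescope c f c0 fc zero    = sym c0
  telescope c f c0 fc (suc n) = begin
    ∑< n f + f n             ≈⟨ +-cong (telescope c f c0 fc n) (fc n) ⟩
    c n + (c (suc n) - c n)  ≈⟨ solve 2 (λ a b → a :+ (b :- a) := b) refl (c n) (c (suc n)) ⟩
    c (suc n)                ∎

  -- A first-order recursion in m, certified term by term by the telescoping
  -- sequence c m, carries the sum over f 0 to the sum over the limit g.
  connection : ∀ {f c : ℕ → ℕ → Carrier} {g α β : ℕ → Carrier} →
    Small f → Geo (λ m n → m ℕ.+ n) (λ m n → f m n - g n) →
    Small c → (∀ m → c m 0 ≈ 0#) →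
    (∀ m n → α m * f m n - β m * f (suc m) n ≈ c m (suc n) - c m n) →
    ∀ {A B} → (λ n → ∏< n α) ⟶ A → (λ n → ∏< n β) ⟶ B →
    ∃₂ λ S T → (λ n → ∑< n (f 0)) ⟶ S × (λ n → ∑< n g) ⟶ T × A * S ≈ B * T
  connection {f} {c} {g} {α} {β} small-f f-g small-c c0 certificate {A} {B} ∏α ∏β =
    S 0 , T , f⟶S 0 , g⟶T , ⟶-unique
      (⟶-lim (*-comm (S 0) A) (⟶-scale (S 0) ∏α))
      (⟶-seq (λ n → sym (iterate n)) (⟶-* ∏β S⟶T))
    where
    sums = ∑-converges (λ _ → 0) small-f
    S : ℕ → Carrier
    S = proj₁ sums
    f⟶S : ∀ m → (λ n → ∑< n (f m)) ⟶ S m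
    f⟶S = ∑-⟶ (λ _ → 0) {S = S} (proj₂ sums)
    differences = ∑-converges (λ m → m) f-g
    Δ : ℕ → Carrier
    Δ = proj₁ differences
    d⟶Δ : ∀ m → (λ n → ∑< n (λ k → f m k - g k)) ⟶ Δ m
    d⟶Δ = ∑-⟶ (λ m → m) {S = Δ} (proj₂ differences)
    -- The sum over g is the sum over f m minus the sum of the differences; m = 0 fixes its value,
    -- and by uniqueness of limits every other m gives the same.
    T = S 0 - Δ 0
    g-sum : ∀ m n → ∑< n (f m) - ∑< n (λ k → f m k - g k) ≈ ∑< n g
    g-sum m zero    = -‿inverseʳ 0#
    g-sum m (suc n) = begin
      (a + f m n) - (b + (f m n - g n))
        ≈⟨ solve 4 (λ a b f g → (a :+ f) :- (b :+ (f :- g)) := (a :- b) :+ g) refl a b (f m n) (g n) ⟩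
      (a - b) + g n
        ≈⟨ +-congʳ (g-sum m n) ⟩
      ∑< n g + g n ∎
      where
      a = ∑< n (f m)
      b = ∑< n (λ k → f m k - g k)
    g⟶ : ∀ m → (λ n → ∑< n g) ⟶ S m - Δ m
    g⟶ m = ⟶-seq (g-sum m) (⟶-- (f⟶S m) (d⟶Δ m))
    g⟶T : (λ n → ∑< n g) ⟶ T
    g⟶T = g⟶ 0
    small-Δ : Small (λ _ n → Δ n)
    -- At n = 0 the partial sum is empty, so the bound on the tails bounds Δ m itself by a multiple
    -- of r^m.
    small-Δ = geo-≤ (λ _ n → ℕₚ.m≤m+n n 0)
      (geo-≈ {y = λ _ n → Δ n} (λ _ n → solve 1 (λ x → x :- :0 := x) refl (Δ n))
        (geo-reindex (λ _ n → n) (λ _ _ → 0) (proj₂ differences)))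
    S⟶T : S ⟶ T
    S⟶T = ⟶-cong (λ m → trans (+-congˡ (⟶-unique g⟶T (g⟶ m)))
                          (solve 2 (λ d s → d :+ (s :- d) := s) refl (Δ m) (S m)))
            (+-identityˡ T) (⟶-+ (small⇒⟶0 small-Δ) (⟶-const T))
    -- The partial sums of the termwise recursion telescope to `c m n`, which tends to 0, so the
    -- recursion passes to the sums.
    step : ∀ m → α m * S m ≈ β m * S (suc m)
    step m = begin
      α m * S m                                            ≈⟨ solve 2 (λ a b → a := (a :- b) :+ b) refl _ _ ⟩
      (α m * S m - β m * S (suc m)) + β m * S (suc m)      ≈⟨ +-congʳ (⟶-unique lhs rhs) ⟩
      0# + β m * S (suc m)                                 ≈⟨ +-identityˡ _ ⟩
      β m * S (suc m)                                      ∎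
      where
      lhs : (λ n → α m * ∑< n (f m) - β m * ∑< n (f (suc m))) ⟶ α m * S m - β m * S (suc m)
      lhs = ⟶-- (⟶-scale (α m) (f⟶S m)) (⟶-scale (β m) (f⟶S (suc m)))
      combine : ∀ n → ∑< n (λ k → α m * f m k - β m * f (suc m) k)
              ≈ α m * ∑< n (f m) - β m * ∑< n (f (suc m))
      combine zero    = solve 2 (λ a b → :0 := a :* :0 :- b :* :0) refl (α m) (β m)
      combine (suc n) = trans (+-congʳ (combine n))
        (solve 6 (λ a b x y u v → (a :* x :- b :* y) :+ (a :* u :- b :* v)
                                  := a :* (x :+ u) :- b :* (y :+ v)) refl
          (α m) (β m) (∑< n (f m)) (∑< n (f (suc m))) (f m n) (f (suc m) n))
      rhs : (λ n → α m * ∑< n (f m) - β m * ∑< n (f (suc m))) ⟶ 0#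
      rhs = ⟶-seq (λ n → trans (sym (telescope (c m) _ (c0 m) (certificate m) n)) (combine n))
              (small⇒⟶0 (geo-reindex (λ _ _ → m) (λ _ n → n) small-c))
    iterate : ∀ n → S 0 * ∏< n α ≈ ∏< n β * S n
    iterate zero    = *-comm (S 0) 1#
    iterate (suc n) = begin
      S 0 * (∏< n α * α n)          ≈⟨ *-assoc _ _ _ ⟨
      S 0 * ∏< n α * α n            ≈⟨ *-congʳ (iterate n) ⟩
      ∏< n β * S n * α n            ≈⟨ solve 3 (λ b s a → b :* s :* a := b :* (a :* s)) refl _ _ _ ⟩
      ∏< n β * (α n * S n)          ≈⟨ *-congˡ (step n) ⟩
      ∏< n β * (β n * S (suc n))    ≈⟨ *-assoc _ _ _ ⟨
      ∏< n β * β n * S (suc n)      ∎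

-- q-shifted factorials and uniformly bounded reciprocals

module Pochhammer (R : CommutativeRing 0ℓ 0ℓ) (G : GeometricBounds R) where
  open Limits R G public

  infixl 7 _⊠_
  infixl 6 _⊞_
  _⊞_ : ∀ {x y} → Bounded x → Bounded y → Bounded (λ m n → x m n + y m n)
  _⊞_ = geo-+
  _⊠_ : ∀ {x y} → Bounded x → Bounded y → Bounded (λ m n → x m n * y m n)
  _⊠_ = geo-*
  ⌜_⌝ : ∀ a → Bounded (λ _ _ → a)
  ⌜_⌝ = geo-const

  ^-cong : ∀ {x y} n → x ≈ y → x ^ n ≈ y ^ n
  ^-cong zero    x≈y = refl
  ^-cong (suc n) x≈y = *-cong (^-cong n x≈y) x≈y

  ^-homo-* : ∀ x m n → x ^ (m ℕ.+ n) ≈ x ^ m * x ^ n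
  ^-homo-* x zero    n = sym (*-identityˡ _)
  ^-homo-* x (suc m) n = begin
    x ^ (m ℕ.+ n) * x      ≈⟨ *-congʳ (^-homo-* x m n) ⟩
    x ^ m * x ^ n * x      ≈⟨ solve 3 (λ a b x → a :* b :* x := a :* x :* b) refl _ _ x ⟩
    x ^ m * x * x ^ n      ∎

  ^-assocʳ : ∀ x m n → (x ^ m) ^ n ≈ x ^ (n ℕ.* m)
  ^-assocʳ x m zero    = refl
  ^-assocʳ x m (suc n) = begin
    (x ^ m) ^ n * x ^ m      ≈⟨ *-comm _ _ ⟩
    x ^ m * (x ^ m) ^ n      ≈⟨ *-congˡ (^-assocʳ x m n) ⟩
    x ^ m * x ^ (n ℕ.* m)    ≈⟨ ^-homo-* x m (n ℕ.* m) ⟨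
    x ^ (m ℕ.+ n ℕ.* m)      ∎

  ^-distrib-* : ∀ x y n → (x * y) ^ n ≈ x ^ n * y ^ n
  ^-distrib-* x y zero    = sym (*-identityˡ 1#)
  ^-distrib-* x y (suc n) = trans (*-congʳ (^-distrib-* x y n))
    (solve 4 (λ a b x y → a :* b :* (x :* y) := a :* x :* (b :* y)) refl _ _ x y)

  ^-square : ∀ x n → (x * x) ^ n ≈ x ^ n * x ^ n
  ^-square x = ^-distrib-* x x

  ^-double : ∀ x n → x ^ (n ℕ.+ n) ≈ (x * x) ^ n
  ^-double x n = trans (^-homo-* x n n) (sym (^-square x n))

  -- The form in which ∣p∣ < 1 enters the limit arguments.
  Base : Carrier → Set
  Base p = Small (λ _ n → p ^ n)

  CubicRelation IsHalf : Carrier → Set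
  CubicRelation ω = 1# + ω + ω * ω ≈ 0#
  IsHalf x = x + x ≈ 1#

  InvertsFactors : Carrier → (ℕ → Carrier) → Set
  InvertsFactors p i = ∀ k → (1# - p ^ suc k) * i k ≈ 1#

  poch : Carrier → Carrier → ℕ → Carrier
  poch a p n = ∏< n (λ k → 1# - a * p ^ k)

  abstract
    poch-converges : ∀ {p} → Base p → ∀ a → ∃ λ l → poch a p ⟶ l
    poch-converges base a = ∏-converges (geo-neg (geo-ᵇ* ⌜ a ⌝ base))

  poch-cong : ∀ {a b p r} n → a ≈ b → p ≈ r → poch a p n ≈ poch b r n
  poch-cong n a≈b p≈r = ∏-cong n (λ k → +-congˡ (-‿cong (*-cong a≈b (^-cong k p≈r))))

  poch-split : ∀ a p n → poch a p (n ℕ.+ n) ≈ poch a (p * p) n * poch (a * p) (p * p) n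
  poch-split a p n = begin
    poch a p (n ℕ.+ n)
      ≈⟨ ∏-pairs n (λ k → 1# - a * p ^ k) ⟩
    ∏< n (λ k → (1# - a * p ^ (k ℕ.+ k)) * (1# - a * p ^ suc (k ℕ.+ k)))
      ≈⟨ ∏-cong n (λ k → *-cong (+-congˡ (-‿cong (*-congˡ (^-double p k))))
          (+-congˡ (-‿cong (trans (*-congˡ (*-congʳ (^-double p k)))
            (solve 3 (λ a x p → a :* (x :* p) := a :* p :* x) refl a _ p))))) ⟩
    ∏< n (λ k → (1# - a * (p * p) ^ k) * (1# - a * p * (p * p) ^ k))
      ≈⟨ ∏-* n _ _ ⟩
    poch a (p * p) n * poch (a * p) (p * p) n ∎

  poch-square : ∀ a p n → poch a p n * poch (- a) p n ≈ poch (a * a) (p * p) n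
  poch-square a p n = trans (sym (∏-* n _ _)) (∏-cong n λ k → begin
    (1# - a * p ^ k) * (1# - - a * p ^ k)
      ≈⟨ solve 2 (λ a x → (:1 :- a :* x) :* (:1 :- (:- a) :* x) := :1 :- a :* a :* (x :* x)) refl a (p ^ k) ⟩
    1# - a * a * (p ^ k * p ^ k)
      ≈⟨ +-congˡ (-‿cong (*-congˡ (^-square p k))) ⟨
    1# - a * a * (p * p) ^ k ∎)

  cancelˡ : ∀ {a i x y} → a * i ≈ 1# → a * x ≈ a * y → x ≈ y
  cancelˡ {a} {i} {x} {y} ai eq = begin
    x              ≈⟨ *-identityˡ x ⟨
    1# * x         ≈⟨ *-congʳ ai ⟨
    a * i * x      ≈⟨ solve 3 (λ a i x → a :* i :* x := i :* (a :* x)) refl a i x ⟩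
    i * (a * x)    ≈⟨ *-congˡ eq ⟩
    i * (a * y)    ≈⟨ solve 3 (λ a i x → i :* (a :* x) := a :* i :* x) refl a i y ⟩
    a * i * y      ≈⟨ *-congʳ ai ⟩
    1# * y         ≈⟨ *-identityˡ y ⟩
    y              ∎

  -- Reciprocals are carried as explicit witnesses; this plays the role of congruence for inversion.
  inverse-unique : ∀ {a b i j} → a ≈ b → a * i ≈ 1# → b * j ≈ 1# → i ≈ j
  inverse-unique a≈b ai bj = cancelˡ ai (trans ai (sym (trans (*-congʳ a≈b) bj)))

  -- If the factors 1 − x_k have uniformly bounded inverses and x_k is
  -- small, then ∏ (1 − x_k) is invertible with inverse ∏ (1 + x_k i_k).
  abstract
    ∏-invertible : ∀ {x i : ℕ → Carrier} {l} → Small (λ _ → x) → Bounded (λ _ → i) →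
      (∀ k → (1# - x k) * i k ≈ 1#) → (λ n → ∏< n (λ k → 1# - x k)) ⟶ l →
      ∃ λ l′ → l * l′ ≈ 1#
    ∏-invertible {x} {i} {l} small bounded inv conv =
      let l′ , conv′ = ∏-converges (geo-*ᵇ small bounded)
      in l′ , ⟶-unique (⟶-* conv conv′) (⟶-seq (λ n → sym (one n)) (⟶-const 1#))
      where
      one : ∀ n → ∏< n (λ k → 1# - x k) * ∏< n (λ k → 1# + x k * i k) ≈ 1#
      one n = trans (sym (∏-* n _ _)) (∏-1 n λ k → begin
        (1# - x k) * (1# + x k * i k)
          ≈⟨ solve 2 (λ x i → (:1 :- x) :* (:1 :+ x :* i) := (:1 :- x) :+ x :* ((:1 :- x) :* i)) refl (x k) (i k) ⟩
        (1# - x k) + x k * ((1# - x k) * i k)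
          ≈⟨ +-congˡ (*-congˡ (inv k)) ⟩
        (1# - x k) + x k * 1#
          ≈⟨ solve 1 (λ x → (:1 :- x) :+ x :* :1 := :1) refl (x k) ⟩
        1# ∎)

  ∏-inverse : ∀ n {x i : ℕ → Carrier} → (∀ k → x k * i k ≈ 1#) → ∏< n x * ∏< n i ≈ 1#
  ∏-inverse n xi = trans (sym (∏-* n _ _)) (∏-1 n xi)

  small-∏ : ∀ {ρ : ℕ → ℕ → Carrier} → Small ρ → Small (λ m n → ∏< n (ρ m))
  small-∏ {ρ} small = geo-recursion (λ _ → 0) {u = λ _ _ → 0#} (geo-const 1#) geo-0 small
    (λ m n → sym (+-identityˡ _))

  -- One step of the index costs only a constant factor.
  small-suc : ∀ {x : ℕ → ℕ → Carrier} → (∀ m → x m 0 ≈ 0#) → Small (λ m n → x m (suc n)) → Small x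
  small-suc {x} x0 small = geo-recursion (λ _ → 0) {u = λ m n → x m (suc n)} {σ = λ _ _ → 0#}
    (geo-≈ (λ m _ → sym (x0 m)) geo-0) small geo-0
    (λ m n → sym (trans (+-congˡ (zeroʳ _)) (+-identityʳ _)))

  -- By f ρ - g σ = f (ρ - σ) + (f - g) σ. In the forcing term f (ρ - σ) the product supplies the
  -- rate in n and the difference of factors the rate in m.
  product-difference : ∀ {ρ : ℕ → ℕ → Carrier} {σ : ℕ → Carrier} →
    Small ρ → Small (λ _ → σ) → Small₁ (λ m n → ρ m n - σ n) →
    Geo (λ m n → m ℕ.+ n) (λ m n → ∏< n (ρ m) - ∏< n σ)
  product-difference {ρ} {σ} small-ρ small-σ ρ-σ =
    geo-recursion (λ m → m) {u = λ m n → ∏< n (ρ m) * (ρ m n - σ n)} {σ = λ _ → σ}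
      (geo-≈ (λ _ _ → sym (-‿inverseʳ 1#)) geo-0)
      (geo-≤ (λ m n → ℕₚ.≤-reflexive (ℕₚ.+-comm m n)) (geo-* (small-∏ small-ρ) ρ-σ))
      small-σ
      (λ m n → solve 4 (λ f g ρ σ → f :* ρ :- g :* σ := f :* (ρ :- σ) :+ (f :- g) :* σ) refl
        (∏< n (ρ m)) (∏< n σ) (ρ m n) (σ n))

  small₁-* : ∀ {p} {x b : ℕ → ℕ → Carrier} → Base p → Bounded b →
    (∀ m n → p ^ m * b m n ≈ x m n) → Small₁ x
  small₁-* base b eq = geo-≈ eq (geo-*ᵇ (geo-reindex (λ m _ → m) (λ m _ → m) base) b)

  module Inverses (q : Carrier) (base : Base q) where
    -- The inverse of 1 - q^(j+1) is a geometric series. Its bound is uniform in j because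
    -- (q^(j+1))^n = q^(n(j+1)) and n(j+1) ≥ n.
    geometric′ : ∃ λ (u : ℕ → Carrier) → Bounded (λ m _ → u m) × (∀ j → (1# - q ^ suc j) * u j ≈ 1#)
    geometric′ = u , bounded-u , λ j → ⟶-unique
        (⟶-scale (1# - q ^ suc j) (∑-⟶ (λ _ → 0) {S = u} (proj₂ sums) j))
        (⟶-seq (partial j) (⟶-lim (solve 0 (:1 :- :0 := :1) refl)
          (⟶-- (⟶-const 1#) (small⇒⟶0 (geo-reindex (λ _ _ → j) (λ _ n → n) powers)))))
      where
      powers : Small (λ j n → (q ^ suc j) ^ n)
      powers = geo-≈ (λ j n → sym (^-assocʳ q (suc j) n))
        (geo-≤ (λ j n → ℕₚ.m≤m*n n (suc j)) (geo-reindex (λ m _ → m) (λ j n → n ℕ.* suc j) base))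
      sums : ∃ λ (S : ℕ → Carrier) →
        Small (λ j n → S j - ∑< n (λ k → (q ^ suc j) ^ k))
      sums = ∑-converges (λ _ → 0) powers
      u : ℕ → Carrier
      u = proj₁ sums
      bounded-u : Bounded (λ m _ → u m)
      -- The bound on the tails, taken at n = 0 where nothing has been summed yet.
      bounded-u = geo-≈ (λ m _ → solve 1 (λ x → x :- :0 := x) refl (u m))
        (geo-reindex (λ m _ → m) (λ _ _ → 0) (proj₂ sums))
      partial : ∀ j n → 1# - (q ^ suc j) ^ n ≈ (1# - q ^ suc j) * ∑< n (λ k → (q ^ suc j) ^ k)
      partial j zero    = solve 1 (λ p → :1 :- :1 := (:1 :- p) :* :0) refl (q ^ suc j)
      partial j (suc n) = begin
        1# - p ^ n * p
          ≈⟨ solve 2 (λ p x → :1 :- x :* p := (:1 :- x) :+ (:1 :- p) :* x) refl p (p ^ n) ⟩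
        (1# - p ^ n) + (1# - p) * p ^ n
          ≈⟨ +-congʳ (partial j n) ⟩
        (1# - p) * ∑< n (p ^_) + (1# - p) * p ^ n
          ≈⟨ distribˡ _ _ _ ⟨
        (1# - p) * (∑< n (p ^_) + p ^ n) ∎
        where
        p = q ^ suc j

    abstract
      geometric : ∃ λ (u : ℕ → Carrier) → Bounded (λ m _ → u m) × (∀ j → (1# - q ^ suc j) * u j ≈ 1#)
      geometric = geometric′

    sixth : Carrier → Carrier
    sixth x = x * x * x * (x * x * x)

    -- x is a sixth root of q^e; twists of powers of q by sixth roots of
    -- unity are treated uniformly through 1/(1−x) = (1+x+⋯+x⁵)/(1−x⁶).
    record Sixth (x : Carrier) (e : ℕ) : Set where
      constructor mkSixth
      field sixth≈ : sixth x ≈ q ^ e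
    open Sixth

    abstract
      sixth-* : ∀ {x y e f} → Sixth x e → Sixth y f → Sixth (x * y) (e ℕ.+ f)
      sixth-* {x} {y} {e} {f} (mkSixth sx) (mkSixth sy) = mkSixth (begin
        sixth (x * y)        ≈⟨ solve 2 (λ x y → let z = x :* y in z :* z :* z :* (z :* z :* z)
                                  := x :* x :* x :* (x :* x :* x) :* (y :* y :* y :* (y :* y :* y))) refl x y ⟩
        sixth x * sixth y    ≈⟨ *-cong sx sy ⟩
        q ^ e * q ^ f        ≈⟨ ^-homo-* q e f ⟨
        q ^ (e ℕ.+ f)        ∎)

    abstract
      sixth-q : Sixth q 6
      sixth-q = mkSixth (solve 1 (λ q → q :* q :* q :* (q :* q :* q) := :1 :* q :* q :* q :* q :* q :* q) refl q)

    abstract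
      sixth-1 : Sixth 1# 0
      sixth-1 = mkSixth (solve 0 (:1 :* :1 :* :1 :* (:1 :* :1 :* :1) := :1) refl)

    abstract
      sixth-^ : ∀ {x e} → Sixth x e → ∀ n → ∃ λ f → Sixth (x ^ n) f
      sixth-^ sx zero    = 0 , sixth-1
      sixth-^ sx (suc n) = let f , sf = sixth-^ sx n in _ , sixth-* sf sx

    -- With x = q a, `cubes x` is 1 + x + ⋯ + x⁵. The explicit factor q makes x⁶ a positive power of
    -- q, the case that `geometric` inverts.
    inverses′ : ∀ {a : ℕ → ℕ → Carrier} → (∀ m n → ∃ λ e → Sixth (a m n) e) → Bounded a →
      ∃ λ (i : ℕ → ℕ → Carrier) → Bounded i × (∀ m n → (1# - q * a m n) * i m n ≈ 1#)
    inverses′ {a} sa bounded = i , bounded-i , inv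
      where
      u : ℕ → Carrier
      u = proj₁ geometric
      cubes : Carrier → Carrier
      cubes x = (1# + x * x * x) * (1# + x + x * x)
      e : ℕ → ℕ → ℕ
      -- Here x⁶ = q^(6+f), where f is the exponent found for a, and `geometric` is indexed by the
      -- exponent minus one.
      e m n = 5 ℕ.+ proj₁ (sa m n)
      i : ℕ → ℕ → Carrier
      i m n = cubes (q * a m n) * u (e m n)
      qa : Bounded (λ m n → q * a m n)
      qa = ⌜ q ⌝ ⊠ bounded
      bounded-i : Bounded i
      bounded-i = (⌜ 1# ⌝ ⊞ qa ⊠ qa ⊠ qa) ⊠ (⌜ 1# ⌝ ⊞ qa ⊞ qa ⊠ qa)
        ⊠ geo-reindex e (λ _ n → n) (proj₁ (proj₂ geometric))
      inv : ∀ m n → (1# - q * a m n) * i m n ≈ 1#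
      inv m n = begin
        (1# - x) * (cubes x * u (e m n))
          ≈⟨ solve 2 (λ x u → (:1 :- x) :* ((:1 :+ x :* x :* x) :* (:1 :+ x :+ x :* x) :* u)
               := (:1 :- x :* x :* x :* (x :* x :* x)) :* u) refl x (u (e m n)) ⟩
        (1# - sixth x) * u (e m n)
          ≈⟨ *-congʳ (+-congˡ (-‿cong (sixth≈ (sixth-* sixth-q (proj₂ (sa m n)))))) ⟩
        (1# - q ^ suc (e m n)) * u (e m n)
          ≈⟨ proj₂ (proj₂ geometric) (e m n) ⟩
        1# ∎
        where
        x = q * a m n

    abstract
      inverses : ∀ {a : ℕ → ℕ → Carrier} → (∀ m n → ∃ λ e → Sixth (a m n) e) → Bounded a →
        ∃ λ (i : ℕ → ℕ → Carrier) → Bounded i × (∀ m n → (1# - q * a m n) * i m n ≈ 1#)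
      inverses = inverses′

-- The series in x whose value at x = ω is ∑ b_n

module FirstSum (R : CommutativeRing 0ℓ 0ℓ) (G : GeometricBounds R)
  (q : CommutativeRing.Carrier R) (base : Pochhammer.Base R G q) where
  open Pochhammer R G
  open Inverses q base

  -- Clears denominators: to the solver a reciprocal is an opaque variable, so 1 is inserted as a
  -- product of factors and their reciprocals where both sides need a common denominator.
  ones : ∀ {a b} z → a ≈ 1# → b ≈ 1# → z ≈ a * b * z
  ones {a} {b} z a1 b1 = sym (trans (*-congʳ (*-cong a1 b1))
    (solve 1 (λ z → :1 :* :1 :* z := z) refl z))

  bounded-q^ˡ : Bounded (λ m _ → q ^ m)
  bounded-q^ˡ = geo-reindex (λ m _ → m) (λ m _ → m) (geo-bounded base)
  bounded-q^ : Bounded (λ _ n → q ^ n)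
  bounded-q^ = geo-bounded base

  abstract
    cube : ∃ λ (i : ℕ → ℕ → Carrier) → Bounded i ×
      (∀ m n → (1# - q * (q * q * (q ^ n * q ^ n * q ^ n))) * i m n ≈ 1#)
    cube = inverses
      (λ _ n → let s = proj₂ (sixth-^ sixth-q n)
               in _ , sixth-* (sixth-* sixth-q sixth-q) (sixth-* (sixth-* s s) s))
      (⌜ q ⌝ ⊠ ⌜ q ⌝ ⊠ (bounded-q^ ⊠ bounded-q^ ⊠ bounded-q^))

  i₃ : ℕ → Carrier
  i₃ = proj₁ cube 0
  i₃-inverse : ∀ n → (1# - q * (q * q * (q ^ n * q ^ n * q ^ n))) * i₃ n ≈ 1#
  i₃-inverse = proj₂ (proj₂ cube) 0
  bounded-i₃ : Bounded (λ _ n → i₃ n)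
  bounded-i₃ = geo-reindex (λ _ _ → 0) (λ _ n → n) (proj₁ (proj₂ cube))

  -- At y = q^n, the term ratio of ∑ (-x;q)_n (x+q²)(x+q⁴)⋯(x+q^(2n)) q^(n(n+1)/2) / ((qx²;q²)_n
  -- (q³;q³)_n), where i and j stand for 1/(1 - qx²y²) and 1/(1 - q³y³).
  rho : (x y i j : Carrier) → Carrier
  rho x y i j = (1# + x * y) * (x + q * q * (y * y)) * (q * y) * (i * j)

  rho-cong : ∀ {x x′ y i i′ j} → x ≈ x′ → i ≈ i′ → rho x y i j ≈ rho x′ y i′ j
  rho-cong x≈ i≈ =
    *-cong (*-congʳ (*-cong (+-congˡ (*-congʳ x≈)) (+-congʳ x≈))) (*-congʳ i≈)

  -- The term ratio at x = 0, where the series becomes ∑ q^(3n(n+1)/2) / (q³;q³)_n.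
  σ : ℕ → Carrier
  σ n = q * q * (q ^ n * q ^ n) * (q * q ^ n) * i₃ n

  small-qy : Small (λ _ n → q * q ^ n)
  small-qy = geo-ᵇ* ⌜ q ⌝ base

  module _ (c : Carrier) (c-sixth : Sixth c 0) where

    -- The start c is a sixth root of unity, so that `inverses` covers every denominator; the values
    -- used are -1 and ω.
    x : ℕ → Carrier
    x m = c * (q ^ m * q ^ m)

    bounded-x : Bounded (λ m _ → x m)
    bounded-x = ⌜ c ⌝ ⊠ (bounded-q^ˡ ⊠ bounded-q^ˡ)

    sixth-x : ∀ m → ∃ λ e → Sixth (x m) e
    sixth-x m = let s = proj₂ (sixth-^ sixth-q m) in _ , sixth-* c-sixth (sixth-* s s)

    abstract
      quadratic : ∃ λ (i : ℕ → ℕ → Carrier) → Bounded i ×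
        (∀ m n → (1# - q * (x m * x m * (q ^ n * q ^ n))) * i m n ≈ 1#)
      quadratic = inverses
        (λ m n → let s = proj₂ (sixth-x m) ; t = proj₂ (sixth-^ sixth-q n)
                 in _ , sixth-* (sixth-* s s) (sixth-* t t))
        (bounded-x ⊠ bounded-x ⊠ (bounded-q^ ⊠ bounded-q^))

    i₂ : ℕ → ℕ → Carrier
    i₂ = proj₁ quadratic
    i₂-inverse : ∀ m n → (1# - q * (x m * x m * (q ^ n * q ^ n))) * i₂ m n ≈ 1#
    i₂-inverse = proj₂ (proj₂ quadratic)

    ρ b : ℕ → ℕ → Carrier
    ρ m k = rho (x m) (q ^ k) (i₂ m k) (i₃ k)
    b m n = ∏< n (ρ m)

    -- Coefficients of the recursion α B(x) = β B(q²x), where B is the series as a function of x,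
    -- taken at x = `x m`.
    α β : ℕ → Carrier
    α m = (1# - q * (x m * x m)) * (1# - q * q * q * (x m * x m))
    β m = (1# + q * x m) * (1# + q * q * q * (x m * x m * x m))

    small-ρ : Small ρ
    small-ρ = geo-*ᵇ (geo-ᵇ* ((⌜ 1# ⌝ ⊞ bounded-x ⊠ bounded-q^)
        ⊠ (bounded-x ⊞ ⌜ q ⌝ ⊠ ⌜ q ⌝ ⊠ (bounded-q^ ⊠ bounded-q^))) small-qy)
      (proj₁ (proj₂ quadratic) ⊠ bounded-i₃)

    small-σ : Small (λ _ → σ)
    small-σ = geo-*ᵇ (geo-ᵇ* (⌜ q ⌝ ⊠ ⌜ q ⌝ ⊠ (bounded-q^ ⊠ bounded-q^)) small-qy) bounded-i₃

    ρ-σ : Small₁ (λ m n → ρ m n - σ n)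
    -- The ratios agree at x = 0. Once σ is multiplied by (1 - qx²y²) i₂ = 1, the difference is
    -- divisible by x, and one of the two factors q^m of x gives the decay.
    ρ-σ = small₁-*
      {b = λ m n → c * q ^ m * ((1# + q ^ n * (x m + q * q * (q ^ n * q ^ n))) * i₂ m n
                    + q * q * (q ^ n * q ^ n) * (x m * q * (q ^ n * q ^ n)) * i₂ m n)
                   * (q * q ^ n * i₃ n)} base
      (⌜ c ⌝ ⊠ bounded-q^ˡ ⊠ ((⌜ 1# ⌝ ⊞ bounded-q^ ⊠ (bounded-x ⊞ qqyy)) ⊠ bounded-i₂
          ⊞ qqyy ⊠ (bounded-x ⊠ ⌜ q ⌝ ⊠ (bounded-q^ ⊠ bounded-q^)) ⊠ bounded-i₂)
        ⊠ (⌜ q ⌝ ⊠ bounded-q^ ⊠ bounded-i₃))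
      λ m n → let X = q ^ m ; y = q ^ n in begin
        X * (c * X * ((1# + y * (x m + q * q * (y * y))) * i₂ m n
          + q * q * (y * y) * (x m * q * (y * y)) * i₂ m n) * (q * y * i₃ n))
          ≈⟨ solve 6 (λ c X y q i j → let x = c :* (X :* X) in
               X :* (c :* X :* ((:1 :+ y :* (x :+ q :* q :* (y :* y))) :* i
                 :+ q :* q :* (y :* y) :* (x :* q :* (y :* y)) :* i) :* (q :* y :* j))
               := (:1 :+ x :* y) :* (x :+ q :* q :* (y :* y)) :* (q :* y) :* (i :* j)
                  :- q :* q :* (y :* y) :* (q :* y) :* j :* ((:1 :- q :* (x :* x :* (y :* y))) :* i)) refl
               c X y q (i₂ m n) (i₃ n) ⟩
        ρ m n - σ n * ((1# - q * (x m * x m * (y * y))) * i₂ m n)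
          ≈⟨ +-congˡ (-‿cong (trans (*-congˡ (i₂-inverse m n)) (*-identityʳ _))) ⟩
        ρ m n - σ n ∎
      where
      bounded-i₂ : Bounded i₂
      bounded-i₂ = proj₁ (proj₂ quadratic)
      qqyy : Bounded (λ _ n → q * q * (q ^ n * q ^ n))
      qqyy = ⌜ q ⌝ ⊠ ⌜ q ⌝ ⊠ (bounded-q^ ⊠ bounded-q^)

    x-suc : ∀ m → x (suc m) ≈ q * q * x m
    x-suc m = solve 3 (λ c X q → c :* (X :* q :* (X :* q)) := q :* q :* (c :* (X :* X))) refl c (q ^ m) q

    -- The product x²y² gains the same factor q⁴ from x ↦ q²x as from y ↦ q²y.
    i₂-suc : ∀ m k → i₂ (suc m) k ≈ i₂ m (suc (suc k))
    i₂-suc m k = inverse-unique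
      (solve 4 (λ c X q y → let x = c :* (X :* X) ; x′ = c :* (X :* q :* (X :* q)) ; y″ = y :* q :* q in
        :1 :- q :* (x′ :* x′ :* (y :* y)) := :1 :- q :* (x :* x :* (y″ :* y″))) refl c (q ^ m) q (q ^ k))
      (i₂-inverse (suc m) k) (i₂-inverse m (suc (suc k)))

    ρ-suc : ∀ m k → ρ (suc m) k ≈ rho (q * q * x m) (q ^ k) (i₂ m (suc (suc k))) (i₃ k)
    ρ-suc m k = rho-cong (x-suc m) (i₂-suc m k)

    α-unit : ∀ m z → z ≈ α m * (i₂ m 0 * i₂ m 1) * z
    α-unit m z = trans (ones z (i₂-inverse m 0) (i₂-inverse m 1))
      (solve 5 (λ q x i j z → (:1 :- q :* (x :* x :* (:1 :* :1))) :* i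
          :* ((:1 :- q :* (x :* x :* (:1 :* q :* (:1 :* q)))) :* j) :* z
        := (:1 :- q :* (x :* x)) :* (:1 :- q :* q :* q :* (x :* x)) :* (i :* j) :* z) refl
        q (x m) (i₂ m 0) (i₂ m 1) z)

    -- Replacing x by q²x moves (-x;q) and (qx²;q²) by two places and the product of the x + q^(2k)
    -- by one. The new factor q²(x + 1) cancels the 1 + x lost from (-x;q), so that only 1 + qx
    -- remains on the left.
    shifted : ∀ m n → let X = x m ; y = q ^ n in
      (1# + q * X) * b (suc m) (suc n)
      ≈ α m * b m n * ((1# + X * y) * (1# + X * (y * q)) * (1# + X * (y * q * q)))
        * (q * q * q * (y * y * y)) * (i₂ m n * i₂ m (suc n) * i₂ m (suc (suc n)) * i₃ n)
    shifted m zero = begin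
      (1# + q * x m) * (1# * ρ (suc m) 0)
        ≈⟨ *-congˡ (*-congˡ (ρ-suc m 0)) ⟩
      (1# + q * x m) * (1# * rho (q * q * x m) 1# (i₂ m 2) (i₃ 0))
        ≈⟨ α-unit m _ ⟩
      α m * (i₂ m 0 * i₂ m 1) * ((1# + q * x m) * (1# * rho (q * q * x m) 1# (i₂ m 2) (i₃ 0)))
        ≈⟨ solve 7 (λ a q x i i′ i″ j →
             a :* (i :* i′) :* ((:1 :+ q :* x) :* (:1 :* ((:1 :+ q :* q :* x :* :1)
               :* (q :* q :* x :+ q :* q :* (:1 :* :1)) :* (q :* :1) :* (i″ :* j))))
             := a :* :1 :* ((:1 :+ x :* :1) :* (:1 :+ x :* (:1 :* q)) :* (:1 :+ x :* (:1 :* q :* q)))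
                :* (q :* q :* q :* (:1 :* :1 :* :1)) :* (i :* i′ :* i″ :* j)) refl
             (α m) q (x m) (i₂ m 0) (i₂ m 1) (i₂ m 2) (i₃ 0) ⟩
      _ ∎
    shifted m (suc n) = begin
      (1# + q * X) * (b (suc m) (suc n) * ρ (suc m) (suc n))
        ≈⟨ *-assoc _ _ _ ⟨
      (1# + q * X) * b (suc m) (suc n) * ρ (suc m) (suc n)
        ≈⟨ *-cong (shifted m n) (ρ-suc m (suc n)) ⟩
      _ * rho (q * q * X) (y * q) (i₂ m (suc (suc (suc n)))) (i₃ (suc n))
        ≈⟨ solve 11 (λ a b q x y i i′ i″ i‴ j k →
             a :* b :* ((:1 :+ x :* y) :* (:1 :+ x :* (y :* q)) :* (:1 :+ x :* (y :* q :* q)))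
               :* (q :* q :* q :* (y :* y :* y)) :* (i :* i′ :* i″ :* k)
               :* ((:1 :+ q :* q :* x :* (y :* q)) :* (q :* q :* x :+ q :* q :* (y :* q :* (y :* q)))
                   :* (q :* (y :* q)) :* (i‴ :* j))
             := a :* (b :* ((:1 :+ x :* y) :* (x :+ q :* q :* (y :* y)) :* (q :* y) :* (i :* k)))
               :* ((:1 :+ x :* (y :* q)) :* (:1 :+ x :* (y :* q :* q)) :* (:1 :+ x :* (y :* q :* q :* q)))
               :* (q :* q :* q :* (y :* q :* (y :* q) :* (y :* q))) :* (i′ :* i″ :* i‴ :* j)) refl
             (α m) (b m n) q X y (i₂ m n) (i₂ m (suc n)) (i₂ m (suc (suc n)))
             (i₂ m (suc (suc (suc n)))) (i₃ (suc n)) (i₃ n) ⟩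
      _ ∎
      where
      X = x m
      y = q ^ n

    -- The certificate of creative telescoping: a rational multiple of the preceding term, with
    -- boundary value 0.
    remainder : ℕ → ℕ → Carrier
    remainder m zero    = 0#
    remainder m (suc n) = - (α m * (X * q * y * (1# + X * y) * (1# + X * (y * q * q)))
        * (i₂ m n * i₂ m (suc n)) * b m n)
      where
      X = x m
      y = q ^ n

    -- What is left of the certificate once the factors common to all terms are removed. Multiplying
    -- by denominators times their reciprocals turns it into a polynomial identity.
    core : ∀ m n → let X = x m ; y = q ^ n in
      (X + q * q * (y * y)) * i₃ n
        - (1# + q * q * q * (X * X * X)) * (1# + X * (y * q)) * (1# + X * (y * q * q))
          * (q * q * (y * y)) * (i₂ m (suc n) * i₂ m (suc (suc n)) * i₃ n)
      ≈ X * (1# + X * (y * q * q)) * i₂ m (suc n)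
        - X * q * (y * q) * (1# + X * (y * q)) * (1# + X * (y * q * q * q))
          * (i₂ m (suc n) * i₂ m (suc (suc n))) * ((X + q * q * (y * y)) * i₃ n)
    core m n = begin
      (X + q * q * (y * y)) * k - P * (i * j * k)
        ≈⟨ +-congʳ (ones _ (i₂-inverse m (suc n)) (i₂-inverse m (suc (suc n)))) ⟩
      _
        ≈⟨ solve 6 (λ x y q i j k →
             (:1 :- q :* (x :* x :* (y :* q :* (y :* q)))) :* i
               :* ((:1 :- q :* (x :* x :* (y :* q :* q :* (y :* q :* q)))) :* j)
               :* ((x :+ q :* q :* (y :* y)) :* k)
             :- (:1 :+ q :* q :* q :* (x :* x :* x)) :* (:1 :+ x :* (y :* q)) :* (:1 :+ x :* (y :* q :* q))
                :* (q :* q :* (y :* y)) :* (i :* j :* k)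
             := (:1 :- q :* (x :* x :* (y :* q :* q :* (y :* q :* q)))) :* j
               :* ((:1 :- q :* (q :* q :* (y :* y :* y))) :* k) :* (x :* (:1 :+ x :* (y :* q :* q)) :* i)
             :- x :* q :* (y :* q) :* (:1 :+ x :* (y :* q)) :* (:1 :+ x :* (y :* q :* q :* q))
               :* (i :* j) :* ((x :+ q :* q :* (y :* y)) :* k)) refl X y q i j k ⟩
      _
        ≈⟨ +-congʳ (ones _ (i₂-inverse m (suc (suc n))) (i₃-inverse n)) ⟨
      _ ∎
      where
      X = x m
      y = q ^ n
      i = i₂ m (suc n)
      j = i₂ m (suc (suc n))
      k = i₃ n
      P = (1# + q * q * q * (X * X * X)) * (1# + X * (y * q)) * (1# + X * (y * q * q)) * (q * q * (y * y))

    certificate : ∀ m n → α m * b m n - β m * b (suc m) n ≈ remainder m (suc n) - remainder m n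
    certificate m zero = begin
      α m * 1# - β m * 1#
        ≈⟨ solve 2 (λ q x → (:1 :- q :* (x :* x)) :* (:1 :- q :* q :* q :* (x :* x)) :* :1
             :- (:1 :+ q :* x) :* (:1 :+ q :* q :* q :* (x :* x :* x)) :* :1
             := :- (x :* q :* :1 :* (:1 :+ x :* :1) :* (:1 :+ x :* (:1 :* q :* q)))) refl q (x m) ⟩
      - (x m * q * 1# * (1# + x m * 1#) * (1# + x m * (1# * q * q)))
        ≈⟨ -‿cong (α-unit m _) ⟩
      - (α m * (i₂ m 0 * i₂ m 1) * (x m * q * 1# * (1# + x m * 1#) * (1# + x m * (1# * q * q))))
        ≈⟨ solve 3 (λ a i z → :- (a :* i :* z) := :- (a :* z :* i :* :1) :- :0) refl _ _ _ ⟩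
      remainder m 1 - 0# ∎
    certificate m (suc n) = begin
      α m * (b m n * ρ m n) - β m * b (suc m) (suc n)
        ≈⟨ +-congˡ (-‿cong (trans (solve 3 (λ u v w → u :* v :* w := v :* (u :* w)) refl _ _ _)
             (*-congˡ (shifted m n)))) ⟩
      _
        ≈⟨ solve 9 (λ a b q x y h i j k →
             a :* (b :* ((:1 :+ x :* y) :* (x :+ q :* q :* (y :* y)) :* (q :* y) :* (h :* k)))
             :- (:1 :+ q :* q :* q :* (x :* x :* x)) :* (a :* b
               :* ((:1 :+ x :* y) :* (:1 :+ x :* (y :* q)) :* (:1 :+ x :* (y :* q :* q)))
               :* (q :* q :* q :* (y :* y :* y)) :* (h :* i :* j :* k))
             := a :* b :* (:1 :+ x :* y) :* (q :* y) :* h :*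
               ((x :+ q :* q :* (y :* y)) :* k
                :- (:1 :+ q :* q :* q :* (x :* x :* x)) :* (:1 :+ x :* (y :* q)) :* (:1 :+ x :* (y :* q :* q))
                  :* (q :* q :* (y :* y)) :* (i :* j :* k))) refl
             (α m) (b m n) q X y h i j k ⟩
      α m * b m n * (1# + X * y) * (q * y) * h * _
        ≈⟨ *-congˡ (core m n) ⟩
      α m * b m n * (1# + X * y) * (q * y) * h * _
        ≈⟨ solve 9 (λ a b q x y h i j k →
             a :* b :* (:1 :+ x :* y) :* (q :* y) :* h :*
               (x :* (:1 :+ x :* (y :* q :* q)) :* i
                :- x :* q :* (y :* q) :* (:1 :+ x :* (y :* q)) :* (:1 :+ x :* (y :* q :* q :* q))
                  :* (i :* j) :* ((x :+ q :* q :* (y :* y)) :* k))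
             := :- (a :* (x :* q :* (y :* q) :* (:1 :+ x :* (y :* q)) :* (:1 :+ x :* (y :* q :* q :* q)))
                  :* (i :* j) :* (b :* ((:1 :+ x :* y) :* (x :+ q :* q :* (y :* y)) :* (q :* y) :* (h :* k))))
                :- :- (a :* (x :* q :* y :* (:1 :+ x :* y) :* (:1 :+ x :* (y :* q :* q))) :* (h :* i) :* b)) refl
             (α m) (b m n) q X y h i j k ⟩
      remainder m (suc (suc n)) - remainder m (suc n) ∎
      where
      X = x m
      y = q ^ n
      h = i₂ m n
      i = i₂ m (suc n)
      j = i₂ m (suc (suc n))
      k = i₃ n

    small-remainder : Small remainder
    small-remainder = small-suc (λ _ → refl) (geo-neg (geo-*ᵇ (geo-*ᵇ
      (geo-ᵇ* bounded-α (geo-*ᵇ (geo-*ᵇ (geo-ᵇ* (bounded-x ⊠ ⌜ q ⌝) base)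
        (⌜ 1# ⌝ ⊞ bounded-x ⊠ bounded-q^))
        (⌜ 1# ⌝ ⊞ bounded-x ⊠ (bounded-q^ ⊠ ⌜ q ⌝ ⊠ ⌜ q ⌝))))
      (bounded-i₂ ⊠ geo-reindex (λ m _ → m) (λ _ n → suc n) bounded-i₂))
      (geo-bounded (small-∏ small-ρ))))
      where
      bounded-i₂ : Bounded i₂
      bounded-i₂ = proj₁ (proj₂ quadratic)
      bounded-α : Bounded (λ m _ → α m)
      bounded-α = (⌜ 1# ⌝ ⊞ geo-neg (⌜ q ⌝ ⊠ (bounded-x ⊠ bounded-x)))
        ⊠ (⌜ 1# ⌝ ⊞ geo-neg (⌜ q ⌝ ⊠ ⌜ q ⌝ ⊠ ⌜ q ⌝ ⊠ (bounded-x ⊠ bounded-x)))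

    abstract
      first-sum : ∀ {A B} → (λ n → ∏< n α) ⟶ A → (λ n → ∏< n β) ⟶ B →
        ∃₂ λ S T → (λ n → ∑< n (b 0)) ⟶ S × (λ n → ∑< n (λ k → ∏< k σ)) ⟶ T × A * S ≈ B * T
      first-sum = connection {f = b} {c = remainder} {g = λ n → ∏< n σ} {α = α} {β = β} (small-∏ small-ρ) (product-difference small-ρ small-σ ρ-σ)
        small-remainder (λ _ → refl) certificate

    -- The squares of `x m` advance by q⁴, so the two factors of `α m` are consecutive ones in base
    -- q².
    ∏α : ∀ n → ∏< n α ≈ poch (c * c * q) (q * q) (n ℕ.+ n)
    ∏α n = sym (trans (∏-pairs n _) (∏-cong n λ k → begin
      (1# - c * c * q * (q * q) ^ (k ℕ.+ k)) * (1# - c * c * q * ((q * q) ^ (k ℕ.+ k) * (q * q)))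
        ≈⟨ *-cong (+-congˡ (-‿cong (*-congˡ (four k)))) (+-congˡ (-‿cong (*-congˡ (*-congʳ (four k))))) ⟩
      _ ≈⟨ solve 3 (λ c q X → let Z = X :* X :* (X :* X) ; x = c :* (X :* X) in
             (:1 :- c :* c :* q :* Z) :* (:1 :- c :* c :* q :* (Z :* (q :* q)))
             := (:1 :- q :* (x :* x)) :* (:1 :- q :* q :* q :* (x :* x))) refl c q (q ^ k) ⟩
      α k ∎))
      where
      four : ∀ k → (q * q) ^ (k ℕ.+ k) ≈ q ^ k * q ^ k * (q ^ k * q ^ k)
      four k = trans (^-homo-* (q * q) k k) (*-cong (^-square q k) (^-square q k))

    ∏β : ∀ n → ∏< n β ≈ poch (- (c * q)) (q * q) n * poch (- (c * c * c * (q * q * q))) (q * q * q * (q * q * q)) n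
    ∏β n = sym (trans (sym (∏-* n _ _)) (∏-cong n λ k → begin
      (1# - - (c * q) * (q * q) ^ k) * (1# - - (c * c * c * (q * q * q)) * (q * q * q * (q * q * q)) ^ k)
        ≈⟨ *-cong (+-congˡ (-‿cong (*-congˡ (^-square q k)))) (+-congˡ (-‿cong (*-congˡ (six k)))) ⟩
      _ ≈⟨ solve 3 (λ c q X → let x = c :* (X :* X) in
             (:1 :- (:- (c :* q)) :* (X :* X))
               :* (:1 :- (:- (c :* c :* c :* (q :* q :* q))) :* (X :* X :* X :* (X :* X :* X)))
             := (:1 :+ q :* x) :* (:1 :+ q :* q :* q :* (x :* x :* x))) refl c q (q ^ k) ⟩
      β k ∎))
      where
      six : ∀ k → (q * q * q * (q * q * q)) ^ k ≈ q ^ k * q ^ k * q ^ k * (q ^ k * q ^ k * q ^ k)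
      six k = trans (^-square (q * q * q) k)
        (let t = trans (^-distrib-* (q * q) q k) (*-congʳ (^-square q k)) in *-cong t t)

-- The series in v whose value at v = 1 is ∑ a_n

module SecondSum (R : CommutativeRing 0ℓ 0ℓ) (G : GeometricBounds R)
  (q ω : CommutativeRing.Carrier R) (base : Pochhammer.Base R G q)
  (ω-relation : Pochhammer.CubicRelation R G ω) where
  open Pochhammer R G
  open Inverses q base

  -- The solver does not know that 1 + ω + ω² = 0; identities that depend on it are stated with an
  -- explicit cofactor, which is removed here.
  relation-0 : ∀ k z → z + (1# + ω + ω * ω) * k ≈ z
  relation-0 k z = trans (+-congˡ (trans (*-congʳ ω-relation) (zeroˡ k))) (+-identityʳ z)

  cube≈1 : ω * ω * ω ≈ 1#
  cube≈1 = trans (solve 1 (λ w → w :* w :* w := :1 :+ (:1 :+ w :+ w :* w) :* (w :- :1)) refl ω) (relation-0 _ 1#)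

  abstract
    sixth-ω : Sixth ω 0
    sixth-ω = mkSixth (trans (*-cong cube≈1 cube≈1) (*-identityˡ 1#))

  ones : ∀ {a b} z → a ≈ 1# → b ≈ 1# → z ≈ a * b * z
  ones {a} {b} z a1 b1 = sym (trans (*-congʳ (*-cong a1 b1))
    (solve 1 (λ z → :1 :* :1 :* z := z) refl z))

  bounded-q^ˡ : Bounded (λ m _ → q ^ m)
  bounded-q^ˡ = geo-reindex (λ m _ → m) (λ m _ → m) (geo-bounded base)
  bounded-q^ : Bounded (λ _ n → q ^ n)
  bounded-q^ = geo-bounded base

  -- The denominators free of v. At v = 1 the remaining one, 1 - ωqy, completes (1 - qy)(1 - ω²qy)
  -- to 1 - q³y³.
  factors : Carrier → Carrier
  factors y = (1# - q * (ω * ω * (y * y))) * (1# - q * y) * (1# - q * (ω * ω * y))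

  combined′ : ∃ λ (e : ℕ → Carrier) → Bounded (λ _ n → e n) × (∀ n → factors (q ^ n) * e n ≈ 1#)
  combined′ = (λ n → i n * j n * k n)
    , bound (proj₁ (proj₂ I)) ⊠ bound (proj₁ (proj₂ J)) ⊠ bound (proj₁ (proj₂ K))
    , λ n → let y = q ^ n in begin
        factors y * (i n * j n * k n)
          ≈⟨ solve 6 (λ a b c i j k → a :* b :* c :* (i :* j :* k) := a :* i :* (b :* j) :* (c :* k)) refl
               (1# - q * (ω * ω * (y * y))) (1# - q * y) (1# - q * (ω * ω * y)) (i n) (j n) (k n) ⟩
        (1# - q * (ω * ω * (y * y))) * i n * ((1# - q * y) * j n) * ((1# - q * (ω * ω * y)) * k n)
          ≈⟨ *-cong (*-cong (proj₂ (proj₂ I) 0 n) (proj₂ (proj₂ J) 0 n)) (proj₂ (proj₂ K) 0 n) ⟩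
        1# * 1# * 1# ≈⟨ solve 0 (:1 :* :1 :* :1 := :1) refl ⟩
        1# ∎
    where
    bound : ∀ {x} → Bounded x → Bounded (λ _ n → x 0 n)
    bound = geo-reindex (λ _ _ → 0) (λ _ n → n)
    I = inverses {λ _ n → ω * ω * (q ^ n * q ^ n)}
      (λ _ n → let s = proj₂ (sixth-^ sixth-q n) in _ , sixth-* (sixth-* sixth-ω sixth-ω) (sixth-* s s))
      (⌜ ω ⌝ ⊠ ⌜ ω ⌝ ⊠ (bounded-q^ ⊠ bounded-q^))
    J = inverses {λ _ n → q ^ n} (λ _ n → sixth-^ sixth-q n) bounded-q^
    K = inverses {λ _ n → ω * ω * q ^ n}
      (λ _ n → _ , sixth-* (sixth-* sixth-ω sixth-ω) (proj₂ (sixth-^ sixth-q n)))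
      (⌜ ω ⌝ ⊠ ⌜ ω ⌝ ⊠ bounded-q^)
    i j k : ℕ → Carrier
    i = proj₁ I 0
    j = proj₁ J 0
    k = proj₁ K 0

  abstract
    combined : ∃ λ (e : ℕ → Carrier) → Bounded (λ _ n → e n) × (∀ n → factors (q ^ n) * e n ≈ 1#)
    combined = combined′

  e : ℕ → Carrier
  e = proj₁ combined
  e-inverse : ∀ n → factors (q ^ n) * e n ≈ 1#
  e-inverse = proj₂ (proj₂ combined)
  bounded-e : Bounded (λ _ n → e n)
  bounded-e = proj₁ (proj₂ combined)

  rho : (v y i j : Carrier) → Carrier
  rho v y i j = (1# + ω * (q * y)) * (v + ω * ω * (y * y)) * (ω * (q * y)) * (i * j)

  σ : ℕ → Carrier
  σ n = (1# + ω * (q * q ^ n)) * (ω * ω * (q ^ n * q ^ n)) * (ω * (q * q ^ n)) * e n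

  -- The factor 1 + ωq^n stays outside the product, here and in `a`: as part of the term ratio it
  -- would call for the reciprocal of 1 + ωy.
  g : ℕ → Carrier
  g n = ∏< n σ * (1# + ω * q ^ n)

  small-ωqy : Small (λ _ n → ω * (q * q ^ n))
  small-ωqy = geo-ᵇ* ⌜ ω ⌝ (geo-ᵇ* ⌜ q ⌝ base)

  bounded-1+ωqy : Bounded (λ _ n → 1# + ω * (q * q ^ n))
  bounded-1+ωqy = ⌜ 1# ⌝ ⊞ ⌜ ω ⌝ ⊠ (⌜ q ⌝ ⊠ bounded-q^)

  bounded-1+ωy : Bounded (λ _ n → 1# + ω * q ^ n)
  bounded-1+ωy = ⌜ 1# ⌝ ⊞ ⌜ ω ⌝ ⊠ bounded-q^

  bounded-ωωyy : Bounded (λ _ n → ω * ω * (q ^ n * q ^ n))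
  bounded-ωωyy = ⌜ ω ⌝ ⊠ ⌜ ω ⌝ ⊠ (bounded-q^ ⊠ bounded-q^)

  module _ (c : Carrier) (c-sixth : Sixth c 0) where

    v : ℕ → Carrier
    v m = c * (q ^ m * q ^ m)

    bounded-v : Bounded (λ m _ → v m)
    bounded-v = ⌜ c ⌝ ⊠ (bounded-q^ˡ ⊠ bounded-q^ˡ)

    abstract
      linear : ∃ λ (i : ℕ → ℕ → Carrier) → Bounded i ×
        (∀ m n → (1# - q * (ω * v m * q ^ n)) * i m n ≈ 1#)
      linear = inverses
        (λ m n → let s = proj₂ (sixth-^ sixth-q m)
                 in _ , sixth-* (sixth-* sixth-ω (sixth-* c-sixth (sixth-* s s))) (proj₂ (sixth-^ sixth-q n)))
        (⌜ ω ⌝ ⊠ bounded-v ⊠ bounded-q^)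

    i : ℕ → ℕ → Carrier
    i = proj₁ linear
    i-inverse : ∀ m n → (1# - q * (ω * v m * q ^ n)) * i m n ≈ 1#
    i-inverse = proj₂ (proj₂ linear)
    bounded-i : Bounded i
    bounded-i = proj₁ (proj₂ linear)

    ρ A a : ℕ → ℕ → Carrier
    ρ m k = rho (v m) (q ^ k) (e k) (i m k)
    A m n = ∏< n (ρ m)
    a m n = A m n * (1# + ω * q ^ n)

    α β : ℕ → Carrier
    α m = (1# - q * (ω * v m)) * (1# - q * q * (ω * v m))
    β m = (1# + q * q * (ω * ω * v m)) * (1# + q * v m)

    small-ρ : Small ρ
    small-ρ = geo-*ᵇ (geo-ᵇ* (bounded-1+ωqy ⊠ (bounded-v ⊞ bounded-ωωyy)) small-ωqy) (bounded-e ⊠ bounded-i)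

    small-σ : Small (λ _ → σ)
    small-σ = geo-*ᵇ (geo-ᵇ* (bounded-1+ωqy ⊠ bounded-ωωyy) small-ωqy) bounded-e

    ρ-σ : Small₁ (λ m n → ρ m n - σ n)
    -- As for the first series: after the reciprocal is cleared the difference is divisible by v,
    -- which contains q^m twice.
    ρ-σ = small₁-*
      {b = λ m n → c * q ^ m * (i m n + ω * ω * (q ^ n * q ^ n) * (q * ω * q ^ n) * i m n)
                   * ((1# + ω * (q * q ^ n)) * (ω * (q * q ^ n)) * e n)} base
      (⌜ c ⌝ ⊠ bounded-q^ˡ ⊠ (bounded-i ⊞ bounded-ωωyy ⊠ (⌜ q ⌝ ⊠ ⌜ ω ⌝ ⊠ bounded-q^) ⊠ bounded-i)
        ⊠ (bounded-1+ωqy ⊠ (⌜ ω ⌝ ⊠ (⌜ q ⌝ ⊠ bounded-q^)) ⊠ bounded-e))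
      λ m n → let X = q ^ m ; y = q ^ n in begin
        X * (c * X * (i m n + ω * ω * (y * y) * (q * ω * y) * i m n)
          * ((1# + ω * (q * y)) * (ω * (q * y)) * e n))
          ≈⟨ solve 7 (λ c X y q w i e → let v = c :* (X :* X) in
               X :* (c :* X :* (i :+ w :* w :* (y :* y) :* (q :* w :* y) :* i)
                 :* ((:1 :+ w :* (q :* y)) :* (w :* (q :* y)) :* e))
               := (:1 :+ w :* (q :* y)) :* (v :+ w :* w :* (y :* y)) :* (w :* (q :* y)) :* (e :* i)
                  :- (:1 :+ w :* (q :* y)) :* (w :* w :* (y :* y)) :* (w :* (q :* y)) :* e
                     :* ((:1 :- q :* (w :* v :* y)) :* i)) refl
               c X y q ω (i m n) (e n) ⟩
        ρ m n - σ n * ((1# - q * (ω * v m * y)) * i m n)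
          ≈⟨ +-congˡ (-‿cong (trans (*-congˡ (i-inverse m n)) (*-identityʳ _))) ⟩
        ρ m n - σ n ∎

    i-suc : ∀ m k → i (suc m) k ≈ i m (suc (suc k))
    i-suc m k = inverse-unique
      (solve 5 (λ c X q w y →
        :1 :- q :* (w :* (c :* (X :* q :* (X :* q))) :* y)
        := :1 :- q :* (w :* (c :* (X :* X)) :* (y :* q :* q))) refl c (q ^ m) q ω (q ^ k))
      (i-inverse (suc m) k) (i-inverse m (suc (suc k)))

    ρ-suc : ∀ m k → ρ (suc m) k ≈ rho (q * q * v m) (q ^ k) (e k) (i m (suc (suc k)))
    ρ-suc m k = *-cong (*-congʳ (*-congˡ (+-congʳ
      (solve 3 (λ c X q → c :* (X :* q :* (X :* q)) := q :* q :* (c :* (X :* X))) refl c (q ^ m) q))))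
      (*-congˡ (i-suc m k))

    α-unit : ∀ m z → z ≈ α m * (i m 0 * i m 1) * z
    α-unit m z = trans (ones z (i-inverse m 0) (i-inverse m 1))
      (solve 6 (λ q w v i j z → (:1 :- q :* (w :* v :* :1)) :* i
          :* ((:1 :- q :* (w :* v :* (:1 :* q))) :* j) :* z
        := (:1 :- q :* (w :* v)) :* (:1 :- q :* q :* (w :* v)) :* (i :* j) :* z) refl
        q ω (v m) (i m 0) (i m 1) z)

    -- Only the factors that contain v move: v + ω²y² by one place, with q²v + ω² entering at the
    -- start, and the reciprocals by two.
    shifted : ∀ m n → let V = v m ; y = q ^ n in
      A (suc m) (suc n)
      ≈ α m * A m n * ((1# + ω * (q * y)) * (ω * (q * y)) * e n) * (q * q * V + ω * ω) * (y * y)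
        * (i m n * i m (suc n) * i m (suc (suc n)))
    shifted m zero = begin
      1# * ρ (suc m) 0
        ≈⟨ *-congˡ (ρ-suc m 0) ⟩
      1# * rho (q * q * v m) 1# (e 0) (i m 2)
        ≈⟨ α-unit m _ ⟩
      α m * (i m 0 * i m 1) * (1# * rho (q * q * v m) 1# (e 0) (i m 2))
        ≈⟨ solve 8 (λ a q w v e i j k →
             a :* (i :* j) :* (:1 :* ((:1 :+ w :* (q :* :1)) :* (q :* q :* v :+ w :* w :* (:1 :* :1))
               :* (w :* (q :* :1)) :* (e :* k)))
             := a :* :1 :* ((:1 :+ w :* (q :* :1)) :* (w :* (q :* :1)) :* e) :* (q :* q :* v :+ w :* w)
               :* (:1 :* :1) :* (i :* j :* k)) refl
             (α m) q ω (v m) (e 0) (i m 0) (i m 1) (i m 2) ⟩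
      _ ∎
    shifted m (suc n) = begin
      A (suc m) (suc n) * ρ (suc m) (suc n)
        ≈⟨ *-cong (shifted m n) (ρ-suc m (suc n)) ⟩
      _ * rho (q * q * v m) (q ^ n * q) (e (suc n)) (i m (suc (suc (suc n))))
        ≈⟨ solve 12 (λ a b q w v y e f i j k l →
             a :* b :* ((:1 :+ w :* (q :* y)) :* (w :* (q :* y)) :* e) :* (q :* q :* v :+ w :* w) :* (y :* y)
               :* (i :* j :* k)
               :* ((:1 :+ w :* (q :* (y :* q))) :* (q :* q :* v :+ w :* w :* (y :* q :* (y :* q)))
                   :* (w :* (q :* (y :* q))) :* (f :* l))
             := a :* (b :* ((:1 :+ w :* (q :* y)) :* (v :+ w :* w :* (y :* y)) :* (w :* (q :* y)) :* (e :* i)))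
               :* ((:1 :+ w :* (q :* (y :* q))) :* (w :* (q :* (y :* q))) :* f) :* (q :* q :* v :+ w :* w)
               :* (y :* q :* (y :* q)) :* (j :* k :* l)) refl
             (α m) (A m n) q ω (v m) (q ^ n) (e n) (e (suc n))
             (i m n) (i m (suc n)) (i m (suc (suc n))) (i m (suc (suc (suc n)))) ⟩
      _ ∎

    remainder : ℕ → ℕ → Carrier
    remainder m zero    = 0#
    remainder m (suc n) = - (α m * (q * v m * (ω * q ^ n) * (1# + ω * (q * q ^ n)))
        * (i m n * i m (suc n)) * A m n)

    core : ∀ m n → let V = v m ; y = q ^ n in
      (V + ω * ω * (y * y)) * (1# + ω * (q * y)) * e n
        - (1# + q * q * (ω * ω * V)) * (1# + q * V) * ((q * q * V + ω * ω) * (y * y) * (1# + ω * (q * y)))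
          * (e n * i m (suc n) * i m (suc (suc n)))
      ≈ V * i m (suc n)
        - q * V * (ω * (y * q)) * (1# + ω * (q * (y * q))) * (i m (suc n) * i m (suc (suc n)))
          * ((V + ω * ω * (y * y)) * e n)
    core m n = begin
      (V + ω * ω * (y * y)) * (1# + ω * (q * y)) * f - P * (f * j * k)
        ≈⟨ +-congʳ (ones _ (i-inverse m (suc n)) (i-inverse m (suc (suc n)))) ⟩
      _
        ≈⟨ solve 7 (λ v y q w f j k →
             (:1 :- q :* (w :* v :* (y :* q))) :* j :* ((:1 :- q :* (w :* v :* (y :* q :* q))) :* k)
               :* ((v :+ w :* w :* (y :* y)) :* (:1 :+ w :* (q :* y)) :* f)
             :- (:1 :+ q :* q :* (w :* w :* v)) :* (:1 :+ q :* v)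
               :* ((q :* q :* v :+ w :* w) :* (y :* y) :* (:1 :+ w :* (q :* y))) :* (f :* j :* k)
             := (:1 :- q :* (w :* v :* (y :* q :* q))) :* k
               :* ((:1 :- q :* (w :* w :* (y :* y))) :* (:1 :- q :* y) :* (:1 :- q :* (w :* w :* y)) :* f)
               :* (v :* j)
             :- q :* v :* (w :* (y :* q)) :* (:1 :+ w :* (q :* (y :* q))) :* (j :* k)
               :* ((v :+ w :* w :* (y :* y)) :* f)
             -- The two sides agree only modulo 1 + ω + ω²; the polynomial written here is the
             -- quotient of their difference by it.
             :+ (:1 :+ w :+ w :* w) :* ((q :* v :* y :+ w :* q :* q :* v :* y :* y :+ w :* q :* q :* q :* v :* v :* y :* y :+ w :* w :* q :* q :* q :* v :* y :* y :* y :+ w :* w :* q :* q :* q :* q :* v :* v :* y :* y :* y :+ w :* w :* w :* q :* q :* q :* q :* q :* v :* v :* y :* y :* y :* y :- (q :* q :* v :* y :* y :+ q :* q :* q :* v :* v :* y :* y :+ w :* q :* q :* q :* v :* y :* y :* y :+ w :* q :* q :* q :* q :* v :* v :* y :* y :+ w :* q :* q :* q :* q :* v :* v :* y :* y :* y :+ w :* w :* q :* q :* v :* y :* y :+ w :* w :* q :* q :* v :* y :* y :* y :+ w :* w :* q :* q :* q :* v :* v :* y :* y :+ w :* w :* w :* q :* q :* q :* v :* y :* y :* y :+ w :* w :* w :* q :* q :* q :* q :* v :* v :* y :* y :* y)) :* (f :* j :* k))) refl V y q ω f j k ⟩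
      _
        ≈⟨ relation-0 _ _ ⟩
      _
        ≈⟨ +-congʳ (ones _ (i-inverse m (suc (suc n))) (e-inverse n)) ⟨
      _ ∎
      where
      V = v m
      y = q ^ n
      f = e n
      j = i m (suc n)
      k = i m (suc (suc n))
      P = (1# + q * q * (ω * ω * V)) * (1# + q * V) * ((q * q * V + ω * ω) * (y * y) * (1# + ω * (q * y)))

    certificate : ∀ m n → α m * a m n - β m * a (suc m) n ≈ remainder m (suc n) - remainder m n
    certificate m zero = begin
      α m * (1# * (1# + ω * 1#)) - β m * (1# * (1# + ω * 1#))
        ≈⟨ solve 3 (λ q w v →
             (:1 :- q :* (w :* v)) :* (:1 :- q :* q :* (w :* v)) :* (:1 :* (:1 :+ w :* :1))
             :- (:1 :+ q :* q :* (w :* w :* v)) :* (:1 :+ q :* v) :* (:1 :* (:1 :+ w :* :1))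
             := :- (q :* v :* (w :* :1) :* (:1 :+ w :* (q :* :1)))
                :+ (:1 :+ w :+ w :* w) :* (:- (q :* v :+ q :* q :* v :* w))) refl q ω (v m) ⟩
      _ ≈⟨ relation-0 _ _ ⟩
      - (q * v m * (ω * 1#) * (1# + ω * (q * 1#)))
        ≈⟨ -‿cong (α-unit m _) ⟩
      - (α m * (i m 0 * i m 1) * (q * v m * (ω * 1#) * (1# + ω * (q * 1#))))
        ≈⟨ solve 3 (λ a i z → :- (a :* i :* z) := :- (a :* z :* i :* :1) :- :0) refl _ _ _ ⟩
      remainder m 1 - 0# ∎
    certificate m (suc n) = begin
      α m * (A m n * ρ m n * (1# + ω * (y * q))) - β m * (A (suc m) (suc n) * (1# + ω * (y * q)))
        ≈⟨ +-congˡ (-‿cong (*-congˡ (*-congʳ (shifted m n)))) ⟩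
      _
        ≈⟨ solve 10 (λ a b q w v y f h j k →
             a :* (b :* ((:1 :+ w :* (q :* y)) :* (v :+ w :* w :* (y :* y)) :* (w :* (q :* y)) :* (f :* h))
                   :* (:1 :+ w :* (y :* q)))
             :- (:1 :+ q :* q :* (w :* w :* v)) :* (:1 :+ q :* v)
               :* (a :* b :* ((:1 :+ w :* (q :* y)) :* (w :* (q :* y)) :* f) :* (q :* q :* v :+ w :* w) :* (y :* y)
                 :* (h :* j :* k) :* (:1 :+ w :* (y :* q)))
             := a :* b :* (:1 :+ w :* (q :* y)) :* (w :* (q :* y)) :* h :*
               ((v :+ w :* w :* (y :* y)) :* (:1 :+ w :* (q :* y)) :* f
                :- (:1 :+ q :* q :* (w :* w :* v)) :* (:1 :+ q :* v)
                  :* ((q :* q :* v :+ w :* w) :* (y :* y) :* (:1 :+ w :* (q :* y))) :* (f :* j :* k))) refl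
             (α m) (A m n) q ω V y f h j k ⟩
      α m * A m n * (1# + ω * (q * y)) * (ω * (q * y)) * h * _
        ≈⟨ *-congˡ (core m n) ⟩
      α m * A m n * (1# + ω * (q * y)) * (ω * (q * y)) * h * _
        ≈⟨ solve 10 (λ a b q w v y f h j k →
             a :* b :* (:1 :+ w :* (q :* y)) :* (w :* (q :* y)) :* h :*
               (v :* j
                :- q :* v :* (w :* (y :* q)) :* (:1 :+ w :* (q :* (y :* q))) :* (j :* k)
                  :* ((v :+ w :* w :* (y :* y)) :* f))
             := :- (a :* (q :* v :* (w :* (y :* q)) :* (:1 :+ w :* (q :* (y :* q)))) :* (j :* k)
                  :* (b :* ((:1 :+ w :* (q :* y)) :* (v :+ w :* w :* (y :* y)) :* (w :* (q :* y)) :* (f :* h))))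
                :- :- (a :* (q :* v :* (w :* y) :* (:1 :+ w :* (q :* y))) :* (h :* j) :* b)) refl
             (α m) (A m n) q ω V y f h j k ⟩
      remainder m (suc (suc n)) - remainder m (suc n) ∎
      where
      V = v m
      y = q ^ n
      f = e n
      h = i m n
      j = i m (suc n)
      k = i m (suc (suc n))

    small-remainder : Small remainder
    small-remainder = small-suc (λ _ → refl) (geo-neg (geo-*ᵇ (geo-*ᵇ
      (geo-ᵇ* bounded-α (geo-*ᵇ (geo-ᵇ* (⌜ q ⌝ ⊠ bounded-v) (geo-ᵇ* ⌜ ω ⌝ base)) bounded-1+ωqy))
      (bounded-i ⊠ geo-reindex (λ m _ → m) (λ _ n → suc n) bounded-i))
      (geo-bounded (small-∏ small-ρ))))
      where
      bounded-α : Bounded (λ m _ → α m)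
      bounded-α = (⌜ 1# ⌝ ⊞ geo-neg (⌜ q ⌝ ⊠ (⌜ ω ⌝ ⊠ bounded-v)))
        ⊠ (⌜ 1# ⌝ ⊞ geo-neg (⌜ q ⌝ ⊠ ⌜ q ⌝ ⊠ (⌜ ω ⌝ ⊠ bounded-v)))

    abstract
      second-sum : ∀ {U V} → (λ n → ∏< n α) ⟶ U → (λ n → ∏< n β) ⟶ V →
        ∃₂ λ S T → (λ n → ∑< n (a 0)) ⟶ S × (λ n → ∑< n g) ⟶ T × U * S ≈ V * T
      second-sum = connection {f = a} {c = remainder} {g = g} {α = α} {β = β} (geo-*ᵇ (small-∏ small-ρ) bounded-1+ωy)
        (geo-≈ (λ m n → solve 3 (λ a b z → (a :- b) :* z := a :* z :- b :* z) refl (A m n) (∏< n σ) (1# + ω * q ^ n))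
          (geo-*ᵇ (product-difference small-ρ small-σ ρ-σ) bounded-1+ωy))
        small-remainder (λ _ → refl) certificate

    ∏α : ∀ n → ∏< n α ≈ poch (ω * c * q) q (n ℕ.+ n)
    ∏α n = sym (trans (∏-pairs n _) (∏-cong n λ k → begin
      (1# - ω * c * q * q ^ (k ℕ.+ k)) * (1# - ω * c * q * (q ^ (k ℕ.+ k) * q))
        ≈⟨ *-cong (+-congˡ (-‿cong (*-congˡ (^-homo-* q k k)))) (+-congˡ (-‿cong (*-congˡ (*-congʳ (^-homo-* q k k))))) ⟩
      _ ≈⟨ solve 4 (λ w c q X → let Z = X :* X ; v = c :* (X :* X) in
             (:1 :- w :* c :* q :* Z) :* (:1 :- w :* c :* q :* (Z :* q))
             := (:1 :- q :* (w :* v)) :* (:1 :- q :* q :* (w :* v))) refl ω c q (q ^ k) ⟩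
      α k ∎))

    ∏β : ∀ n → ∏< n β ≈ poch (- (ω * ω * c * (q * q))) (q * q) n * poch (- (c * q)) (q * q) n
    ∏β n = sym (trans (sym (∏-* n _ _)) (∏-cong n λ k → begin
      (1# - - (ω * ω * c * (q * q)) * (q * q) ^ k) * (1# - - (c * q) * (q * q) ^ k)
        ≈⟨ *-cong (+-congˡ (-‿cong (*-congˡ (^-square q k)))) (+-congˡ (-‿cong (*-congˡ (^-square q k)))) ⟩
      _ ≈⟨ solve 4 (λ w c q X → let v = c :* (X :* X) in
             (:1 :- (:- (w :* w :* c :* (q :* q))) :* (X :* X)) :* (:1 :- (:- (c :* q)) :* (X :* X))
             := (:1 :+ q :* q :* (w :* w :* v)) :* (:1 :+ q :* v)) refl ω c q (q ^ k) ⟩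
      β k ∎))

-- The triple product

-- Jacobi's triple product, from the same connection principle: the sums are
-- truncated by the factors ∏ (p^j − x) at x = p^m.
module TripleProduct (R : CommutativeRing 0ℓ 0ℓ) (G : GeometricBounds R)
  (p : CommutativeRing.Carrier R) (base : Pochhammer.Base R G p)
  (i : ℕ → CommutativeRing.Carrier R) (bounded-i′ : Limits.Bounded R G (λ _ n → i n))
  (i-inverse : Pochhammer.InvertsFactors R G p i) where
  open Pochhammer R G

  I : ℕ → ℕ → Carrier
  I m k = i (m ℕ.+ k)

  bounded-I : Bounded I
  bounded-I = geo-reindex (λ m _ → m) ℕ._+_ bounded-i′

  I-inverse : ∀ m k → (1# - p ^ m * p ^ k * p) * I m k ≈ 1#
  I-inverse m k = trans (*-congʳ (+-congˡ (-‿cong (*-congʳ (sym (^-homo-* p m k)))))) (i-inverse (m ℕ.+ k))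

  bounded-p^ : Bounded (λ _ n → p ^ n)
  bounded-p^ = geo-bounded base
  bounded-p^ˡ : Bounded (λ m _ → p ^ m)
  bounded-p^ˡ = geo-reindex (λ m _ → m) (λ m _ → m) bounded-p^
  bounded-p^∸ : Bounded (λ m n → p ^ (m ℕ.∸ n))
  bounded-p^∸ = geo-reindex (λ m _ → m) ℕ._∸_ bounded-p^

  square : ℕ → Carrier
  square m = (1# - p * p ^ m) * (1# - p * p ^ m)

  β : ℕ → Carrier
  β m = (1# - p * (p ^ m * p ^ m)) * (1# - p * p * (p ^ m * p ^ m))

  module Half (z : Carrier) where
    -- For k ≤ m the bracket is p^k - p^m. Truncated subtraction makes it 0 from k = m on and keeps
    -- it bounded by a multiple of p^k uniformly in m, which p^k - p^m is not.
    ρ : ℕ → ℕ → Carrier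
    ρ m k = - z * (p ^ k * (1# - p ^ (m ℕ.∸ k))) * I m k
    -- This is (-z)^k p^(k(k-1)/2) times a ratio of Gaussian binomials in base p, "2m over m+k" to
    -- "2m over m". The sums over k are thus a finite form of the theta series.
    F : ℕ → ℕ → Carrier
    F m k = ∏< k (ρ m)
    σ : ℕ → Carrier
    σ k = - z * p ^ k

    small-ρ : Small ρ
    small-ρ = geo-*ᵇ (geo-ᵇ* (geo-neg ⌜ z ⌝) (geo-*ᵇ base (⌜ 1# ⌝ ⊞ geo-neg bounded-p^∸))) bounded-I

    small-σ : Small (λ _ → σ)
    small-σ = geo-ᵇ* (geo-neg ⌜ z ⌝) base

    ρ-σ : Small₁ (λ m k → ρ m k - σ k)
    -- Since k + (m ∸ k) ≥ m, the first term is small in m; the second carries p^m from the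
    -- denominator of `I m k`.
    ρ-σ = geo-≈ {x = λ m k → z * p ^ (k ℕ.+ (m ℕ.∸ k))
          - p ^ m * (p ^ k * p * I m k * (z * p ^ k * (1# - p ^ (m ℕ.∸ k))))}
      (λ m k → let x = p ^ m ; Y = p ^ k ; t = p ^ (m ℕ.∸ k) in begin
        z * p ^ (k ℕ.+ (m ℕ.∸ k)) - x * (Y * p * I m k * (z * Y * (1# - t)))
          ≈⟨ +-congʳ (*-congˡ (^-homo-* p k (m ℕ.∸ k))) ⟩
        z * (Y * t) - x * (Y * p * I m k * (z * Y * (1# - t)))
          ≈⟨ solve 6 (λ z x Y p t i → z :* (Y :* t) :- x :* (Y :* p :* i :* (z :* Y :* (:1 :- t)))
               := (:- z) :* (Y :* (:1 :- t)) :* i :- (:- z) :* Y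
                  :+ z :* Y :* (:1 :- t) :* ((:1 :- x :* Y :* p) :* i :- :1)) refl z x Y p t (I m k) ⟩
        ρ m k - σ k + z * Y * (1# - t) * ((1# - x * Y * p) * I m k - 1#)
          ≈⟨ +-congˡ (*-congˡ (trans (+-congʳ (I-inverse m k)) (-‿inverseʳ 1#))) ⟩
        ρ m k - σ k + z * Y * (1# - t) * 0#
          ≈⟨ trans (+-congˡ (zeroʳ _)) (+-identityʳ _) ⟩
        ρ m k - σ k ∎)
      (geo-- (geo-ᵇ* ⌜ z ⌝ (geo-≤ (λ m k → ℕₚ.m≤n+m∸n m k)
               (geo-reindex (λ m _ → m) (λ m k → k ℕ.+ (m ℕ.∸ k)) base)))
        (geo-*ᵇ (geo-reindex (λ m _ → m) (λ m _ → m) base)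
          (bounded-p^ ⊠ ⌜ p ⌝ ⊠ bounded-I ⊠ (⌜ z ⌝ ⊠ bounded-p^ ⊠ (⌜ 1# ⌝ ⊞ geo-neg bounded-p^∸)))))

    F-zero : ∀ m k → m ℕ.< k → F m k ≈ 0#
    F-zero m (suc k) m<1+k with m ℕ.≟ k
    ... | yes ≡.refl = begin
      F m m * (- z * (p ^ m * (1# - p ^ (m ℕ.∸ m))) * I m m)
        ≡⟨ ≡.cong (λ d → F m m * (- z * (p ^ m * (1# - p ^ d)) * I m m)) (ℕₚ.n∸n≡0 m) ⟩
      F m m * (- z * (p ^ m * (1# - 1#)) * I m m)
        ≈⟨ solve 4 (λ f z x i → f :* ((:- z) :* (x :* (:1 :- :1)) :* i) := :0) refl _ z _ _ ⟩
      0# ∎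
    ... | no m≢k = trans (*-congʳ (F-zero m k (ℕₚ.≤∧≢⇒< (ℕₚ.≤-pred m<1+k) m≢k))) (zeroˡ _)

    -- For k > m both sides vanish with `F m k`, so the polynomial factor may replace the truncated
    -- one.
    F-suc : ∀ m k → F m (suc k) ≈ F m k * (- z * (p ^ k - p ^ m) * I m k)
    F-suc m k with k ℕ.≤? m
    ... | yes k≤m = *-congˡ (*-congʳ (*-congˡ (begin
      p ^ k * (1# - p ^ (m ℕ.∸ k))        ≈⟨ solve 2 (λ a b → a :* (:1 :- b) := a :- a :* b) refl _ _ ⟩
      p ^ k - p ^ k * p ^ (m ℕ.∸ k)       ≈⟨ +-congˡ (-‿cong (^-homo-* p k (m ℕ.∸ k))) ⟨
      p ^ k - p ^ (k ℕ.+ (m ℕ.∸ k))       ≡⟨ ≡.cong (λ d → p ^ k - p ^ d) (ℕₚ.m+[n∸m]≡n k≤m) ⟩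
      p ^ k - p ^ m                       ∎)))
    ... | no k≰m = trans (trans (*-congʳ F≈0) (zeroˡ _)) (sym (trans (*-congʳ F≈0) (zeroˡ _)))
      where
      F≈0 : F m k ≈ 0#
      F≈0 = F-zero m k (ℕₚ.≰⇒> k≰m)

    shifted : ∀ m k → F (suc m) (suc k) ≈ F m k * (- z * square m * p ^ k * (I m k * I m (suc k)))
    shifted m zero = begin
      1# * (- z * (1# * (1# - p ^ m * p)) * I (suc m) 0)
        ≡⟨ ≡.cong (λ d → 1# * (- z * (1# * (1# - p ^ m * p)) * i d)) (≡.sym (ℕₚ.+-suc m 0)) ⟩
      1# * (- z * (1# * (1# - p ^ m * p)) * I m 1)
        ≈⟨ *-identityˡ _ ⟨
      1# * (1# * (- z * (1# * (1# - p ^ m * p)) * I m 1))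
        ≈⟨ *-congʳ (I-inverse m 0) ⟨
      (1# - p ^ m * 1# * p) * I m 0 * (1# * (- z * (1# * (1# - p ^ m * p)) * I m 1))
        ≈⟨ solve 5 (λ x p z i j →
             (:1 :- x :* :1 :* p) :* i :* (:1 :* ((:- z) :* (:1 :* (:1 :- x :* p)) :* j))
             := :1 :* ((:- z) :* ((:1 :- p :* x) :* (:1 :- p :* x)) :* :1 :* (i :* j))) refl
             (p ^ m) p z (I m 0) (I m 1) ⟩
      _ ∎
    shifted m (suc k) = begin
      F (suc m) (suc k) * (- z * (p ^ k * p * (1# - p ^ (m ℕ.∸ k))) * I (suc m) (suc k))
        ≡⟨ ≡.cong (λ d → F (suc m) (suc k) * (- z * (p ^ k * p * (1# - p ^ (m ℕ.∸ k))) * i d))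
             (≡.sym (ℕₚ.+-suc m (suc k))) ⟩
      F (suc m) (suc k) * (- z * (p ^ k * p * (1# - p ^ (m ℕ.∸ k))) * I m (suc (suc k)))
        ≈⟨ *-congʳ (shifted m k) ⟩
      _ ≈⟨ solve 9 (λ f z s Y p t i j l →
             f :* ((:- z) :* s :* Y :* (i :* j)) :* ((:- z) :* (Y :* p :* (:1 :- t)) :* l)
             := f :* ((:- z) :* (Y :* (:1 :- t)) :* i) :* ((:- z) :* s :* (Y :* p) :* (j :* l))) refl
             (F m k) z (square m) (p ^ k) p (p ^ (m ℕ.∸ k)) (I m k) (I m (suc k)) (I m (suc (suc k))) ⟩
      _ ∎

    remainder : ℕ → ℕ → Carrier
    remainder m zero    = 0#
    remainder m (suc k) =
      square m * (- (p ^ m * z) - p * p ^ m * (p ^ k - p ^ m) * I m k) * F m k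

    small-remainder : Small remainder
    small-remainder = small-suc (λ _ → refl) (geo-ᵇ*
      ((⌜ 1# ⌝ ⊞ geo-neg (⌜ p ⌝ ⊠ bounded-p^ˡ)) ⊠ (⌜ 1# ⌝ ⊞ geo-neg (⌜ p ⌝ ⊠ bounded-p^ˡ))
        ⊠ (geo-neg (bounded-p^ˡ ⊠ ⌜ z ⌝)
           ⊞ geo-neg (⌜ p ⌝ ⊠ bounded-p^ˡ ⊠ (bounded-p^ ⊞ geo-neg bounded-p^ˡ) ⊠ bounded-I)))
      (small-∏ small-ρ))

    core : ∀ m k → let x = p ^ m ; Y = p ^ k in
      β m * Y * (I m k * I m (suc k)) - (1# + p * (x * x)) * (Y - x) * I m k
      ≈ p * x * (Y * p - x) * (Y - x) * (I m k * I m (suc k)) + x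
    core m k = begin
      β m * Y * (h * j) - u
        ≈⟨ +-congˡ (-‿cong (one u (I-inverse m (suc k)))) ⟩
      β m * Y * (h * j) - (1# - x * (Y * p) * p) * j * u
        ≈⟨ solve 5 (λ x Y p i j →
             (:1 :- p :* (x :* x)) :* (:1 :- p :* p :* (x :* x)) :* Y :* (i :* j)
             :- (:1 :- x :* (Y :* p) :* p) :* j :* ((:1 :+ p :* (x :* x)) :* (Y :- x) :* i)
             := p :* x :* (Y :* p :- x) :* (Y :- x) :* (i :* j)
                :+ (:1 :- x :* Y :* p) :* i :* ((:1 :- x :* (Y :* p) :* p) :* j :* x)) refl x Y p h j ⟩
      p * x * (Y * p - x) * (Y - x) * (h * j) + (1# - x * Y * p) * h * ((1# - x * (Y * p) * p) * j * x)
        ≈⟨ +-congˡ (trans (one x (I-inverse m (suc k))) (one _ (I-inverse m k))) ⟨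
      p * x * (Y * p - x) * (Y - x) * (h * j) + x ∎
      where
      x = p ^ m
      Y = p ^ k
      h = I m k
      j = I m (suc k)
      u = (1# + p * (x * x)) * (Y - x) * h
      one : ∀ {a} z → a ≈ 1# → z ≈ a * z
      one z a≈1 = sym (trans (*-congʳ a≈1) (*-identityˡ z))

    -- From k = 1 on each half telescopes by itself, the other half being the case with z and w
    -- exchanged. Here z w = p is used through an explicit cofactor of z w - p.
    certificate : ∀ w → z * w ≈ p → ∀ m k →
      (1# - z * p ^ m) * (1# - w * p ^ m) * square m * F m (suc k) - β m * F (suc m) (suc k)
      ≈ remainder m (suc (suc k)) - remainder m (suc k)
    certificate w zw m k = begin
      (1# - z * x) * (1# - w * x) * s * F m (suc k) - β m * F (suc m) (suc k)
        ≈⟨ +-cong (*-congˡ F⁺) (-‿cong (trans (*-congˡ (shifted m k))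
             (solve 6 (λ b f z s Y r → b :* (f :* ((:- z) :* s :* Y :* r)) := f :* ((:- z) :* s :* (b :* Y :* r)))
               refl (β m) f z s Y (h * j)))) ⟩
      (1# - z * x) * (1# - w * x) * s * (f * (- z * u)) - f * (- z * s * (β m * Y * (h * j)))
        ≈⟨ solve 8 (λ z w x p f s u c →
             (:1 :- z :* x) :* (:1 :- w :* x) :* s :* (f :* ((:- z) :* u)) :- f :* ((:- z) :* s :* c)
             := s :* f :* (z :* (c :- (:1 :+ p :* (x :* x)) :* u) :- x :* z :* ((:- z) :* u) :+ x :* p :* u)
                :+ (z :* w :- p) :* (s :* f :* (x :* u :- x :* x :* z :* u))) refl
             z w x p f s u (β m * Y * (h * j)) ⟩
      s * f * (z * (β m * Y * (h * j) - (1# + p * (x * x)) * u) - x * z * (- z * u) + x * p * u)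
        + (z * w - p) * (s * f * (x * u - x * x * z * u))
        ≈⟨ +-cong (*-congˡ (+-congʳ (+-congʳ (*-congˡ (trans (+-congˡ (-‿cong (sym (*-assoc _ _ _)))) (core m k))))))
             (trans (*-congʳ (trans (+-congʳ zw) (-‿inverseʳ p))) (zeroˡ _)) ⟩
      s * f * (z * (p * x * (Y * p - x) * (Y - x) * (h * j) + x) - x * z * (- z * u) + x * p * u) + 0#
        ≈⟨ trans (+-identityʳ _) (*-congˡ (+-congʳ (+-congʳ (*-congˡ (+-congʳ
             (solve 6 (λ p x t d h j → p :* x :* t :* d :* (h :* j) := p :* x :* t :* j :* (d :* h)) refl
               p x (Y * p - x) (Y - x) h j)))))) ⟩
      s * f * (z * (p * x * (Y * p - x) * j * u + x) - x * z * (- z * u) + x * p * u)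
        ≈⟨ solve 7 (λ z x p f s u e →
             s :* f :* (z :* (e :* u :+ x) :- x :* z :* ((:- z) :* u) :+ x :* p :* u)
             := s :* ((:- (x :* z)) :- e) :* (f :* ((:- z) :* u)) :- s :* ((:- (x :* z)) :- p :* x :* u) :* f) refl
             z x p f s u (p * x * (Y * p - x) * j) ⟩
      s * (- (x * z) - p * x * (Y * p - x) * j) * (f * (- z * u)) - s * (- (x * z) - p * x * u) * f
        ≈⟨ +-cong (*-congˡ F⁺) (-‿cong (*-congʳ (*-congˡ (+-congˡ (-‿cong (*-assoc _ _ _)))))) ⟨
      remainder m (suc (suc k)) - remainder m (suc k) ∎
      where
      x = p ^ m
      Y = p ^ k
      h = I m k
      j = I m (suc k)
      f = F m k
      s = square m
      u = (Y - x) * h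
      F⁺ : F m (suc k) ≈ f * (- z * u)
      F⁺ = trans (F-suc m k) (*-congˡ (*-assoc _ _ _))

  -- Index 0 belongs to both halves of the bilateral series and is subtracted once.
  δ : ℕ → Carrier
  δ zero    = 1#
  δ (suc _) = 0#

  small-δ : Small (λ _ → δ)
  small-δ = geo-recursion (λ _ → 0) {u = λ _ _ → 0#} {σ = λ _ _ → 0#} (geo-const 1#) geo-0 geo-0
    (λ _ n → sym (trans (+-identityˡ _) (zeroʳ _)))

  -- 1 for n = 0 and (−1)ⁿ p^(n(n−1)/2) (zⁿ + wⁿ) for n > 0
  theta : Carrier → Carrier → ℕ → Carrier
  theta z w n = ∏< n (Half.σ z) + ∏< n (Half.σ w) - δ n

  module _ {z w : Carrier} (zw : z * w ≈ p) where
    private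
      module Z = Half z
      module W = Half w

    f remainder : ℕ → ℕ → Carrier
    f m k = Z.F m k + W.F m k - δ k
    remainder m k = Z.remainder m k + W.remainder m k

    α : ℕ → Carrier
    α m = (1# - z * p ^ m) * (1# - w * p ^ m) * square m

    f-theta : Geo (λ m n → m ℕ.+ n) (λ m n → f m n - theta z w n)
    f-theta = geo-≈ (λ m n → solve 5 (λ a b c d e → (a :- b) :+ (c :- d) := (a :+ c :- e) :- (b :+ d :- e)) refl
        (Z.F m n) (∏< n Z.σ) (W.F m n) (∏< n W.σ) (δ n))
      (geo-+ (product-difference Z.small-ρ Z.small-σ Z.ρ-σ) (product-difference W.small-ρ W.small-σ W.ρ-σ))

    certificate : ∀ m n → α m * f m n - β m * f (suc m) n ≈ remainder m (suc n) - remainder m n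
    certificate m zero = begin
      α m * (1# + 1# - 1#) - β m * (1# + 1# - 1#)
        -- At index 0 the halves share a term and must be treated together. The cofactors of z w - p
        -- and of (1 - p^(m+1)) I - 1 are written out and vanish in the next step.
        ≈⟨ solve 5 (λ z w x p i → let s = (:1 :- p :* x) :* (:1 :- p :* x) in
             (:1 :- z :* x) :* (:1 :- w :* x) :* s :* (:1 :+ :1 :- :1)
             :- (:1 :- p :* (x :* x)) :* (:1 :- p :* p :* (x :* x)) :* (:1 :+ :1 :- :1)
             := s :* ((:- (x :* z)) :- p :* x :* (:1 :- x) :* i) :* :1
                :+ s :* ((:- (x :* w)) :- p :* x :* (:1 :- x) :* i) :* :1 :- (:0 :+ :0)
                :+ (z :* w :- p) :* (x :* x :* s)
                :+ ((:1 :- x :* :1 :* p) :* i :- :1) :* ((:1 :+ :1) :* p :* x :* (:1 :- x) :* (:1 :- p :* x))) refl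
             z w (p ^ m) p (I m 0) ⟩
      _ ≈⟨ +-cong (+-congˡ (*-congʳ (trans (+-congʳ zw) (-‿inverseʳ p))))
             (*-congʳ (trans (+-congʳ (I-inverse m 0)) (-‿inverseʳ 1#))) ⟩
      _ ≈⟨ solve 3 (λ a b c → a :+ :0 :* b :+ :0 :* c := a) refl _ _ _ ⟩
      remainder m 1 - remainder m 0 ∎
    certificate m (suc k) = begin
      α m * (Z.F m (suc k) + W.F m (suc k) - 0#) - β m * (Z.F (suc m) (suc k) + W.F (suc m) (suc k) - 0#)
        ≈⟨ solve 8 (λ u v s a b c d e →
             u :* v :* s :* (a :+ b :- :0) :- e :* (c :+ d :- :0)
             := (u :* v :* s :* a :- e :* c) :+ (v :* u :* s :* b :- e :* d)) refl
             (1# - z * p ^ m) (1# - w * p ^ m) (square m) _ _ _ _ (β m) ⟩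
      _ ≈⟨ +-cong (Z.certificate w zw m k) (W.certificate z (trans (*-comm w z) zw) m k) ⟩
      _ ≈⟨ solve 4 (λ a b c d → (a :- b) :+ (c :- d) := (a :+ c) :- (b :+ d)) refl _ _ _ _ ⟩
      remainder m (suc (suc k)) - remainder m (suc k) ∎

    -- At m = 0 every later term contains the factor 1 - p⁰.
    initial-sum : (λ n → ∑< n (f 0)) ⟶ 1#
    initial-sum = geo-≈
      (λ { _ zero    → sym (+-identityˡ _)
         ; _ (suc n) → trans (solve 0 (:- :0 := :1 :- :1) refl) (+-congʳ (sym (one n))) })
      (geo-neg small-δ)
      where
      one : ∀ n → ∑< (suc n) (f 0) ≈ 1#
      one zero    = solve 0 (:0 :+ (:1 :+ :1 :- :1) := :1) refl
      one (suc n) = trans (+-cong (one n) (+-congʳ (+-cong (Z.F-zero 0 (suc n) (ℕ.s≤s ℕ.z≤n)) (W.F-zero 0 (suc n) (ℕ.s≤s ℕ.z≤n)))))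
        (solve 0 (:1 :+ (:0 :+ :0 :- :0) := :1) refl)

    triple-product : ∀ {A B C} → poch z p ⟶ A → poch w p ⟶ B → poch p p ⟶ C →
      (λ n → ∑< n (theta z w)) ⟶ A * B * C
    triple-product {A} {B} {C} hA hB hC =
      let S , T , f⟶S , theta⟶T , eq = connection {f = f} {c = remainder} {g = theta z w} {α = α} {β = β}
            (geo-- (geo-+ (small-∏ Z.small-ρ) (small-∏ W.small-ρ)) small-δ)
            f-theta (geo-+ Z.small-remainder W.small-remainder) (λ _ → +-identityˡ 0#)
            certificate ∏α ∏β
          -- The recursion yields A B C² = C T, so one factor C has to be cancelled.
          C′ , CC′ = ∏-invertible {x = λ k → p * p ^ k} {i = i} (geo-ᵇ* ⌜ p ⌝ base) bounded-i′
            (λ k → trans (*-congʳ (+-congˡ (-‿cong (*-comm p (p ^ k))))) (i-inverse k)) hC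
      in ⟶-lim (cancelˡ CC′ (begin
           C * T                ≈⟨ eq ⟨
           A * B * (C * C) * S  ≈⟨ *-congˡ (⟶-unique f⟶S initial-sum) ⟩
           A * B * (C * C) * 1# ≈⟨ solve 3 (λ a b c → a :* b :* (c :* c) :* :1 := c :* (a :* b :* c)) refl A B C ⟩
           C * (A * B * C)      ∎)) theta⟶T
      where
      ∏α : (λ n → ∏< n α) ⟶ A * B * (C * C)
      ∏α = ⟶-seq (λ n → sym (trans (∏-* n _ _) (*-cong (∏-* n _ _) (∏-* n _ _))))
        (⟶-* (⟶-* hA hB) (⟶-* hC hC))
      ∏β : (λ n → ∏< n β) ⟶ C
      ∏β = ⟶-seq (λ n → trans (∏-pairs n _) (∏-cong n λ k → trans
          (*-cong (+-congˡ (-‿cong (*-congˡ (^-homo-* p k k))))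
            (+-congˡ (-‿cong (*-congˡ (*-congʳ (^-homo-* p k k))))))
          (solve 2 (λ p x → (:1 :- p :* (x :* x)) :* (:1 :- p :* (x :* x :* p))
                         := (:1 :- p :* (x :* x)) :* (:1 :- p :* p :* (x :* x))) refl p (p ^ k))))
        (⟶-double hC)

-- Infinite products: splitting, squares, cubes, and the dissection of theta series

module Products (R : CommutativeRing 0ℓ 0ℓ) (G : GeometricBounds R) where
  open Pochhammer R G

  -- Carrying the bound along with the base makes `P` a function of two arguments; equalities of
  -- products then concern only the points.
  record BasePoint : Set where
    constructor _∶_
    field
      point : Carrier
      base  : Base point
  open BasePoint public

  infixl 7 _⊗_
  _⊗_ : BasePoint → BasePoint → BasePoint
  (p ∶ bp) ⊗ (r ∶ br) = (p * r) ∶ geo-≈ (λ _ n → sym (^-distrib-* p r n)) (geo-*ᵇ bp (geo-bounded br))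

  abstract
    -- Kept opaque: an infinite product is known from here on only through `P⟶`.
    P : Carrier → BasePoint → Carrier
    P a p = proj₁ (poch-converges (base p) a)

    P⟶ : ∀ a p → poch a (point p) ⟶ P a p
    P⟶ a p = proj₂ (poch-converges (base p) a)

  P-cong : ∀ {a b p r} → a ≈ b → point p ≈ point r → P a p ≈ P b r
  P-cong {a} {b} {p} {r} ab pr = ⟶-unique (⟶-seq (λ n → poch-cong n ab pr) (P⟶ a p)) (P⟶ b r)

  P-congˡ : ∀ {a b p} → a ≈ b → P a p ≈ P b p
  P-congˡ {p = p} ab = P-cong {p = p} {r = p} ab refl

  P-split : ∀ a p → P a p ≈ P a (p ⊗ p) * P (a * point p) (p ⊗ p)
  P-split a p = ⟶-unique (⟶-seq (λ n → poch-split a (point p) n) (⟶-double (P⟶ a p)))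
    (⟶-* (P⟶ a (p ⊗ p)) (P⟶ (a * point p) (p ⊗ p)))

  P-square : ∀ a p → P a p * P (- a) p ≈ P (a * a) (p ⊗ p)
  P-square a p = ⟶-unique (⟶-* (P⟶ a p) (P⟶ (- a) p))
    (⟶-seq (λ n → sym (poch-square a (point p) n)) (P⟶ (a * a) (p ⊗ p)))

  triple : ℕ → ℕ
  triple n = n ℕ.+ (n ℕ.+ n)

  triple-suc : ∀ n → triple (suc n) ≡ suc (suc (suc (triple n)))
  triple-suc n = ≡.cong suc (≡.trans (≡.cong (n ℕ.+_) (≡.cong suc (ℕₚ.+-suc n n)))
    (≡.trans (ℕₚ.+-suc n _) (≡.cong suc (ℕₚ.+-suc n _))))

  ^-triple : ∀ p n → p ^ triple n ≈ (p * p * p) ^ n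
  ^-triple p n = begin
    p ^ (n ℕ.+ (n ℕ.+ n))      ≈⟨ ^-homo-* p n (n ℕ.+ n) ⟩
    p ^ n * p ^ (n ℕ.+ n)      ≈⟨ *-comm _ _ ⟩
    p ^ (n ℕ.+ n) * p ^ n      ≈⟨ *-congʳ (^-double p n) ⟩
    (p * p) ^ n * p ^ n        ≈⟨ ^-distrib-* (p * p) p n ⟨
    (p * p * p) ^ n            ∎

  poch-split₃ : ∀ a p n → poch a p (triple n)
    ≈ poch a (p * p * p) n * poch (a * p) (p * p * p) n * poch (a * p * p) (p * p * p) n
  poch-split₃ a p zero    = solve 0 (:1 := :1 :* :1 :* :1) refl
  poch-split₃ a p (suc n) = begin
    poch a p (triple (suc n))
      ≡⟨ ≡.cong (poch a p) (triple-suc n) ⟩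
    poch a p (triple n) * (1# - a * r) * (1# - a * (r * p)) * (1# - a * (r * p * p))
      ≈⟨ *-cong (*-cong (*-cong (poch-split₃ a p n) (eq 1# (solve 2 (λ a r → a :* r := a :* r) refl a r)))
           (eq p (solve 3 (λ a r p → a :* (r :* p) := a :* p :* r) refl a r p)))
           (eq p (solve 3 (λ a r p → a :* (r :* p :* p) := a :* p :* p :* r) refl a r p)) ⟩
    _ ≈⟨ solve 6 (λ x y z u v w → x :* y :* z :* u :* v :* w := x :* u :* (y :* v) :* (z :* w)) refl _ _ _ _ _ _ ⟩
    _ ∎
    where
    r = p ^ triple n
    eq : ∀ {x b} → Carrier → x ≈ b * r → 1# - x ≈ 1# - b * (p * p * p) ^ n
    eq _ h = +-congˡ (-‿cong (trans h (*-congˡ (^-triple p n))))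

  P-split₃ : ∀ a p → P a p ≈ P a (p ⊗ p ⊗ p) * P (a * point p) (p ⊗ p ⊗ p) * P (a * point p * point p) (p ⊗ p ⊗ p)
  P-split₃ a p = ⟶-unique
    (⟶-seq (poch-split₃ a (point p)) (⟶-sub triple (λ n → ℕₚ.m≤m+n n (n ℕ.+ n)) (P⟶ a p)))
    (⟶-* (⟶-* (P⟶ a _) (P⟶ _ _)) (P⟶ _ _))

  module Cubic (ω : Carrier) (ω-relation : CubicRelation ω) where
    relation-0 : ∀ k z → z + (1# + ω + ω * ω) * k ≈ z
    relation-0 k z = trans (+-congˡ (trans (*-congʳ ω-relation) (zeroˡ k))) (+-identityʳ z)

    cube≈1 : ω * ω * ω ≈ 1#
    cube≈1 = trans (solve 1 (λ w → w :* w :* w := :1 :+ (:1 :+ w :+ w :* w) :* (w :- :1)) refl ω) (relation-0 _ 1#)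

    cubic-factor : ∀ u → (1# - u) * (1# - ω * u) * (1# - ω * ω * u) ≈ 1# - u * u * u
    cubic-factor u = trans (solve 2 (λ w u → (:1 :- u) :* (:1 :- w :* u) :* (:1 :- w :* w :* u)
        := :1 :- u :* u :* u :+ (:1 :+ w :+ w :* w) :* (w :* u :* u :- u :- u :* u :* u :* (w :- :1))) refl ω u)
      (relation-0 _ _)

    -- Factor by factor, (1 - u)(1 - ωu)(1 - ω²u) = 1 - u³.
    P-cube : ∀ a p → P a p * P (ω * a) p * P (ω * ω * a) p ≈ P (a * a * a) (p ⊗ p ⊗ p)
    P-cube a p = ⟶-unique (⟶-* (⟶-* (P⟶ a p) (P⟶ _ p)) (P⟶ _ p))
      (⟶-seq (λ n → sym (trans (sym (trans (∏-* n _ _) (*-congʳ (∏-* n _ _)))) (∏-cong n (factor n))))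
        (P⟶ (a * a * a) (p ⊗ p ⊗ p)))
      where
      r = point p
      factor : ∀ n k → (1# - a * r ^ k) * (1# - ω * a * r ^ k) * (1# - ω * ω * a * r ^ k)
             ≈ 1# - a * a * a * (r * r * r) ^ k
      factor n k = begin
        _ ≈⟨ *-cong (*-congˡ (+-congˡ (-‿cong (*-assoc _ _ _)))) (+-congˡ (-‿cong (*-assoc _ _ _))) ⟩
        _ ≈⟨ cubic-factor (a * r ^ k) ⟩
        _ ≈⟨ +-congˡ (-‿cong (solve 2 (λ a t → let u = a :* t in u :* u :* u := a :* a :* a :* (t :* t :* t)) refl a (r ^ k))) ⟩
        _ ≈⟨ +-congˡ (-‿cong (*-congˡ (trans (^-distrib-* (r * r) r k) (*-congʳ (^-square r k))))) ⟨
        _ ∎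

  module Units (q : Carrier) (base-q : Base q) where
    open Inverses q base-q public

    abstract
      unit : ∀ {a e f} p → Sixth a e → Sixth (point p) f → ∃ λ u → P (q * a) p * u ≈ 1#
      unit {a} p sa sp =
        let i , bounded , inv = inverses {λ _ n → a * point p ^ n}
              (λ _ n → _ , sixth-* sa (proj₂ (sixth-^ sp n))) (⌜ a ⌝ ⊠ geo-bounded (base p))
        in ∏-invertible {x = λ k → q * a * point p ^ k} {i = i 0} (geo-ᵇ* ⌜ q * a ⌝ (base p))
             (geo-reindex (λ _ _ → 0) (λ _ n → n) bounded)
             (λ k → trans (*-congʳ (+-congˡ (-‿cong (*-assoc q a _)))) (inv 0 k)) (P⟶ (q * a) p)

    abstract
      sixth-neg : ∀ {x e} → Sixth x e → Sixth (- x) e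
      sixth-neg {x} (mkSixth s) = mkSixth (trans (solve 1 (λ x → let y = :- x in
        y :* y :* y :* (y :* y :* y) := x :* x :* x :* (x :* x :* x)) refl x) s)

    -- (zp^n)_n for p = (−q)³ runs through the two residue classes of the
    -- exponent modulo 2, which are the theta series with base q¹².
    module Dissection (base-Q : Base (- q)) where
      Q̂ q̂ q̂₂ q̂₃ q̂₆ q̂₁₂ Q̂₃ : BasePoint
      Q̂ = (- q) ∶ base-Q
      q̂ = q ∶ base-q
      q̂₂ = q̂ ⊗ q̂
      q̂₃ = q̂₂ ⊗ q̂
      q̂₆ = q̂₃ ⊗ q̂₃
      q̂₁₂ = q̂₆ ⊗ q̂₆
      Q̂₃ = Q̂ ⊗ Q̂ ⊗ Q̂

      q₅ q₇ q₁₁ p r : Carrier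
      q₅ = q * q * q * (q * q)
      q₇ = q * q * q * (q * q * q) * q
      q₁₁ = q * q * q * (q * q * q) * q₅
      p = point Q̂₃
      r = point q̂₁₂

      abstract
        -- Supplies the inverses that the triple product requires in base t.
        reciprocals : ∀ {a e f} (t : BasePoint) → point t ≈ q * a → Sixth a e → Sixth (point t) f →
          ∃ λ (i : ℕ → Carrier) → Bounded (λ _ n → i n) × (∀ k → (1# - point t ^ suc k) * i k ≈ 1#)
        reciprocals {a} t eq sa st =
          let i , bounded , inv = inverses {λ _ n → a * point t ^ n}
                (λ _ n → _ , sixth-* sa (proj₂ (sixth-^ st n))) (⌜ a ⌝ ⊠ geo-bounded (base t))
          in i 0 , geo-reindex (λ _ _ → 0) (λ _ n → n) bounded
             , λ k → trans (*-congʳ (+-congˡ (-‿cong (trans (*-congˡ eq)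
                 (solve 3 (λ x q a → x :* (q :* a) := q :* (a :* x)) refl _ q a))))) (inv 0 k)

      sixth-Q : Sixth (- q) 6
      sixth-Q = sixth-neg sixth-q

      sixth-qq : Sixth (q * q) 12
      sixth-qq = sixth-* sixth-q sixth-q

      sixth-q₅ : Sixth q₅ 30
      sixth-q₅ = sixth-* (sixth-* sixth-qq sixth-q) sixth-qq

      sixth-q₆ : Sixth (q * q * q * (q * q * q)) 36
      sixth-q₆ = sixth-* (sixth-* sixth-qq sixth-q) (sixth-* sixth-qq sixth-q)

      i-Q = reciprocals Q̂₃ (solve 1 (λ q → let Q = :- q in Q :* Q :* Q := q :* (:- (q :* q))) refl q)
        (sixth-neg sixth-qq) (sixth-* (sixth-* sixth-Q sixth-Q) sixth-Q)
      i-q = reciprocals q̂₁₂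
        (solve 1 (λ q → let s = q :* q :* q :* (q :* q :* q) in s :* s
                  := q :* (s :* (q :* q :* q :* (q :* q)))) refl q)
        (sixth-* sixth-q₆ sixth-q₅) (sixth-* sixth-q₆ sixth-q₆)

      module JQ = TripleProduct R G p (base Q̂₃) (proj₁ i-Q) (proj₁ (proj₂ i-Q)) (proj₂ (proj₂ i-Q))
      module Jq = TripleProduct R G r (base q̂₁₂) (proj₁ i-q) (proj₁ (proj₂ i-q)) (proj₂ (proj₂ i-q))

      r^ : ∀ n → r ^ n ≈ p ^ n * p ^ n * (p ^ n * p ^ n)
      r^ n = begin
        r ^ n                              ≈⟨ ^-cong n (solve 1 (λ q → let s = q :* q :* q :* (q :* q :* q) ; Q = :- q ; p = Q :* Q :* Q in s :* s := p :* p :* (p :* p)) refl q) ⟩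
        (p * p * (p * p)) ^ n              ≈⟨ ^-square (p * p) n ⟩
        (p * p) ^ n * (p * p) ^ n          ≈⟨ *-cong (^-square p n) (^-square p n) ⟩
        p ^ n * p ^ n * (p ^ n * p ^ n)    ∎

      J₅ J₁ : Carrier
      J₅ = P q₅ q̂₁₂ * P q₇ q̂₁₂ * P r q̂₁₂
      J₁ = P q q̂₁₂ * P q₁₁ q̂₁₂ * P r q̂₁₂

      module _ (s : Carrier) (ss : s * s ≈ 1#) where
        z w : Carrier
        z = s * (- q)
        w = s * ((- q) * (- q))

        strip : ∀ {x y} → x ≈ s * s * y → x ≈ y
        strip h = trans h (trans (*-congʳ ss) (*-identityˡ _))

        zw : z * w ≈ p
        zw = strip (solve 2 (λ s q → let Q = :- q in s :* Q :* (s :* (Q :* Q)) := s :* s :* (Q :* Q :* Q)) refl s q)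

        σz σw τ₅ τ₇ τ₁ τ₁₁ : ℕ → Carrier
        σz = JQ.Half.σ z
        σw = JQ.Half.σ w
        τ₁ = Jq.Half.σ q
        τ₅ = Jq.Half.σ q₅
        τ₇ = Jq.Half.σ q₇
        τ₁₁ = Jq.Half.σ q₁₁

        -- Two consecutive factors give x² p^(4k+1), and p⁴ = r; so y is -x²p, which is q⁵ for x = z
        -- and q⁷ for x = w.
        even : ∀ {x y} → (∀ t → - x * t * (- x * (t * p)) ≈ - y * (t * t)) →
          ∀ n → ∏< (n ℕ.+ n) (JQ.Half.σ x) ≈ ∏< n (Jq.Half.σ y)
        even {x} {y} h n = trans (∏-pairs n _) (∏-cong n λ k → begin
          - x * p ^ (k ℕ.+ k) * (- x * (p ^ (k ℕ.+ k) * p))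
            ≈⟨ h (p ^ (k ℕ.+ k)) ⟩
          - y * (p ^ (k ℕ.+ k) * p ^ (k ℕ.+ k))
            ≈⟨ *-congˡ (trans (*-cong (^-homo-* p k k) (^-homo-* p k k)) (sym (r^ k))) ⟩
          - y * r ^ k ∎)

        -- The factor of index 0 is split off as c, and the pairing starts at index 1.
        odd : ∀ {x} (c : Carrier) (f : ℕ → Carrier) → - x * 1# ≈ c →
          (∀ k t → r ^ k ≈ t * t → - x * (t * p) * (- x * (t * p * p)) ≈ f k) →
          ∀ n → ∏< (suc (n ℕ.+ n)) (JQ.Half.σ x) ≈ c * ∏< n f
        odd {x} c f h₀ h zero    = trans (*-identityˡ _) (trans h₀ (sym (*-identityʳ c)))
        odd {x} c f h₀ h (suc n) = begin
          ∏< (suc (suc n ℕ.+ suc n)) (JQ.Half.σ x)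
            ≡⟨ ≡.cong (λ k → ∏< (suc k) (JQ.Half.σ x)) (double-suc n) ⟩
          ∏< (suc (n ℕ.+ n)) (JQ.Half.σ x) * (- x * (p ^ (n ℕ.+ n) * p)) * (- x * (p ^ (n ℕ.+ n) * p * p))
            ≈⟨ *-assoc _ _ _ ⟩
          ∏< (suc (n ℕ.+ n)) (JQ.Half.σ x) * ((- x * (p ^ (n ℕ.+ n) * p)) * (- x * (p ^ (n ℕ.+ n) * p * p)))
            ≈⟨ *-cong (odd c f h₀ h n)
                 (h n (p ^ (n ℕ.+ n)) (trans (r^ n) (sym (*-cong (^-homo-* p n n) (^-homo-* p n n))))) ⟩
          c * ∏< n f * f n
            ≈⟨ *-assoc _ _ _ ⟩
          c * (∏< n f * f n) ∎

        even-z : ∀ n → ∏< (n ℕ.+ n) σz ≈ ∏< n τ₅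
        even-z = even λ t → strip (solve 3 (λ s q t → let Q = :- q ; x = s :* Q in
          (:- x) :* t :* ((:- x) :* (t :* (Q :* Q :* Q)))
          := s :* s :* ((:- (q :* q :* q :* (q :* q))) :* (t :* t))) refl s q t)

        even-w : ∀ n → ∏< (n ℕ.+ n) σw ≈ ∏< n τ₇
        even-w = even λ t → strip (solve 3 (λ s q t → let Q = :- q ; x = s :* (Q :* Q) in
          (:- x) :* t :* ((:- x) :* (t :* (Q :* Q :* Q)))
          := s :* s :* ((:- (q :* q :* q :* (q :* q :* q) :* q)) :* (t :* t))) refl s q t)

        odd-z : ∀ n → ∏< (suc (n ℕ.+ n)) σz ≈ s * q * ∏< n τ₁₁
        odd-z = odd (s * q) τ₁₁ (solve 2 (λ s q → (:- (s :* (:- q))) :* :1 := s :* q) refl s q)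
          λ k t rt → trans (strip (solve 3 (λ s q t → let Q = :- q ; x = s :* Q ; p = Q :* Q :* Q in
              (:- x) :* (t :* p) :* ((:- x) :* (t :* p :* p))
              := s :* s :* ((:- (q :* q :* q :* (q :* q :* q) :* (q :* q :* q :* (q :* q)))) :* (t :* t))) refl s q t))
            (*-congˡ (sym rt))

        -- The pairs give -q r^(k+1), one step ahead in the theta series of q. The left-over factor
        -- -q is its factor of index 0, so the result has n + 1 factors.
        odd-w : ∀ n → ∏< (suc (n ℕ.+ n)) σw ≈ s * q * ∏< (suc n) τ₁
        odd-w n = begin
          ∏< (suc (n ℕ.+ n)) σw
            ≈⟨ odd (s * q * (- q)) (λ k → τ₁ (suc k))
                 (solve 2 (λ s q → (:- (s :* ((:- q) :* (:- q)))) :* :1 := s :* q :* (:- q)) refl s q)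
                 (λ k t rt → trans (strip (solve 3 (λ s q t → let Q = :- q ; x = s :* (Q :* Q) ; p = Q :* Q :* Q ; v = q :* q :* q :* (q :* q :* q) in
                     (:- x) :* (t :* p) :* ((:- x) :* (t :* p :* p))
                     := s :* s :* ((:- q) :* (t :* t :* (v :* v)))) refl s q t))
                   (*-congˡ (*-congʳ (sym rt)))) n ⟩
          s * q * (- q) * ∏< n (λ k → τ₁ (suc k))
            ≈⟨ *-assoc _ _ _ ⟩
          s * q * (- q * ∏< n (λ k → τ₁ (suc k)))
            ≈⟨ *-congˡ (front n) ⟩
          s * q * ∏< (suc n) τ₁ ∎
          where
          front : ∀ n → - q * ∏< n (λ k → τ₁ (suc k)) ≈ ∏< (suc n) τ₁
          front zero    = solve 1 (λ q → (:- q) :* :1 := :1 :* ((:- q) :* :1)) refl q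
          front (suc n) = trans (sym (*-assoc _ _ _)) (*-congʳ (front n))

        δ-double : ∀ n → JQ.δ (n ℕ.+ n) ≈ Jq.δ n
        δ-double zero    = refl
        δ-double (suc n) = refl

        -- The products of τ₁ come with index k + 1, those of τ₁₁ with index k; realigning them
        -- leaves a boundary term that tends to 0.
        odd-sum : ∀ n → ∑< n (λ k → ∏< k τ₁₁ + ∏< (suc k) τ₁) ≈ ∑< n (Jq.theta q q₁₁) + (∏< n τ₁ - Jq.δ n)
        odd-sum zero    = solve 0 (:0 := :0 :+ (:1 :- :1)) refl
        odd-sum (suc n) = trans (+-congʳ (odd-sum n))
          (solve 5 (λ a z d w z′ → a :+ (z :- d) :+ (w :+ z′) := a :+ (z :+ w :- d) :+ (z′ :- :0)) refl
            _ (∏< n τ₁) (Jq.δ n) (∏< n τ₁₁) (∏< (suc n) τ₁))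

        partial-sum : ∀ n → ∑< (n ℕ.+ n) (JQ.theta z w)
          ≈ ∑< n (Jq.theta q₅ q₇) + s * q * (∑< n (Jq.theta q q₁₁) + (∏< n τ₁ - Jq.δ n))
        partial-sum n = begin
          ∑< (n ℕ.+ n) (JQ.theta z w)
            ≈⟨ ∑-pairs n _ ⟩
          ∑< n (λ k → JQ.theta z w (k ℕ.+ k) + JQ.theta z w (suc (k ℕ.+ k)))
            ≈⟨ ∑-cong n (λ k → +-cong (+-cong (+-cong (even-z k) (even-w k)) (-‿cong (δ-double k)))
                 (trans (+-congʳ (+-cong (odd-z k) (odd-w k)))
                   (solve 3 (λ c a b → c :* a :+ c :* b :- :0 := c :* (a :+ b)) refl (s * q) _ _))) ⟩
          ∑< n (λ k → Jq.theta q₅ q₇ k + s * q * (∏< k τ₁₁ + ∏< (suc k) τ₁))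
            ≈⟨ ∑-+ n _ _ ⟩
          ∑< n (Jq.theta q₅ q₇) + ∑< n (λ k → s * q * (∏< k τ₁₁ + ∏< (suc k) τ₁))
            ≈⟨ +-congˡ (trans (∑-* n _ _) (*-congˡ (odd-sum n))) ⟩
          _ ∎

        dissection : P z Q̂₃ * P w Q̂₃ * P p Q̂₃ ≈ J₅ + s * q * J₁
        dissection = ⟶-unique
          (⟶-double (JQ.triple-product zw (P⟶ z Q̂₃) (P⟶ w Q̂₃) (P⟶ p Q̂₃)))
          (⟶-seq (λ n → sym (partial-sum n)) (⟶-lim (+-congˡ (*-congˡ (trans (+-congˡ
              (solve 0 (:0 :- :0 := :0) refl)) (+-identityʳ J₁))))
            (⟶-+ (Jq.triple-product zw₅ (P⟶ q₅ q̂₁₂) (P⟶ q₇ q̂₁₂) (P⟶ r q̂₁₂))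
              (⟶-scale (s * q) (⟶-+ (Jq.triple-product zw₁ (P⟶ q q̂₁₂) (P⟶ q₁₁ q̂₁₂) (P⟶ r q̂₁₂))
                (⟶-- (small⇒⟶0 (geo-reindex (λ _ _ → 0) (λ _ n → n) (small-∏ (Jq.Half.small-σ q))))
                     (small⇒⟶0 Jq.small-δ)))))))
          where
          zw₅ : q₅ * q₇ ≈ r
          zw₅ = solve 1 (λ q → let v = q :* q :* q in v :* (q :* q) :* (v :* v :* q) := v :* v :* (v :* v)) refl q
          zw₁ : q * q₁₁ ≈ r
          zw₁ = solve 1 (λ q → let v = q :* q :* q in q :* (v :* v :* (v :* (q :* q))) := v :* v :* (v :* v)) refl q

-- Evaluation of ∑ a_n and ∑ b_n, and of the two sums

module Evaluation (R : CommutativeRing 0ℓ 0ℓ) (G : GeometricBounds R)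
  (q ω : CommutativeRing.Carrier R)
  (base-q : Pochhammer.Base R G q) (base-Q : Pochhammer.Base R G (CommutativeRing.-_ R q))
  (ω-relation : Pochhammer.CubicRelation R G ω)
  (½ : CommutativeRing.Carrier R) (half : Pochhammer.IsHalf R G ½) where
  open Products R G
  open Pochhammer R G
  open Cubic ω ω-relation
  open Units q base-q
  open Dissection base-Q
  module F = FirstSum R G q base-q
  module S = SecondSum R G q ω base-q ω-relation

  sixth-ω : Sixth ω 0
  sixth-ω = S.sixth-ω

  q̂₄ : BasePoint
  q̂₄ = q̂₂ ⊗ q̂₂

  six-q₂ = sixth-qq
  six-q₃ = sixth-* six-q₂ sixth-q
  six-q₄ = sixth-* six-q₂ six-q₂

  infixl 6 _by_
  _by_ : ∀ {x y z : Carrier} → x ≈ y → y ≈ z → x ≈ z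
  _by_ = trans

  unit-* : ∀ {x y} → (∃ λ u → x * u ≈ 1#) → (∃ λ u → y * u ≈ 1#) → ∃ λ u → x * y * u ≈ 1#
  unit-* {x} {y} (u , xu) (v , yv) = u * v ,
    (solve 4 (λ x y u v → x :* y :* (u :* v) := x :* u :* (y :* v)) refl x y u v by *-cong xu yv by *-identityˡ 1#)

  unit-≈ : ∀ {x y} → x ≈ y → (∃ λ u → x * u ≈ 1#) → ∃ λ u → y * u ≈ 1#
  unit-≈ xy (u , xu) = u , (*-congʳ (sym xy) by xu)

  cancel-unit : ∀ {a x y} → (∃ λ u → a * u ≈ 1#) → a * x ≈ a * y → x ≈ y
  cancel-unit (u , au) = cancelˡ au

  unitᵖ : ∀ {a b e f} (p : BasePoint) → q * a ≈ b → Sixth a e → Sixth (point p) f → ∃ λ u → P b p * u ≈ 1#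
  unitᵖ p eq sa sp = unit-≈ (P-congˡ {p = p} eq) (unit p sa sp)

  y₃ y₄ Y : Carrier
  y₃ = P (q * q * q) q̂₃
  y₄ = P (ω * (q * q)) q̂₄
  Y = y₃ * y₄

  unit-Y : ∃ λ u → Y * u ≈ 1#
  unit-Y = unit-*
    (unitᵖ q̂₃ (solve 1 (λ q → q :* (q :* q) := q :* q :* q) refl q) six-q₂ six-q₃)
    (unitᵖ q̂₄ (solve 2 (λ w q → q :* (w :* q) := w :* (q :* q)) refl ω q) (sixth-* sixth-ω sixth-q) six-q₄)

  sixth--1 : Sixth (- 1#) 0
  sixth--1 = sixth-neg sixth-1

  o₁ h₃ w₁ k₁ l₃ : Carrier
  o₁ = P q q̂₂
  h₃ = P (q * q * q) q̂₆
  w₁ = P (ω * ω * q) q̂₂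
  k₁ = P (- (ω * q)) q̂₂
  l₃ = P (- (q * q * q)) q̂₆

  abstract
    first-at : ∀ c (s : Sixth c 0) → ∃₂ λ S T → (λ n → ∑< n (F.b c s 0)) ⟶ S × (λ n → ∑< n (λ k → ∏< k F.σ)) ⟶ T
      × P (c * c * q) q̂₂ * S ≈ P (- (c * q)) q̂₂ * P (- (c * c * c * (q * q * q))) q̂₆ * T
    first-at c s = F.first-sum c s
      (⟶-seq (λ n → sym (F.∏α c s n)) (⟶-double (P⟶ _ q̂₂)))
      (⟶-seq (λ n → sym (F.∏β c s n)) (⟶-* (P⟶ _ q̂₂) (P⟶ _ q̂₆)))

  first₋ = first-at (- 1#) sixth--1
  first = first-at ω sixth-ω

  Tb : Carrier
  Tb = proj₁ first

  abstract
    single : ∀ {f : ℕ → Carrier} {z} → f 0 ≈ z → (∀ n → f (suc n) ≈ 0#) → (λ n → ∑< n f) ⟶ z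
    single {f} {z} f0 f+ = geo-≈ {x = λ _ n → - (z * Jq.δ n)}
        (λ { _ zero    → solve 1 (λ z → :- (z :* :1) := :0 :- z) refl z
           ; _ (suc n) → solve 1 (λ z → :- (z :* :0) := z :- z) refl z by +-congʳ (sym (sum n)) })
        (geo-neg (geo-ᵇ* ⌜ z ⌝ Jq.small-δ))
      where
      sum : ∀ n → ∑< (suc n) f ≈ z
      sum zero    = +-identityˡ _ by f0
      sum (suc n) = +-cong (sum n) (f+ n) by +-identityʳ z

  -- At x = -1 and y = 1 the factor 1 + xy is 0, so every term after the first vanishes.
  first₋-start : proj₁ first₋ ≈ 1#
  first₋-start = ⟶-unique (proj₁ (proj₂ (proj₂ first₋))) (single {f = F.b (- 1#) sixth--1 0} {z = 1#} refl vanish)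
    where
    vanish : ∀ n → F.b (- 1#) sixth--1 0 (suc n) ≈ 0#
    vanish zero = begin
      1# * F.ρ (- 1#) sixth--1 0 0
        ≈⟨ *-congˡ (*-congʳ (*-congʳ (*-congʳ (solve 0 (:1 :+ (:- :1) :* (:1 :* :1) :* :1 := :0) refl)))) ⟩
      1# * (0# * (F.x (- 1#) sixth--1 0 + q * q * (1# * 1#)) * (q * 1#) * (F.i₂ (- 1#) sixth--1 0 0 * F.i₃ 0))
        ≈⟨ solve 3 (λ u v w → :1 :* (:0 :* u :* v :* w) := :0) refl _ _ _ ⟩
      0# ∎
    vanish (suc n) = *-congʳ (vanish n) by zeroˡ _

  unit-o₁ : ∃ λ u → o₁ * u ≈ 1#
  unit-o₁ = unitᵖ q̂₂ (*-identityʳ q) sixth-1 six-q₂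
  unit-h₃ : ∃ λ u → h₃ * u ≈ 1#
  unit-h₃ = unitᵖ q̂₆ (solve 1 (λ q → q :* (q :* q) := q :* q :* q) refl q) six-q₂ (sixth-* six-q₃ six-q₃)
  unit-w₁ : ∃ λ u → w₁ * u ≈ 1#
  unit-w₁ = unitᵖ q̂₂ (solve 2 (λ w q → q :* (w :* w) := w :* w :* q) refl ω q) (sixth-* sixth-ω sixth-ω) six-q₂

  T₁ : Carrier
  T₁ = proj₁ (proj₂ first)

  -- Both specialisations share the value T₁ at x = 0, and c = -1 gives (q;q²) = (q;q²)(q³;q⁶) T₁.
  h₃T₁ : h₃ * T₁ ≈ 1#
  h₃T₁ = cancel-unit unit-o₁ (begin
    o₁ * (h₃ * T₁)
      ≈⟨ *-assoc _ _ _ ⟨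
    o₁ * h₃ * T₁
      ≈⟨ *-cong (*-cong (P-congˡ {p = q̂₂} (solve 1 (λ q → q := :- ((:- :1) :* q)) refl q))
            (P-congˡ {p = q̂₆} (solve 1 (λ q → q :* q :* q := :- ((:- :1) :* (:- :1) :* (:- :1) :* (q :* q :* q))) refl q)))
          (⟶-unique (proj₁ (proj₂ (proj₂ (proj₂ first)))) (proj₁ (proj₂ (proj₂ (proj₂ first₋))))) ⟩
    P (- (- 1# * q)) q̂₂ * P (- (- 1# * - 1# * - 1# * (q * q * q))) q̂₆ * proj₁ (proj₂ first₋)
      ≈⟨ proj₂ (proj₂ (proj₂ (proj₂ first₋))) ⟨
    P (- 1# * - 1# * q) q̂₂ * proj₁ first₋
      ≈⟨ *-cong (P-congˡ {p = q̂₂} (solve 1 (λ q → (:- :1) :* (:- :1) :* q := q) refl q)) first₋-start ⟩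
    o₁ * 1# ∎)

  -- With denominators cleared: ∑ b_n = (-ωq;q²)(-q³;q⁶) / ((q³;q⁶)(ω²q;q²)).
  Tb-product : h₃ * w₁ * Tb ≈ k₁ * l₃
  Tb-product = begin
    h₃ * w₁ * Tb            ≈⟨ *-assoc _ _ _ ⟩
    h₃ * (w₁ * Tb)          ≈⟨ *-congˡ (proj₂ (proj₂ (proj₂ (proj₂ first)))) ⟩
    h₃ * (k₁ * P (- (ω * ω * ω * (q * q * q))) q̂₆ * T₁)
      ≈⟨ *-congˡ (*-congʳ (*-congˡ (P-congˡ {p = q̂₆} (-‿cong (*-congʳ cube≈1 by *-identityˡ _))))) ⟩
    h₃ * (k₁ * l₃ * T₁)     ≈⟨ solve 4 (λ h k l t → h :* (k :* l :* t) := h :* t :* (k :* l)) refl h₃ k₁ l₃ T₁ ⟩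
    h₃ * T₁ * (k₁ * l₃)     ≈⟨ *-congʳ h₃T₁ ⟩
    1# * (k₁ * l₃)          ≈⟨ *-identityˡ _ ⟩
    k₁ * l₃                 ∎

  abstract
    second-at : ∀ c (s : Sixth c 0) → ∃₂ λ S T → (λ n → ∑< n (S.a c s 0)) ⟶ S × (λ n → ∑< n S.g) ⟶ T
      × P (ω * c * q) q̂ * S ≈ P (- (ω * ω * c * (q * q))) q̂₂ * P (- (c * q)) q̂₂ * T
    second-at c s = S.second-sum c s
      (⟶-seq (λ n → sym (S.∏α c s n)) (⟶-double (P⟶ _ q̂)))
      (⟶-seq (λ n → sym (S.∏β c s n)) (⟶-* (P⟶ _ q̂₂) (P⟶ _ q̂₂)))

  -- The root of v + ω², at which the series in v stops after its first term 1 + ω.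
  c₋ : Carrier
  c₋ = - (ω * ω)
  sixth-c₋ : Sixth c₋ 0
  sixth-c₋ = sixth-neg (sixth-* sixth-ω sixth-ω)

  second₋ = second-at c₋ sixth-c₋
  second = second-at 1# sixth-1

  Gs : Carrier
  Gs = proj₁ second

  second₋-start : proj₁ second₋ ≈ 1# + ω
  second₋-start = ⟶-unique (proj₁ (proj₂ (proj₂ second₋)))
    (single {f = S.a c₋ sixth-c₋ 0} {z = 1# + ω}
      (solve 1 (λ w → :1 :* (:1 :+ w :* :1) := :1 :+ w) refl ω) λ n → *-congʳ (vanish n) by zeroˡ _)
    where
    vanish : ∀ n → S.A c₋ sixth-c₋ 0 (suc n) ≈ 0#
    vanish zero = solve 4 (λ q w i j → let v = (:- (w :* w)) :* (:1 :* :1) in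
      :1 :* ((:1 :+ w :* (q :* :1)) :* (v :+ w :* w :* (:1 :* :1)) :* (w :* (q :* :1)) :* (i :* j)) := :0) refl
      q ω (S.e 0) (S.i c₋ sixth-c₋ 0 0)
    vanish (suc n) = *-congʳ (vanish n) by zeroˡ _

  a₁ m₂ m₁ n₁ w₂ t₂ o o₂ z₄ : Carrier
  a₁ = P (ω * q) q̂
  m₂ = P (- (ω * ω * (q * q))) q̂₂
  m₁ = P (- q) q̂₂
  n₁ = P (- q) q̂
  w₂ = P (ω * (q * q)) q̂₂
  t₂ = P (ω * ω * (q * q)) q̂₂
  o = P q q̂
  o₂ = P (q * q) q̂₂
  z₄ = P (ω * (q * q * (q * q))) q̂₄

  -- The common value at v = 0 is eliminated between the specialisations v = 1 and v = -ω².
  Gs-product : a₁ * w₂ * w₁ * Gs ≈ m₂ * m₁ * n₁ * (1# + ω)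
  Gs-product = begin
    a₁ * w₂ * w₁ * Gs
      ≈⟨ solve 4 (λ a v w g → a :* v :* w :* g := v :* w :* (a :* g)) refl a₁ w₂ w₁ Gs ⟩
    w₂ * w₁ * (a₁ * Gs)
      ≈⟨ *-congˡ (*-congʳ (P-congˡ {p = q̂} (solve 2 (λ w q → w :* q := w :* :1 :* q) refl ω q))
           by proj₂ (proj₂ (proj₂ (proj₂ second)))
           by *-congʳ (*-cong (P-congˡ {p = q̂₂} (solve 2 (λ w q → :- (w :* w :* :1 :* (q :* q)) := :- (w :* w :* (q :* q))) refl ω q))
                (P-congˡ {p = q̂₂} (-‿cong (*-identityˡ q))))) ⟩
    w₂ * w₁ * (m₂ * m₁ * T)
      ≈⟨ solve 5 (λ a b c d t → a :* b :* (c :* d :* t) := c :* d :* (a :* b :* t)) refl w₂ w₁ m₂ m₁ T ⟩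
    m₂ * m₁ * (w₂ * w₁ * T)
      ≈⟨ *-congˡ (begin
           w₂ * w₁ * T
             ≈⟨ *-cong (*-cong (P-congˡ {p = q̂₂} (ω⁴ (q * q)))
                  (P-congˡ {p = q̂₂} (solve 2 (λ w q → w :* w :* q := :- ((:- (w :* w)) :* q)) refl ω q)))
                  (⟶-unique (proj₁ (proj₂ (proj₂ (proj₂ second)))) (proj₁ (proj₂ (proj₂ (proj₂ second₋))))) ⟩
           P (- (ω * ω * c₋ * (q * q))) q̂₂ * P (- (c₋ * q)) q̂₂ * proj₁ (proj₂ second₋)
             ≈⟨ proj₂ (proj₂ (proj₂ (proj₂ second₋))) ⟨
           P (ω * c₋ * q) q̂ * proj₁ second₋
             ≈⟨ *-cong (P-congˡ {p = q̂} (solve 2 (λ w q → w :* (:- (w :* w)) :* q := :- (w :* w :* w :* q)) refl ω q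
                  by -‿cong (*-congʳ cube≈1 by *-identityˡ q))) second₋-start ⟩
           n₁ * (1# + ω) ∎) ⟩
    m₂ * m₁ * (n₁ * (1# + ω))
      ≈⟨ *-assoc _ _ _ ⟨
    m₂ * m₁ * n₁ * (1# + ω) ∎
    where
    T = proj₁ (proj₂ second)
    ω⁴ : ∀ u → ω * u ≈ - (ω * ω * c₋ * u)
    ω⁴ u = sym (solve 2 (λ w u → :- (w :* w :* (:- (w :* w)) :* u) := w :* w :* w :* (w :* u)) refl ω u
      by *-congʳ cube≈1 by *-identityˡ _)

  1+ω : 1# + ω ≈ - (ω * ω)
  1+ω = sym (relation-0 (- 1#) (1# + ω)) by solve 1 (λ w → :1 :+ w :+ (:1 :+ w :+ w :* w) :* (:- :1) := :- (w :* w)) refl ω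

  1+ωω : 1# + ω * ω ≈ - ω
  1+ωω = sym (relation-0 (- 1#) (1# + ω * ω)) by solve 1 (λ w → :1 :+ w :* w :+ (:1 :+ w :+ w :* w) :* (:- :1) := :- w) refl ω

  -- For s = ±1, the left side of `dissection`.
  X : Carrier → Carrier
  X s = P (s * (- q)) Q̂₃ * P (s * ((- q) * (- q))) Q̂₃ * P p Q̂₃

  -- For s = 1 the three products are the residue classes modulo 3 of (Q;Q)_∞, which is then split
  -- modulo 2.
  X₊≈ : X 1# ≈ m₁ * o₂
  X₊≈ = begin
    X 1#
      ≈⟨ *-congʳ (*-cong (P-congˡ {p = Q̂₃} (*-identityˡ _)) (P-congˡ {p = Q̂₃} (*-identityˡ _))) ⟩
    P (- q) Q̂₃ * P (- q * - q) Q̂₃ * P (- q * - q * - q) Q̂₃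
      ≈⟨ P-split₃ (- q) Q̂ ⟨
    P (- q) Q̂
      ≈⟨ P-split (- q) Q̂ ⟩
    P (- q) (Q̂ ⊗ Q̂) * P (- q * - q) (Q̂ ⊗ Q̂)
      ≈⟨ *-cong (P-cong {p = Q̂ ⊗ Q̂} {r = q̂₂} refl QQ) (P-cong {p = Q̂ ⊗ Q̂} {r = q̂₂} QQ QQ) ⟩
    m₁ * o₂ ∎
    where
    QQ : - q * - q ≈ q * q
    QQ = solve 1 (λ q → (:- q) :* (:- q) := q :* q) refl q

  -- Both sides are multiplied by the denominators of ∑ a_n and by (ω²q²;q²)(q;q). The latter
  -- complete partial products, above all (q;q)(ωq;q)(ω²q;q) = (q³;q³).
  GY : - ω * Gs * Y ≈ X 1#
  GY = cancel-unit units (begin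
    a₁ * w₂ * w₁ * (t₂ * o) * (- ω * Gs * (y₃ * y₄))
      ≈⟨ solve 7 (λ u t o w g y y′ → u :* (t :* o) :* (w :* g :* (y :* y′)) := u :* g :* (w :* y :* y′ :* t :* o)) refl
           (a₁ * w₂ * w₁) t₂ o (- ω) Gs y₃ y₄ ⟩
    a₁ * w₂ * w₁ * Gs * (- ω * y₃ * y₄ * t₂ * o)
      ≈⟨ *-congʳ (Gs-product by *-congˡ 1+ω) ⟩
    m₂ * m₁ * n₁ * - (ω * ω) * (- ω * y₃ * y₄ * t₂ * o)
      ≈⟨ solve 8 (λ m₂ m₁ n w y y′ t o → m₂ :* m₁ :* n :* (:- (w :* w)) :* ((:- w) :* y :* y′ :* t :* o)
           := w :* w :* w :* (y :* (y′ :* (t :* m₂)) :* m₁ :* (o :* n))) refl m₂ m₁ n₁ ω y₃ y₄ t₂ o ⟩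
    ω * ω * ω * (y₃ * (y₄ * (t₂ * m₂)) * m₁ * (o * n₁))
      ≈⟨ *-congʳ cube≈1 by *-identityˡ _ ⟩
    y₃ * (y₄ * (t₂ * m₂)) * m₁ * (o * n₁)
      ≈⟨ *-cong (*-congʳ (*-congˡ (*-congˡ e₁ by sym e₂))) (P-square q q̂) ⟩
    y₃ * w₂ * m₁ * o₂
      ≈⟨ *-congʳ (*-congʳ (*-congʳ (sym e₄ by *-congˡ e₃))) ⟩
    o * a₁ * (w₁ * t₂) * w₂ * m₁ * o₂
      ≈⟨ solve 7 (λ o a w t v m o′ → o :* a :* (w :* t) :* v :* m :* o′ := a :* v :* w :* (t :* o) :* (m :* o′)) refl
           o a₁ w₁ t₂ w₂ m₁ o₂ ⟩
    a₁ * w₂ * w₁ * (t₂ * o) * (m₁ * o₂)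
      ≈⟨ *-congˡ X₊≈ ⟨
    a₁ * w₂ * w₁ * (t₂ * o) * X 1# ∎)
    where
    e₁ : t₂ * m₂ ≈ z₄
    e₁ = P-square (ω * ω * (q * q)) q̂₂ by P-congˡ {p = q̂₄}
      (solve 2 (λ w q → w :* w :* (q :* q) :* (w :* w :* (q :* q)) := w :* w :* w :* (w :* (q :* q :* (q :* q)))) refl ω q
        by *-congʳ cube≈1 by *-identityˡ _)
    e₂ : w₂ ≈ y₄ * z₄
    e₂ = P-split (ω * (q * q)) q̂₂ by *-congˡ (P-congˡ {p = q̂₄} (*-assoc _ _ _))
    e₃ : P (ω * ω * q) q̂ ≈ w₁ * t₂
    e₃ = P-split (ω * ω * q) q̂ by *-congˡ (P-congˡ {p = q̂₂} (*-assoc _ _ _))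
    e₄ : o * a₁ * P (ω * ω * q) q̂ ≈ y₃
    e₄ = P-cube q q̂
    units = unit-* (unit-* (unit-*
        (unitᵖ q̂ (*-comm q ω) sixth-ω sixth-q)
        (unitᵖ q̂₂ (solve 2 (λ w q → q :* (w :* q) := w :* (q :* q)) refl ω q) (sixth-* sixth-ω sixth-q) six-q₂))
        unit-w₁)
      (unit-*
        (unitᵖ q̂₂ (solve 2 (λ w q → q :* (w :* w :* q) := w :* w :* (q :* q)) refl ω q)
          (sixth-* (sixth-* sixth-ω sixth-ω) sixth-q) six-q₂)
        (unitᵖ q̂ (*-identityʳ q) sixth-1 sixth-q))

  -- Euler: (u;u²)(−u;u) = 1
  euler : ∀ u → (∃ λ v → P (point (u ⊗ u)) (u ⊗ u) * v ≈ 1#) → P (point u) (u ⊗ u) * P (- point u) u ≈ 1#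
  euler u unit-u² = cancel-unit unit-u² (begin
    b * (a * c)      ≈⟨ solve 3 (λ a b c → b :* (a :* c) := a :* b :* c) refl a b c ⟩
    a * b * c        ≈⟨ *-congʳ (P-split (point u) u) ⟨
    P (point u) u * c ≈⟨ P-square (point u) u ⟩
    b                ≈⟨ *-identityʳ b ⟨
    b * 1#           ∎)
    where
    a = P (point u) (u ⊗ u)
    b = P (point (u ⊗ u)) (u ⊗ u)
    c = P (- point u) u

  -- Same method: multiplication by invertible products, after which (q²;q⁴)(ωq²;q⁴)(ω²q²;q⁴)
  -- collapses to (q⁶;q¹²) and (q;q²)(ωq;q²)(ω²q;q²) to (q³;q⁶).
  TY : Tb * Y ≈ X (- 1#)
  TY = cancel-unit units (begin
    h₃ * w₁ * (v₁ * o₄ * o₁) * (Tb * (y₃ * y₄))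
      ≈⟨ solve 8 (λ h w v o o′ t y y′ → h :* w :* (v :* o :* o′) :* (t :* (y :* y′))
           := h :* w :* t :* (v :* o :* o′ :* y :* y′)) refl h₃ w₁ v₁ o₄ o₁ Tb y₃ y₄ ⟩
    h₃ * w₁ * Tb * (v₁ * o₄ * o₁ * y₃ * y₄)
      ≈⟨ *-cong Tb-product (*-congʳ (*-congˡ (P-split (q * q * q) q̂₃))) ⟩
    k₁ * l₃ * (v₁ * o₄ * o₁ * (h₃ * h₆) * y₄)
      ≈⟨ solve 8 (λ k l v o o′ h h′ y → k :* l :* (v :* o :* o′ :* (h :* h′) :* y)
           := o :* y :* (v :* k) :* (l :* h :* h′ :* o′)) refl k₁ l₃ v₁ o₄ o₁ h₃ h₆ y₄ ⟩
    o₄ * y₄ * (v₁ * k₁) * (l₃ * h₃ * h₆ * o₁)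
      ≈⟨ *-congʳ (*-congˡ f₂ by f₃ by sym f₇) ⟩
    o₄ * (r₂ * r₄) * (l₃ * h₃ * h₆ * o₁)
      ≈⟨ *-congˡ (*-congˡ (P-split₃ q q̂₂ by
           *-cong (*-congˡ (P-cong {p = q̂₂ ⊗ q̂₂ ⊗ q̂₂} {r = q̂₆} (sym (*-assoc q q q)) q⁶)) refl
           by *-congʳ (*-congʳ (P-cong {p = q̂₂ ⊗ q̂₂ ⊗ q̂₂} {r = q̂₆} refl q⁶))
           by *-congˡ (P-cong {p = q̂₂ ⊗ q̂₂ ⊗ q̂₂} {r = q̂₆} (solve 1 (λ q → q :* (q :* q) :* (q :* q) := q :* q :* q :* (q :* q)) refl q) q⁶))) ⟩
    o₄ * (r₂ * r₄) * (l₃ * h₃ * h₆ * (g₁ * h₃ * g₅))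
      ≈⟨ solve 8 (λ o r r′ l h h′ g g′ → o :* (r :* r′) :* (l :* h :* h′ :* (g :* h :* g′))
           := h :* h :* o :* (g :* r′ :* (r :* g′) :* (l :* h′))) refl o₄ r₂ r₄ l₃ h₃ h₆ g₁ g₅ ⟩
    h₃ * h₃ * o₄ * (g₁ * r₄ * (r₂ * g₅) * (l₃ * h₆))
      ≈⟨ *-cong (*-congʳ (*-congˡ f₄)) X₋≈ ⟨
    h₃ * (o₁ * v₁ * w₁) * o₄ * X (- 1#)
      ≈⟨ solve 6 (λ h o v w o′ x → h :* (o :* v :* w) :* o′ :* x := h :* w :* (v :* o′ :* o) :* x) refl
           h₃ o₁ v₁ w₁ o₄ (X (- 1#)) ⟩
    h₃ * w₁ * (v₁ * o₄ * o₁) * X (- 1#) ∎)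
    where
    v₁ = P (ω * q) q̂₂
    o₄ = P (q * q) q̂₄
    h₆ = P (point q̂₆) q̂₆
    h₁₂ = P (point q̂₆) q̂₁₂
    g₁ = P q q̂₆
    g₅ = P q₅ q̂₆
    r₂ = P (- (q * q)) q̂₆
    r₄ = P (- (q * q * (q * q))) q̂₆
    l₆ = P (- point q̂₆) q̂₆
    q⁶ : q * q * (q * q) * (q * q) ≈ q * q * q * (q * q * q)
    q⁶ = solve 1 (λ q → q :* q :* (q :* q) :* (q :* q) := q :* q :* q :* (q :* q :* q)) refl q
    f₂ : v₁ * k₁ ≈ P (ω * ω * (q * q)) q̂₄
    f₂ = P-square (ω * q) q̂₂ by P-congˡ {p = q̂₄} (solve 2 (λ w q → w :* q :* (w :* q) := w :* w :* (q :* q)) refl ω q)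
    f₃ : o₄ * y₄ * P (ω * ω * (q * q)) q̂₄ ≈ h₁₂
    f₃ = P-cube (q * q) q̂₄ by P-cong {p = q̂₄ ⊗ q̂₄ ⊗ q̂₄} {r = q̂₁₂} q⁶
      (solve 1 (λ q → let u = q :* q :* (q :* q) ; v = q :* q :* q :* (q :* q :* q) in u :* u :* u := v :* v) refl q)
    f₄ : o₁ * v₁ * w₁ ≈ h₃
    f₄ = P-cube q q̂₂ by P-cong {p = q̂₂ ⊗ q̂₂ ⊗ q̂₂} {r = q̂₆} refl q⁶
    six-q₁₂ = sixth-* (sixth-* six-q₃ six-q₃) (sixth-* six-q₃ six-q₃)
    -- Euler's identity for q² and for q⁶: (-q²;q²) splits modulo 3 into the two products here and
    -- (-q⁶;q⁶), which cancels.
    f₇ : o₄ * (r₂ * r₄) ≈ h₁₂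
    f₇ = cancel-unit (h₁₂ , (*-comm l₆ h₁₂ by euler₆)) (begin
      l₆ * (o₄ * (r₂ * r₄))
        ≈⟨ solve 4 (λ l o r r′ → l :* (o :* (r :* r′)) := o :* (r :* r′ :* l)) refl l₆ o₄ r₂ r₄ ⟩
      o₄ * (r₂ * r₄ * l₆)
        ≈⟨ *-congˡ split ⟨
      o₄ * P (- (q * q)) q̂₂
        ≈⟨ euler q̂₂ (unitᵖ q̂₄ (solve 1 (λ q → q :* (q :* q :* q) := q :* q :* (q :* q)) refl q) six-q₃ six-q₄) ⟩
      1#
        ≈⟨ euler₆ ⟨
      h₁₂ * l₆
        ≈⟨ *-comm _ _ ⟩
      l₆ * h₁₂ ∎)
      where
      euler₆ : h₁₂ * l₆ ≈ 1#
      euler₆ = euler q̂₆ (unitᵖ q̂₁₂ (solve 1 (λ q → let v = q :* q :* q :* (q :* q :* q) in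
        q :* (q :* q :* (q :* q :* q) :* v) := v :* v) refl q)
        (sixth-* (sixth-* six-q₂ six-q₃) (sixth-* six-q₃ six-q₃)) six-q₁₂)
      split : P (- (q * q)) q̂₂ ≈ r₂ * r₄ * l₆
      split = P-split₃ (- (q * q)) q̂₂ by *-cong (*-cong (P-cong {p = q̂₂ ⊗ q̂₂ ⊗ q̂₂} {r = q̂₆} refl q⁶)
          (P-cong {p = q̂₂ ⊗ q̂₂ ⊗ q̂₂} {r = q̂₆} (solve 1 (λ u → (:- u) :* u := :- (u :* u)) refl (q * q)) q⁶))
          (P-cong {p = q̂₂ ⊗ q̂₂ ⊗ q̂₂} {r = q̂₆} (solve 1 (λ u → (:- u) :* u :* u := :- (u :* u :* u)) refl (q * q) by -‿cong q⁶) q⁶)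
    X₋≈ : X (- 1#) ≈ g₁ * r₄ * (r₂ * g₅) * (l₃ * h₆)
    X₋≈ = *-cong (*-cong
        (P-split _ Q̂₃ by *-cong (P-cong {p = Q̂₃ ⊗ Q̂₃} {r = q̂₆} (solve 1 (λ q → (:- :1) :* (:- q) := q) refl q) Q⁶)
          (P-cong {p = Q̂₃ ⊗ Q̂₃} {r = q̂₆} (solve 1 (λ q → let Q = :- q in (:- :1) :* Q :* (Q :* Q :* Q) := :- (q :* q :* (q :* q))) refl q) Q⁶))
        (P-split _ Q̂₃ by *-cong (P-cong {p = Q̂₃ ⊗ Q̂₃} {r = q̂₆} (solve 1 (λ q → let Q = :- q in (:- :1) :* (Q :* Q) := :- (q :* q)) refl q) Q⁶)
          (P-cong {p = Q̂₃ ⊗ Q̂₃} {r = q̂₆} (solve 1 (λ q → let Q = :- q in (:- :1) :* (Q :* Q) :* (Q :* Q :* Q) := q :* q :* q :* (q :* q)) refl q) Q⁶)))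
        (P-split _ Q̂₃ by *-cong (P-cong {p = Q̂₃ ⊗ Q̂₃} {r = q̂₆} (solve 1 (λ q → let Q = :- q in Q :* Q :* Q := :- (q :* q :* q)) refl q) Q⁶)
          (P-cong {p = Q̂₃ ⊗ Q̂₃} {r = q̂₆} Q⁶ Q⁶))
      where
      Q⁶ : p * p ≈ q * q * q * (q * q * q)
      Q⁶ = solve 1 (λ q → let Q = :- q ; p = Q :* Q :* Q in p :* p := q :* q :* q :* (q :* q :* q)) refl q
    units = unit-* (unit-* unit-h₃ unit-w₁) (unit-* (unit-*
      (unitᵖ q̂₂ (*-comm q ω) sixth-ω six-q₂) (unitᵖ q̂₄ refl sixth-q six-q₄)) unit-o₁)

  i₂ i₃ iᵥ : ℕ → Carrier
  i₂ = F.i₂ ω sixth-ω 0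
  i₃ = F.i₃
  iᵥ = S.i 1# sixth-1 0

  i₂-inverse : ∀ n → (1# - ω * ω * q * (q ^ n * q ^ n)) * i₂ n ≈ 1#
  i₂-inverse n = *-congʳ (solve 3 (λ w q y → :1 :- w :* w :* q :* (y :* y)
      := :1 :- q :* (w :* (:1 :* :1) :* (w :* (:1 :* :1)) :* (y :* y))) refl ω q (q ^ n))
    by F.i₂-inverse ω sixth-ω 0 n

  i₃-inverse : ∀ n → (1# - q * q * q * (q ^ n * q ^ n * q ^ n)) * i₃ n ≈ 1#
  i₃-inverse n = *-congʳ (solve 2 (λ q y → :1 :- q :* q :* q :* (y :* y :* y)
      := :1 :- q :* (q :* q :* (y :* y :* y))) refl q (q ^ n))
    by F.i₃-inverse n

  iᵥ-inverse : ∀ n → (1# - ω * q * q ^ n) * iᵥ n ≈ 1#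
  iᵥ-inverse n = *-congʳ (solve 3 (λ w q y → :1 :- w :* q :* y := :1 :- q :* (w :* (:1 :* (:1 :* :1)) :* y)) refl ω q (q ^ n))
    by S.i-inverse 1# sixth-1 0 n

  -- From 1 - x³ = (1 - x)(1 + x + x²) at x = ωq^(n+1), whose cube is q^(3n+3).
  cubic-inverse : ∀ n → (1# + ω * (q * q ^ n) + ω * (q * q ^ n) * (ω * (q * q ^ n))) * i₃ n ≈ iᵥ n
  cubic-inverse n = inverse-unique refl
    (solve 4 (λ w q y i → let x = w :* (q :* y) in
        (:1 :- w :* q :* y) :* ((:1 :+ x :+ x :* x) :* i) := (:1 :- w :* w :* w :* (q :* q :* q :* (y :* y :* y))) :* i) refl
        ω q (q ^ n) (i₃ n)
      by *-congʳ (+-congˡ (-‿cong (*-congʳ cube≈1 by *-identityˡ _))) by i₃-inverse n)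
    (iᵥ-inverse n)

  -- At v = 1 the second series acquires the denominators of the first; this is what makes a common
  -- factor H possible.
  e-iᵥ : ∀ n → S.e n * iᵥ n ≈ i₂ n * i₃ n
  e-iᵥ n = inverse-unique
    {a = S.factors y * (1# - ω * q * y)} {b = (1# - ω * ω * q * (y * y)) * (1# - q * q * q * (y * y * y))}
    (solve 3 (λ w q y → let u = q :* y in
        (:1 :- q :* (w :* w :* (y :* y))) :* (:1 :- u) :* (:1 :- q :* (w :* w :* y)) :* (:1 :- w :* q :* y)
        := (:1 :- w :* w :* q :* (y :* y)) :* ((:1 :- u) :* (:1 :- w :* u) :* (:1 :- w :* w :* u))) refl ω q y
      by *-congˡ (cubic-factor (q * y)
      by solve 2 (λ q y → :1 :- q :* y :* (q :* y) :* (q :* y) := :1 :- q :* q :* q :* (y :* y :* y)) refl q y))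
    (pairs (S.e-inverse n) (iᵥ-inverse n)) (pairs (i₂-inverse n) (i₃-inverse n))
    where
    y = q ^ n
    pairs : ∀ {a b i j} → a * i ≈ 1# → b * j ≈ 1# → a * b * (i * j) ≈ 1#
    pairs {a} {b} {i} {j} ai bj =
      solve 4 (λ a b i j → a :* b :* (i :* j) := a :* i :* (b :* j)) refl a b i j
      by *-cong ai bj by *-identityˡ 1#

  η H : ℕ → Carrier
  η n = (1# + ω * q ^ n) * (1# + ω * ω * (q ^ n * q ^ n)) * (ω * (q * q ^ n)) * (i₂ n * i₃ n)
  H n = ∏< n η

  -- The prefactor shifts a product by one place: (1 + ω)(-ωq;q)_n = (-ω;q)_n (1 + ωq^n).
  H-second : ∀ n → (1# + ω) * S.A 1# sixth-1 0 n ≈ H n * (1# + ω * q ^ n)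
  H-second zero    = solve 1 (λ w → (:1 :+ w) :* :1 := :1 :* (:1 :+ w :* :1)) refl ω
  H-second (suc n) = begin
    (1# + ω) * (A * (f * (S.e n * iᵥ n)))
      ≈⟨ solve 4 (λ a b f k → a :* (b :* (f :* k)) := a :* b :* (f :* k)) refl (1# + ω) A f (S.e n * iᵥ n) ⟩
    (1# + ω) * A * (f * (S.e n * iᵥ n))
      ≈⟨ *-cong (H-second n) (*-congˡ (e-iᵥ n)) ⟩
    H n * (1# + ω * y) * (f * (i₂ n * i₃ n))
      ≈⟨ solve 5 (λ h w q y k →
           h :* (:1 :+ w :* y) :* ((:1 :+ w :* (q :* y)) :* (:1 :* (:1 :* :1) :+ w :* w :* (y :* y)) :* (w :* (q :* y)) :* k)
           := h :* ((:1 :+ w :* y) :* (:1 :+ w :* w :* (y :* y)) :* (w :* (q :* y)) :* k) :* (:1 :+ w :* (y :* q))) refl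
           (H n) ω q y (i₂ n * i₃ n) ⟩
    H (suc n) * (1# + ω * (y * q)) ∎
    where
    y = q ^ n
    A = S.A 1# sixth-1 0 n
    f = (1# + ω * (q * y)) * (S.v 1# sixth-1 0 + ω * ω * (y * y)) * (ω * (q * y))

  kill-cube : ∀ z k → z + (1# - ω * ω * ω) * k ≈ z
  kill-cube z k = +-congˡ (*-congʳ (+-congˡ (-‿cong cube≈1) by -‿inverseʳ 1#) by zeroˡ k) by +-identityʳ z

  -- The same shift in base q². The ratio ω + q²y² becomes ω(1 + ω²q²y²) only through ω³ = 1, hence
  -- the cofactor of 1 - ω³.
  H-first : ∀ n → (1# + ω * ω) * F.b ω sixth-ω 0 n ≈ H n * (1# + ω * ω * (q ^ n * q ^ n))
  H-first zero    = solve 1 (λ w → (:1 :+ w :* w) :* :1 := :1 :* (:1 :+ w :* w :* (:1 :* :1))) refl ω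
  H-first (suc n) = begin
    (1# + ω * ω) * (b * (f * k))
      ≈⟨ solve 4 (λ a b f k → a :* (b :* (f :* k)) := a :* b :* (f :* k)) refl (1# + ω * ω) b f k ⟩
    (1# + ω * ω) * b * (f * k)
      ≈⟨ *-congʳ (H-first n) ⟩
    H n * (1# + ω * ω * (y * y)) * (f * k)
      ≈⟨ solve 5 (λ h w q y k →
           h :* (:1 :+ w :* w :* (y :* y)) :* ((:1 :+ w :* (:1 :* :1) :* y) :* (w :* (:1 :* :1) :+ q :* q :* (y :* y)) :* (q :* y) :* k)
           := h :* ((:1 :+ w :* y) :* (:1 :+ w :* w :* (y :* y)) :* (w :* (q :* y)) :* k) :* (:1 :+ w :* w :* (y :* q :* (y :* q)))
              :+ (:1 :- w :* w :* w) :* (h :* (:1 :+ w :* y) :* (:1 :+ w :* w :* (y :* y)) :* (q :* y) :* k :* (q :* q :* (y :* y)))) refl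
           (H n) ω q y k ⟩
    _ ≈⟨ kill-cube _ _ ⟩
    H (suc n) * (1# + ω * ω * (y * q * (y * q))) ∎
    where
    y = q ^ n
    k = i₂ n * i₃ n
    b = F.b ω sixth-ω 0 n
    f = (1# + F.x ω sixth-ω 0 * y) * (F.x ω sixth-ω 0 + q * q * (y * y)) * (q * y)

  a₀ b₀ s d : ℕ → Carrier
  a₀ = S.a 1# sixth-1 0
  b₀ = F.b ω sixth-ω 0
  s n = H n * q ^ n
  d n = H n * q ^ n * ((1# + ω * q ^ n) * (1# + ω * ω * (q ^ n * q ^ n))) * (i₂ n * iᵥ n)

  H-second′ : ∀ n → (1# + ω) * a₀ n ≈ H n * ((1# + ω * q ^ n) * (1# + ω * q ^ n))
  H-second′ n = sym (*-assoc _ _ _) by *-congʳ (H-second n) by *-assoc _ _ _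

  s-terms : ∀ n → (ω + ω) * s n ≈ (1# + ω) * a₀ n - (1# + ω * ω) * b₀ n
  s-terms n = solve 3 (λ h w y → (w :+ w) :* (h :* y)
      := h :* ((:1 :+ w :* y) :* (:1 :+ w :* y)) :- h :* (:1 :+ w :* w :* (y :* y))) refl (H n) ω (q ^ n)
    by sym (+-cong (H-second′ n) (-‿cong (H-first n)))

  -- With y′ = q^(n+1), (1 + ωy′)² + (1 + ω²y′²) = 2(1 + ωy′ + ω²y′²), and the bracket turns 1/(1 -
  -- y′³) into 1/(1 - ωy′).
  d-terms : ∀ n → (1# + 1#) * (ω * q * d n) ≈ (1# + ω) * a₀ (suc n) + (1# + ω * ω) * b₀ (suc n)
  d-terms n = begin
    (1# + 1#) * (ω * q * d n)
      ≈⟨ *-congˡ (*-congˡ (*-congˡ (*-congˡ (sym (cubic-inverse n))))) ⟩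
    _ ≈⟨ solve 6 (λ h w q y i j → let x = w :* (q :* y) ; g = (:1 :+ w :* y) :* (:1 :+ w :* w :* (y :* y)) ; h′ = h :* (g :* (w :* (q :* y)) :* (i :* j)) ; y′ = y :* q in
           (:1 :+ :1) :* (w :* q :* (h :* y :* g :* (i :* ((:1 :+ x :+ x :* x) :* j))))
           := h′ :* ((:1 :+ w :* y′) :* (:1 :+ w :* y′)) :+ h′ :* (:1 :+ w :* w :* (y′ :* y′))) refl
           (H n) ω q (q ^ n) (i₂ n) (i₃ n) ⟩
    _ ≈⟨ +-cong (H-second′ (suc n)) (H-first (suc n)) ⟨
    (1# + ω) * a₀ (suc n) + (1# + ω * ω) * b₀ (suc n) ∎

  -- The combination equals 2(1 + ω + ω²), so starting the sums at index 1 instead of 0 loses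
  -- nothing.
  d-start : (1# + ω) * a₀ 0 + (1# + ω * ω) * b₀ 0 ≈ 0#
  d-start = +-cong (H-second′ 0) (H-first 0)
    by solve 1 (λ w → :1 :* ((:1 :+ w :* :1) :* (:1 :+ w :* :1)) :+ :1 :* (:1 :+ w :* w :* (:1 :* :1))
         := :0 :+ (:1 :+ w :+ w :* w) :* (:1 :+ :1)) refl ω
    by relation-0 _ _

  a₀⟶ : (λ n → ∑< n a₀) ⟶ Gs
  a₀⟶ = proj₁ (proj₂ (proj₂ second))
  b₀⟶ : (λ n → ∑< n b₀) ⟶ Tb
  b₀⟶ = proj₁ (proj₂ (proj₂ first))

  -- This is 1/(2ω), since ω² = 1/ω.
  c₁ : Carrier
  c₁ = ½ * (ω * ω)

  c₁-inverse : c₁ * (ω + ω) ≈ 1#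
  c₁-inverse = solve 2 (λ h w → h :* (w :* w) :* (w :+ w) := (h :+ h) :* (w :* w :* w)) refl ½ ω
    by *-cong half cube≈1 by *-identityˡ 1#

  Σ₁ : Carrier
  Σ₁ = c₁ * ((1# + ω) * Gs - (1# + ω * ω) * Tb)

  s⟶ : (λ n → ∑< n s) ⟶ Σ₁
  s⟶ = ⟶-seq combine (⟶-scale c₁ (⟶-- (⟶-scale (1# + ω) a₀⟶) (⟶-scale (1# + ω * ω) b₀⟶)))
    where
    combine : ∀ n → c₁ * ((1# + ω) * ∑< n a₀ - (1# + ω * ω) * ∑< n b₀) ≈ ∑< n s
    combine zero    = solve 3 (λ c a b → c :* (a :* :0 :- b :* :0) := :0) refl c₁ (1# + ω) (1# + ω * ω)
    combine (suc n) = begin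
      c₁ * ((1# + ω) * (∑< n a₀ + a₀ n) - (1# + ω * ω) * (∑< n b₀ + b₀ n))
        ≈⟨ solve 7 (λ c u v a a′ b b′ → c :* (u :* (a :+ a′) :- v :* (b :+ b′))
             := c :* (u :* a :- v :* b) :+ c :* (u :* a′ :- v :* b′)) refl
             c₁ (1# + ω) (1# + ω * ω) (∑< n a₀) (a₀ n) (∑< n b₀) (b₀ n) ⟩
      _ ≈⟨ +-cong (combine n) (*-congˡ (sym (s-terms n)) by sym (*-assoc _ _ _) by *-congʳ c₁-inverse by *-identityˡ _) ⟩
      ∑< n s + s n ∎

  s-value : Σ₁ * Y ≈ J₅
  s-value = begin
    c₁ * ((1# + ω) * Gs - (1# + ω * ω) * Tb) * Y
      ≈⟨ *-congʳ (*-congˡ (+-cong (*-congʳ 1+ω) (-‿cong (*-congʳ 1+ωω)))) ⟩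
    ½ * (ω * ω) * (- (ω * ω) * Gs - - ω * Tb) * Y
      ≈⟨ solve 5 (λ h w g t y → h :* (w :* w) :* ((:- (w :* w)) :* g :- (:- w) :* t) :* y
           := h :* (w :* w :* w :* ((:- w) :* g :* y) :+ w :* w :* w :* (t :* y))) refl ½ ω Gs Tb Y ⟩
    ½ * (ω * ω * ω * (- ω * Gs * Y) + ω * ω * ω * (Tb * Y))
      ≈⟨ *-congˡ (+-cong (*-cong cube≈1 (GY by dissection 1# (*-identityˡ 1#)))
           (*-cong cube≈1 (TY by dissection (- 1#) (solve 0 ((:- :1) :* (:- :1) := :1) refl)))) ⟩
    _ ≈⟨ solve 4 (λ h j q k → h :* (:1 :* (j :+ :1 :* q :* k) :+ :1 :* (j :+ (:- :1) :* q :* k)) := (h :+ h) :* j) refl ½ J₅ q J₁ ⟩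
    _ ≈⟨ *-congʳ half by *-identityˡ _ ⟩
    J₅ ∎

  bounded₀ : ∀ {x} → Bounded x → Bounded (λ _ n → x 0 n)
  bounded₀ = geo-reindex (λ _ _ → 0) (λ _ n → n)

  bounded-q^ : Bounded (λ _ n → q ^ n)
  bounded-q^ = geo-bounded base-q

  bounded-i₂ : Bounded (λ _ n → i₂ n)
  bounded-i₂ = bounded₀ (proj₁ (proj₂ (F.quadratic ω sixth-ω)))
  bounded-iᵥ : Bounded (λ _ n → iᵥ n)
  bounded-iᵥ = bounded₀ (proj₁ (proj₂ (S.linear 1# sixth-1)))

  bounded-numerator : Bounded (λ _ n → (1# + ω * q ^ n) * (1# + ω * ω * (q ^ n * q ^ n)))
  bounded-numerator = (⌜ 1# ⌝ ⊞ ⌜ ω ⌝ ⊠ bounded-q^) ⊠ (⌜ 1# ⌝ ⊞ ⌜ ω ⌝ ⊠ ⌜ ω ⌝ ⊠ (bounded-q^ ⊠ bounded-q^))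

  small-η : Small (λ _ → η)
  small-η = geo-*ᵇ (geo-ᵇ* bounded-numerator (geo-ᵇ* ⌜ ω ⌝ (geo-ᵇ* ⌜ q ⌝ base-q))) (bounded-i₂ ⊠ F.bounded-i₃)

  small-d : Small (λ _ → d)
  small-d = geo-*ᵇ (geo-*ᵇ (geo-*ᵇ (small-∏ small-η) bounded-q^) bounded-numerator) (bounded-i₂ ⊠ bounded-iᵥ)

  -- Drawn from the size of the terms: the sums over `a₀` and `b₀` determine only q times this one,
  -- and q may be 0.
  d-converges : ∃ λ l → (λ n → ∑< n d) ⟶ l
  d-converges = let S , bound = ∑-converges (λ _ → 0) {f = λ _ → d} small-d
                in S 0 , ∑-⟶ (λ _ → 0) {f = λ _ → d} {S = S} bound 0

  Σ₂ : Carrier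
  Σ₂ = proj₁ d-converges
  d⟶ : (λ n → ∑< n d) ⟶ Σ₂
  d⟶ = proj₂ d-converges

  Σ₂-relation : (1# + 1#) * (ω * q * Σ₂) ≈ (1# + ω) * Gs + (1# + ω * ω) * Tb
  Σ₂-relation = ⟶-unique (⟶-scale (1# + 1#) (⟶-scale (ω * q) d⟶))
    (⟶-seq (λ n → sym (combine n)) (⟶-+ (⟶-scale (1# + ω) (⟶-suc a₀⟶)) (⟶-scale (1# + ω * ω) (⟶-suc b₀⟶))))
    where
    combine : ∀ n → (1# + 1#) * (ω * q * ∑< n d) ≈ (1# + ω) * ∑< (suc n) a₀ + (1# + ω * ω) * ∑< (suc n) b₀
    combine zero    = solve 1 (λ x → (:1 :+ :1) :* (x :* :0) := :0) refl (ω * q)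
      by sym (+-cong (*-congˡ (+-identityˡ (a₀ 0))) (*-congˡ (+-identityˡ (b₀ 0))) by d-start)
    combine (suc n) = begin
      (1# + 1#) * (ω * q * (∑< n d + d n))
        ≈⟨ solve 3 (λ x a b → (:1 :+ :1) :* (x :* (a :+ b)) := (:1 :+ :1) :* (x :* a) :+ (:1 :+ :1) :* (x :* b)) refl
             (ω * q) (∑< n d) (d n) ⟩
      _ ≈⟨ +-cong (combine n) (d-terms n) ⟩
      _ ≈⟨ solve 6 (λ u v a b a′ b′ → u :* a :+ v :* b :+ (u :* a′ :+ v :* b′) := u :* (a :+ a′) :+ v :* (b :+ b′)) refl
             (1# + ω) (1# + ω * ω) (∑< (suc n) a₀) (∑< (suc n) b₀) (a₀ (suc n)) (b₀ (suc n)) ⟩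
      _ ∎

  q*d-value : q * (Σ₂ * Y) ≈ q * J₁
  q*d-value = begin
    q * (Σ₂ * Y)
      ≈⟨ *-identityˡ _ ⟨
    1# * (q * (Σ₂ * Y))
      ≈⟨ *-congʳ c₁-inverse ⟨
    c₁ * (ω + ω) * (q * (Σ₂ * Y))
      ≈⟨ solve 5 (λ c w q t y → c :* (w :+ w) :* (q :* (t :* y)) := c :* ((:1 :+ :1) :* (w :* q :* t)) :* y) refl c₁ ω q Σ₂ Y ⟩
    c₁ * ((1# + 1#) * (ω * q * Σ₂)) * Y
      ≈⟨ *-congʳ (*-congˡ (Σ₂-relation by +-cong (*-congʳ 1+ω) (*-congʳ 1+ωω))) ⟩
    ½ * (ω * ω) * (- (ω * ω) * Gs + - ω * Tb) * Y
      ≈⟨ solve 5 (λ h w g t y → h :* (w :* w) :* ((:- (w :* w)) :* g :+ (:- w) :* t) :* y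
           := h :* (w :* w :* w :* ((:- w) :* g :* y) :- w :* w :* w :* (t :* y))) refl ½ ω Gs Tb Y ⟩
    ½ * (ω * ω * ω * (- ω * Gs * Y) - ω * ω * ω * (Tb * Y))
      ≈⟨ *-congˡ (+-cong (*-cong cube≈1 (GY by dissection 1# (*-identityˡ 1#)))
           (-‿cong (*-cong cube≈1 (TY by dissection (- 1#) (solve 0 ((:- :1) :* (:- :1) := :1) refl))))) ⟩
    _ ≈⟨ solve 4 (λ h j q k → h :* (:1 :* (j :+ :1 :* q :* k) :- :1 :* (j :+ (:- :1) :* q :* k)) := (h :+ h) :* (q :* k)) refl ½ J₅ q J₁ ⟩
    _ ≈⟨ *-congʳ half by *-identityˡ _ ⟩
    q * J₁ ∎

  module Degenerate (q≈0 : q ≈ 0#) where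
    q*≈0 : ∀ {x} → q * x ≈ 0#
    q*≈0 = *-congʳ q≈0 by zeroˡ _

    P-1 : ∀ {a b} (p : BasePoint) → a ≈ q * b → P a p ≈ 1#
    P-1 {a} {b} p eq = ⟶-unique (P⟶ a p) (⟶-seq (λ n → sym (∏-1 n λ k →
        +-congˡ (-‿cong (*-congʳ (eq by q*≈0) by zeroˡ _)) by solve 0 (:1 :- :0 := :1) refl)) (⟶-const 1#))

    inverse-1 : ∀ {a i} → a ≈ 0# → (1# - a) * i ≈ 1# → i ≈ 1#
    inverse-1 {a} {i} a≈0 inv = sym (*-identityˡ i)
      by *-congʳ (sym (+-congˡ (-‿cong a≈0) by solve 0 (:1 :- :0 := :1) refl)) by inv

    -- Every later term contains a factor q, and the first is (1 + ω)(1 + ω²) = 1.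
    d⟶1 : (λ n → ∑< n d) ⟶ 1#
    d⟶1 = single {f = d} {z = 1#} (begin
        1# * 1# * ((1# + ω * 1#) * (1# + ω * ω * (1# * 1#))) * (i₂ 0 * iᵥ 0)
          ≈⟨ *-congˡ (*-cong
               (inverse-1 (solve 2 (λ w q → w :* w :* q :* (:1 :* :1) := q :* (w :* w)) refl ω q by q*≈0) (i₂-inverse 0))
               (inverse-1 (solve 2 (λ w q → w :* q :* :1 := q :* w) refl ω q by q*≈0) (iᵥ-inverse 0))) ⟩
        1# * 1# * ((1# + ω * 1#) * (1# + ω * ω * (1# * 1#))) * (1# * 1#)
          ≈⟨ solve 1 (λ w → :1 :* :1 :* ((:1 :+ w :* :1) :* (:1 :+ w :* w :* (:1 :* :1))) :* (:1 :* :1)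
               := w :* w :* w :+ (:1 :+ w :+ w :* w) :* :1) refl ω by relation-0 _ _ by cube≈1 ⟩
        1# ∎)
      λ n → solve 5 (λ h y q z i → h :* (y :* q) :* z :* i := q :* (h :* y :* z :* i)) refl (H (suc n)) (q ^ n) q
          ((1# + ω * (q ^ n * q)) * (1# + ω * ω * (q ^ n * q * (q ^ n * q)))) (i₂ (suc n) * iᵥ (suc n))
        by q*≈0

    d-value : Σ₂ * Y ≈ J₁
    d-value = begin
      Σ₂ * (y₃ * y₄)    ≈⟨ *-cong (⟶-unique d⟶ d⟶1) (*-cong
                             (P-1 q̂₃ (solve 1 (λ q → q :* q :* q := q :* (q :* q)) refl q))
                             (P-1 q̂₄ (solve 2 (λ w q → w :* (q :* q) := q :* (w :* q)) refl ω q))) ⟩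
      1# * (1# * 1#)    ≈⟨ solve 0 (:1 :* (:1 :* :1) := :1 :* :1 :* :1) refl ⟩
      1# * 1# * 1#      ≈⟨ *-cong (*-cong (P-1 q̂₁₂ (sym (*-identityʳ q)))
                             (P-1 q̂₁₂ (solve 1 (λ q → let v = q :* q :* q in v :* v :* (v :* (q :* q))
                               := q :* (q :* q :* v :* (v :* (q :* q)))) refl q)))
                             (P-1 q̂₁₂ (solve 1 (λ q → let v = q :* q :* q in v :* v :* (v :* v)
                               := q :* (q :* q :* v :* (v :* v))) refl q)) ⟨
      J₁                ∎

  exponent : ℕ → ℕ
  exponent n = (n ℕ.* (n ℕ.+ 3)) ℕ./ 2

  -- From (n+1)(n+4) = n(n+3) + 2(n+2): the natural-number division splits because 2 divides the
  -- second summand.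
  exponent-suc : ∀ n → exponent (suc n) ≡ exponent n ℕ.+ (n ℕ.+ 2)
  exponent-suc n = ≡.trans (≡.cong (ℕ._/ 2) (identity n))
    (≡.trans (ℕ/.+-distrib-/-∣ʳ (n ℕ.* (n ℕ.+ 3)) (divides (n ℕ.+ 2) ≡.refl))
      (≡.cong (exponent n ℕ.+_) (ℕ/.m*n/n≡m (n ℕ.+ 2) 2)))
    where
    identity : ∀ n → suc n ℕ.* (suc n ℕ.+ 3) ≡ n ℕ.* (n ℕ.+ 3) ℕ.+ (n ℕ.+ 2) ℕ.* 2
    identity = solve-∀

  power : ℕ → Carrier
  power n = ω ^ n * q ^ exponent n

  power-suc : ∀ n → power (suc n) ≈ power n * (ω * (q * q ^ n) * q)
  power-suc n = begin
    ω ^ n * ω * q ^ exponent (suc n)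
      ≡⟨ ≡.cong (λ k → ω ^ n * ω * q ^ k) (exponent-suc n) ⟩
    ω ^ n * ω * q ^ (exponent n ℕ.+ (n ℕ.+ 2))
      ≈⟨ *-congˡ (^-homo-* q (exponent n) (n ℕ.+ 2) by *-congˡ (^-homo-* q n 2)) ⟩
    ω ^ n * ω * (q ^ exponent n * (q ^ n * (1# * q * q)))
      ≈⟨ solve 5 (λ a w b y q → a :* w :* (b :* (y :* (:1 :* q :* q))) := a :* b :* (w :* (q :* y) :* q)) refl
           (ω ^ n) ω (q ^ exponent n) (q ^ n) q ⟩
    power n * (ω * (q * q ^ n) * q) ∎

  ^2≈ : ∀ x → x ^ 2 ≈ x * x
  ^2≈ x = *-congʳ (*-identityˡ x)
  ^3≈ : ∀ x → x ^ 3 ≈ x * x * x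
  ^3≈ x = *-congʳ (^2≈ x)
  ^4≈ : ∀ x → x ^ 4 ≈ x * x * (x * x)
  ^4≈ x = *-congʳ (^3≈ x) by *-assoc _ _ _

  power-2 : ∀ n → (q ^ 2) ^ n ≈ q ^ n * q ^ n
  power-2 n = ^-cong n (^2≈ q) by ^-square q n
  power-3 : ∀ n → (q ^ 3) ^ n ≈ q ^ n * q ^ n * q ^ n
  power-3 n = ^-cong n (^3≈ q) by ^-distrib-* (q * q) q n by *-congʳ (^-square q n)
  power-4 : ∀ n → (q ^ 4) ^ n ≈ q ^ n * q ^ n * (q ^ n * q ^ n)
  power-4 n = ^-cong n (^4≈ q) by ^-square (q * q) n by *-cong (^-square q n) (^-square q n)

  denominator₂ : ∀ n → (1# - ω ^ 2 * q * (q ^ 2) ^ n) * i₂ n ≈ 1#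
  denominator₂ n = *-congʳ (+-congˡ (-‿cong (*-cong (*-congʳ (^2≈ ω)) (power-2 n)))) by i₂-inverse n
  denominator₃ : ∀ n → (1# - q ^ 3 * (q ^ 3) ^ n) * i₃ n ≈ 1#
  denominator₃ n = *-congʳ (+-congˡ (-‿cong (*-cong (^3≈ q) (power-3 n)))) by i₃-inverse n

  numerator₁ denominator₁ inverse₁ numerator₂ denominator inverse : ℕ → Carrier
  numerator₁ n = poch (- ω) q n * poch (- (ω ^ 2)) (q ^ 2) n
  denominator₁ n = poch (ω ^ 2 * q) (q ^ 2) n * poch (q ^ 3) (q ^ 3) n
  inverse₁ n = ∏< n i₂ * ∏< n i₃
  numerator₂ n = poch (ω * q ^ 4) (q ^ 4) n
  denominator n = poch (q ^ 3) (q ^ 3) n * poch (ω * q) q (suc n) * poch (ω ^ 2 * q) (q ^ 2) (suc n)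
  inverse n = ∏< n i₃ * ∏< (suc n) iᵥ * ∏< (suc n) i₂

  inverse₁-correct : ∀ n → denominator₁ n * inverse₁ n ≈ 1#
  inverse₁-correct n =
    solve 4 (λ a b i j → a :* b :* (i :* j) := a :* i :* (b :* j)) refl _ _ _ _
    by *-cong (∏-inverse n denominator₂) (∏-inverse n denominator₃) by *-identityˡ 1#

  inverse-correct : ∀ n → denominator n * inverse n ≈ 1#
  inverse-correct n =
    solve 6 (λ a b c i j k → a :* b :* c :* (i :* j :* k) := a :* i :* (b :* j) :* (c :* k)) refl _ _ _ _ _ _
    by *-cong (*-cong (∏-inverse n denominator₃) (∏-inverse (suc n) iᵥ-inverse)) (∏-inverse (suc n) denominator₂)
    by solve 0 (:1 :* :1 :* :1 := :1) refl

  summand₁ : ∀ n → numerator₁ n * inverse₁ n * power n ≈ s n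
  summand₁ zero    = solve 0 (:1 :* :1 :* (:1 :* :1) :* (:1 :* :1) := :1 :* :1) refl
  summand₁ (suc n) = begin
    a * a′ * (b * b′) * (c * i₂ n * (e * i₃ n)) * power (suc n)
      ≈⟨ *-cong (*-congʳ (*-congˡ (*-congˡ (+-congˡ (-‿cong (*-cong (-‿cong (^2≈ ω)) (power-2 n))))))) (power-suc n) ⟩
    a * a′ * (b * (1# - - (ω * ω) * (y * y))) * (c * i₂ n * (e * i₃ n)) * (power n * (ω * (q * y) * q))
      ≈⟨ solve 10 (λ a b c e i j p w q y →
           a :* (:1 :- (:- w) :* y) :* (b :* (:1 :- (:- (w :* w)) :* (y :* y))) :* (c :* i :* (e :* j)) :* (p :* (w :* (q :* y) :* q))
           := a :* b :* (c :* e) :* p :* ((:1 :+ w :* y) :* (:1 :+ w :* w :* (y :* y)) :* (w :* (q :* y)) :* (i :* j) :* q)) refl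
           a b c e (i₂ n) (i₃ n) (power n) ω q y ⟩
    a * b * (c * e) * power n * (η n * q)
      ≈⟨ *-congʳ (summand₁ n) ⟩
    H n * y * (η n * q)
      ≈⟨ solve 4 (λ h y e q → h :* y :* (e :* q) := h :* e :* (y :* q)) refl (H n) y (η n) q ⟩
    H n * η n * (y * q) ∎
    where
    y = q ^ n
    a = poch (- ω) q n
    a′ = 1# - - ω * y
    b = poch (- (ω ^ 2)) (q ^ 2) n
    b′ = 1# - - (ω ^ 2) * (q ^ 2) ^ n
    c = ∏< n i₂
    e = ∏< n i₃

  -- With x = q^(n+1) and ω = ω⁴, 1 - ωx⁴ = (1 - ωx)(1 + ωx)(1 + ω²x²); the first factor is the one
  -- that `iᵥ` inverts.
  numerator-factor : ∀ n → (1# - ω * q ^ 4 * (q ^ 4) ^ n) * iᵥ n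
    ≈ (1# + ω * (q ^ n * q)) * (1# + ω * ω * (q ^ n * q * (q ^ n * q)))
  numerator-factor n = begin
    (1# - ω * q ^ 4 * (q ^ 4) ^ n) * iᵥ n
      ≈⟨ *-congʳ (+-congˡ (-‿cong (*-cong (*-congˡ (^4≈ q)) (power-4 n)))) ⟩
    (1# - ω * (q * q * (q * q)) * (y * y * (y * y))) * iᵥ n
      ≈⟨ solve 4 (λ w q y i → let x = y :* q in
           (:1 :- w :* (q :* q :* (q :* q)) :* (y :* y :* (y :* y))) :* i
           := (:1 :+ w :* x) :* (:1 :+ w :* w :* (x :* x)) :* ((:1 :- w :* q :* y) :* i)
              :+ (:1 :- w :* w :* w) :* (:- (w :* (x :* x :* (x :* x)) :* i))) refl ω q y (iᵥ n) ⟩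
    _ ≈⟨ kill-cube _ _ by *-congˡ (iᵥ-inverse n) by *-identityʳ _ ⟩
    (1# + ω * (y * q)) * (1# + ω * ω * (y * q * (y * q))) ∎
    where
    y = q ^ n

  -- By `numerator-factor` the numerators start at exponent 1, those of H at exponent 0. The shift
  -- produces the factors at q^n, divided by (1 + ω)(1 + ω²) = 1.
  summand₂′ : ∀ n → numerator₂ n * (∏< n i₃ * ∏< n iᵥ * ∏< n i₂) * power n
    ≈ H n * q ^ n * ((1# + ω * q ^ n) * (1# + ω * ω * (q ^ n * q ^ n)))
  summand₂′ zero    = sym (solve 1 (λ w → :1 :* :1 :* ((:1 :+ w :* :1) :* (:1 :+ w :* w :* (:1 :* :1)))
      := w :* w :* w :+ (:1 :+ w :+ w :* w) :* :1) refl ω by relation-0 _ _ by cube≈1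
      by solve 0 (:1 := :1 :* (:1 :* :1 :* :1) :* (:1 :* :1)) refl)
  summand₂′ (suc n) = begin
    a * f * (c * i₃ n * (v * iᵥ n) * (e * i₂ n)) * power (suc n)
      ≈⟨ *-congˡ (power-suc n) ⟩
    a * f * (c * i₃ n * (v * iᵥ n) * (e * i₂ n)) * (power n * (ω * (q * y) * q))
      ≈⟨ solve 11 (λ a f c v e i j k p z q →
           a :* f :* (c :* i :* (v :* j) :* (e :* k)) :* (p :* (z :* q))
           := a :* (c :* v :* e) :* p :* (f :* j :* (z :* (k :* i) :* q))) refl
           a f c v e (i₃ n) (iᵥ n) (i₂ n) (power n) (ω * (q * y)) q ⟩
    a * (c * v * e) * power n * (f * iᵥ n * (ω * (q * y) * (i₂ n * i₃ n) * q))
      ≈⟨ *-cong (summand₂′ n) (*-congʳ (numerator-factor n)) ⟩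
    H n * y * g * (g′ * (ω * (q * y) * (i₂ n * i₃ n) * q))
      ≈⟨ solve 7 (λ h y g g′ z k q → h :* y :* g :* (g′ :* (z :* k :* q)) := h :* (g :* z :* k) :* (y :* q) :* g′) refl
           (H n) y g g′ (ω * (q * y)) (i₂ n * i₃ n) q ⟩
    H n * η n * (y * q) * g′ ∎
    where
    y = q ^ n
    a = numerator₂ n
    f = 1# - ω * q ^ 4 * (q ^ 4) ^ n
    c = ∏< n i₃
    v = ∏< n iᵥ
    e = ∏< n i₂
    g = (1# + ω * y) * (1# + ω * ω * (y * y))
    g′ = (1# + ω * (y * q)) * (1# + ω * ω * (y * q * (y * q)))

  summand₂ : ∀ n → numerator₂ n * inverse n * power n ≈ d n
  summand₂ n = solve 7 (λ a c v j e k p → a :* (c :* (v :* j) :* (e :* k)) :* p := a :* (c :* v :* e) :* p :* (k :* j)) refl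
      (numerator₂ n) (∏< n i₃) (∏< n iᵥ) (iᵥ n) (∏< n i₂) (i₂ n) (power n)
    by *-congʳ (summand₂′ n)

-- The ingredients of the two identities, with exponents as in the statement

-- Over an arbitrary ring, because over ℂ conversion checking unfolds the
-- products.  For the same reason the exponents are variables.
module Values (R : CommutativeRing 0ℓ 0ℓ) (G : GeometricBounds R)
  (q ω : CommutativeRing.Carrier R)
  (base-q : Pochhammer.Base R G q) (base-Q : Pochhammer.Base R G (CommutativeRing.-_ R q))
  (ω-relation : Pochhammer.CubicRelation R G ω)
  (½ : CommutativeRing.Carrier R) (half : Pochhammer.IsHalf R G ½) where
  open Products R G
  open Pochhammer R G
  open Units q base-q using (module Dissection)
  open Dissection base-Q using (J₅; J₁; q₅; q₇; q₁₁; q̂₃; q̂₁₂)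
  open Evaluation R G q ω base-q base-Q ω-relation ½ half public

  x₁ x₅ x₇ x₁₁ x₁₂ : Carrier
  x₁ = P q q̂₁₂
  x₅ = P q₅ q̂₁₂
  x₇ = P q₇ q̂₁₂
  x₁₁ = P q₁₁ q̂₁₂
  x₁₂ = P (point q̂₁₂) q̂₁₂

  abstract
    P⟶′ : ∀ {a b c} p → a ≈ b → point p ≈ c → poch b c ⟶ P a p
    P⟶′ p a≈b p≈c = ⟶-seq (λ n → poch-cong n a≈b p≈c) (P⟶ _ p)

    q^3 : q * q * q ≈ q ^ 3
    q^3 = solve 1 (λ x → x :* x :* x := :1 :* x :* x :* x) refl q
    q^12 : point q̂₁₂ ≈ q ^ 12
    q^12 = solve 1 (λ x → x :* x :* x :* (x :* x :* x) :* (x :* x :* x :* (x :* x :* x))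
      := :1 :* x :* x :* x :* x :* x :* x :* x :* x :* x :* x :* x :* x) refl q

    y₃⟶ : ∀ m → m ≡ 3 → poch (q ^ m) (q ^ m) ⟶ y₃
    y₃⟶ _ ≡.refl = P⟶′ q̂₃ q^3 q^3
    y₄⟶ : ∀ a m → a ≡ 2 → m ≡ 4 → poch (ω * q ^ a) (q ^ m) ⟶ y₄
    y₄⟶ _ _ ≡.refl ≡.refl = P⟶′ q̂₄ (solve 2 (λ w x → w :* (x :* x) := w :* (:1 :* x :* x)) refl ω q)
      (solve 1 (λ x → x :* x :* (x :* x) := :1 :* x :* x :* x :* x) refl q)
    x₁⟶ : ∀ a m → a ≡ 1 → m ≡ 12 → poch (q ^ a) (q ^ m) ⟶ x₁
    x₁⟶ _ _ ≡.refl ≡.refl = P⟶′ q̂₁₂ (solve 1 (λ x → x := :1 :* x) refl q) q^12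
    x₅⟶ : ∀ a m → a ≡ 5 → m ≡ 12 → poch (q ^ a) (q ^ m) ⟶ x₅
    x₅⟶ _ _ ≡.refl ≡.refl = P⟶′ q̂₁₂ (solve 1 (λ x → x :* x :* x :* (x :* x) := :1 :* x :* x :* x :* x :* x) refl q) q^12
    x₇⟶ : ∀ a m → a ≡ 7 → m ≡ 12 → poch (q ^ a) (q ^ m) ⟶ x₇
    x₇⟶ _ _ ≡.refl ≡.refl = P⟶′ q̂₁₂ (solve 1 (λ x → x :* x :* x :* (x :* x :* x) :* x
      := :1 :* x :* x :* x :* x :* x :* x :* x) refl q) q^12
    x₁₁⟶ : ∀ a m → a ≡ 11 → m ≡ 12 → poch (q ^ a) (q ^ m) ⟶ x₁₁
    x₁₁⟶ _ _ ≡.refl ≡.refl = P⟶′ q̂₁₂ (solve 1 (λ x → x :* x :* x :* (x :* x :* x) :* (x :* x :* x :* (x :* x))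
      := :1 :* x :* x :* x :* x :* x :* x :* x :* x :* x :* x :* x) refl q) q^12
    x₁₂⟶ : ∀ m → m ≡ 12 → poch (q ^ m) (q ^ m) ⟶ x₁₂
    x₁₂⟶ _ ≡.refl = P⟶′ q̂₁₂ q^12 q^12

    numerator₁≡ : ∀ j → j ≡ 2 → ∀ n → numerator₁ n ≡ poch (- ω) q n * poch (- (ω ^ j)) (q ^ j) n
    numerator₁≡ _ ≡.refl n = ≡.refl
    denominator₁≡ : ∀ j k → j ≡ 2 → k ≡ 3 → ∀ n →
      denominator₁ n ≡ poch (ω ^ j * q) (q ^ j) n * poch (q ^ k) (q ^ k) n
    denominator₁≡ _ _ ≡.refl ≡.refl n = ≡.refl
    numerator₂≡ : ∀ j → j ≡ 4 → ∀ n → numerator₂ n ≡ poch (ω * q ^ j) (q ^ j) n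
    numerator₂≡ _ ≡.refl n = ≡.refl
    denominator≡ : ∀ j k → j ≡ 2 → k ≡ 3 → ∀ n → denominator n
      ≡ poch (q ^ k) (q ^ k) n * poch (ω * q) q (suc n) * poch (ω ^ j * q) (q ^ j) (suc n)
    denominator≡ _ _ ≡.refl ≡.refl n = ≡.refl
    power≡ : ∀ n → power n ≡ ω ^ n * q ^ ((n ℕ.* (n ℕ.+ 3)) ℕ./ 2)
    power≡ n = ≡.refl

    Σ₁-value : Σ₁ * (y₃ * y₄) ≈ x₅ * x₇ * x₁₂
    Σ₁-value = s-value

    unit : ∃ λ u → y₃ * y₄ * u ≈ 1#
    unit = unit-Y

    partial-sums : ∀ {f g : ℕ → Carrier} {l} → (∀ n → f n ≈ g n) → (λ n → ∑< n g) ⟶ l → (λ n → ∑< n f) ⟶ l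
    partial-sums f≈g = ⟶-seq (λ n → sym (∑-cong n f≈g))

    first⟶ : (λ n → ∑< n (λ k → numerator₁ k * inverse₁ k * power k)) ⟶ Σ₁
    first⟶ = partial-sums summand₁ s⟶
    second⟶ : (λ n → ∑< n (λ k → numerator₂ k * inverse k * power k)) ⟶ Σ₂
    second⟶ = partial-sums summand₂ d⟶

    -- The hypothesis is the form in which q can be cancelled when it is not known whether q is 0; ℂ
    -- will supply it.
    Σ₂-value : (∀ Δ → q * Δ ≈ 0# → (q ≈ 0# → Δ ≈ 0#) → Δ ≈ 0#) → Σ₂ * (y₃ * y₄) ≈ x₁ * x₁₁ * x₁₂
    Σ₂-value cancel = begin
      Σ₂ * Y              ≈⟨ solve 2 (λ x y → x := (x :- y) :+ y) refl (Σ₂ * Y) J₁ ⟩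
      (Σ₂ * Y - J₁) + J₁  ≈⟨ +-congʳ (cancel (Σ₂ * Y - J₁) q*Δ≈0
                               (λ q≈0 → trans (+-congʳ (Degenerate.d-value q≈0)) (-‿inverseʳ J₁))) ⟩
      0# + J₁             ≈⟨ +-identityˡ J₁ ⟩
      J₁                  ∎
      where
      q*Δ≈0 : q * (Σ₂ * Y - J₁) ≈ 0#
      q*Δ≈0 = begin
        q * (Σ₂ * Y - J₁)        ≈⟨ solve 3 (λ x y q → q :* (x :- y) := q :* x :- q :* y) refl (Σ₂ * Y) J₁ q ⟩
        q * (Σ₂ * Y) - q * J₁    ≈⟨ +-congʳ q*d-value ⟩
        q * J₁ - q * J₁          ≈⟨ -‿inverseʳ (q * J₁) ⟩
        0#                       ∎

-- Estimates for powers of a rational ratio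

module Rationals where
  open import Data.Integer as ℤ using (-[1+_]) renaming (+_ to ⁺_)
  open import Data.Integer.Tactic.RingSolver using () renaming (solve-∀ to ℤ-solve-∀)
  open import Data.Rational using (mkℚ; _+_; _*_; _-_; -_; _≤_; _<_)
  open ≡ using (refl; sym; trans; cong; subst)

  0<½ : 0ℚ < ½
  0<½ = ℚₚ.positive⁻¹ ½
  0≤1 : 0ℚ ≤ 1ℚ
  0≤1 = ℚₚ.nonNegative⁻¹ 1ℚ
  0<1 : 0ℚ < 1ℚ
  0<1 = ℚₚ.positive⁻¹ 1ℚ

  *-monoʳ : ∀ {a b} c → 0ℚ ≤ c → a ≤ b → a * c ≤ b * c
  *-monoʳ c 0≤c = ℚₚ.*-monoʳ-≤-nonNeg c {{ℚ.nonNegative 0≤c}}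
  *-monoˡ : ∀ {a b} c → 0ℚ ≤ c → a ≤ b → c * a ≤ c * b
  *-monoˡ c 0≤c = ℚₚ.*-monoˡ-≤-nonNeg c {{ℚ.nonNegative 0≤c}}

  *-mono : ∀ {a b c d} → 0ℚ ≤ b → 0ℚ ≤ c → a ≤ b → c ≤ d → a * c ≤ b * d
  *-mono {b = b} {c = c} 0≤b 0≤c a≤b c≤d = ℚₚ.≤-trans (*-monoʳ c 0≤c a≤b) (*-monoˡ b 0≤b c≤d)

  *-nonNeg : ∀ {a b} → 0ℚ ≤ a → 0ℚ ≤ b → 0ℚ ≤ a * b
  *-nonNeg {a} {b} 0≤a 0≤b = subst (_≤ a * b) (ℚₚ.*-zeroˡ b) (*-monoʳ b 0≤b 0≤a)

  *-pos : ∀ {a b} → 0ℚ < a → 0ℚ < b → 0ℚ < a * b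
  *-pos {a} {b} 0<a 0<b = subst (_< a * b) (ℚₚ.*-zeroʳ a) (ℚₚ.*-monoʳ-<-pos a {{ℚ.positive 0<a}} 0<b)

  +-nonNeg : ∀ {a b} → 0ℚ ≤ a → 0ℚ ≤ b → 0ℚ ≤ a + b
  +-nonNeg = ℚₚ.+-mono-≤

  ≤-+ʳ : ∀ a {b} → 0ℚ ≤ b → a ≤ a + b
  ≤-+ʳ a {b} 0≤b = subst (_≤ a + b) (ℚₚ.+-identityʳ a) (ℚₚ.+-monoʳ-≤ a 0≤b)
  ≤-+ˡ : ∀ {a} b → 0ℚ ≤ a → b ≤ a + b
  ≤-+ˡ {a} b 0≤a = subst (_≤ a + b) (ℚₚ.+-identityˡ b) (ℚₚ.+-monoˡ-≤ b 0≤a)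

  a-b≤a : ∀ a {b} → 0ℚ ≤ b → a - b ≤ a
  a-b≤a a {b} 0≤b = subst (a - b ≤_) (ℚₚ.+-identityʳ a) (ℚₚ.+-monoʳ-≤ a (ℚₚ.neg-antimono-≤ 0≤b))

  0≤b-a : ∀ {a b} → a ≤ b → 0ℚ ≤ b - a
  0≤b-a {a} {b} a≤b = subst (_≤ b - a) (ℚₚ.+-inverseʳ a) (ℚₚ.+-monoˡ-≤ (- a) a≤b)

  abstract
    reciprocal : ∀ a → 0ℚ < a → ∃ λ b → 0ℚ < b × a * b ≡ 1ℚ
    reciprocal a 0<a = ℚ.1/ a , ℚₚ.positive⁻¹ (ℚ.1/ a) , ℚₚ.*-inverseʳ a
      where
      instance
        a-pos : ℚ.Positive a
        a-pos = ℚ.positive 0<a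
        a-nz : ℚ.NonZero a
        a-nz = ℚₚ.pos⇒nonZero a
        1/a-pos : ℚ.Positive (ℚ.1/ a)
        1/a-pos = ℚₚ.1/pos⇒pos a

  ι : ℕ → ℚ
  ι n = mkℚ (⁺ n) 0 (Coprimality.sym (Coprimality.1-coprimeTo n))

  ι-suc : ∀ n → ι (suc n) ≡ 1ℚ + ι n
  ι-suc n = ℚₚ.toℚᵘ-injective (ℚᵘₚ.≃-trans (ℚᵘ.*≡* (lemma (⁺ n)))
    (ℚᵘₚ.≃-sym (ℚₚ.toℚᵘ-homo-+ 1ℚ (ι n))))
    where
    lemma : ∀ i → (⁺ 1 ℤ.+ i) ℤ.* (⁺ 1 ℤ.* ⁺ 1) ≡ (⁺ 1 ℤ.* ⁺ 1 ℤ.+ i ℤ.* ⁺ 1) ℤ.* ⁺ 1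
    lemma = ℤ-solve-∀

  abstract
    archimedean : ∀ p → ∃ λ n → p ≤ ι n
    archimedean (mkℚ (⁺ n) d _)    = n , ℚ.*≤* (ℤₚ.*-monoˡ-≤-nonNeg (⁺ n) {⁺ 1} {⁺ suc d} (ℤ.+≤+ (ℕ.s≤s ℕ.z≤n)))
    archimedean (mkℚ -[1+ n ] d _) = 0 , ℚ.*≤* ℤ.-≤+

  module Powers (r : ℚ) (0<r : 0ℚ < r) (r<1 : r < 1ℚ) where
    r^ : ℕ → ℚ
    r^ zero    = 1ℚ
    r^ (suc n) = r^ n * r

    0<r^ : ∀ n → 0ℚ < r^ n
    0<r^ zero    = 0<1
    0<r^ (suc n) = *-pos (0<r^ n) 0<r

    0≤r^ : ∀ n → 0ℚ ≤ r^ n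
    0≤r^ n = ℚₚ.<⇒≤ (0<r^ n)

    h : ℚ
    h = 1ℚ - r
    0<h : 0ℚ < h
    0<h = subst (_< h) (ℚₚ.+-inverseʳ r) (ℚₚ.+-monoˡ-< (- r) r<1)
    0≤h : 0ℚ ≤ h
    0≤h = ℚₚ.<⇒≤ 0<h

    r^-+ : ∀ m n → r^ (m ℕ.+ n) ≡ r^ m * r^ n
    r^-+ zero    n = sym (ℚₚ.*-identityˡ (r^ n))
    r^-+ (suc m) n = trans (cong (_* r) (r^-+ m n))
      (solve 3 (λ a b r → a :* b :* r := a :* r :* b) refl (r^ m) (r^ n) r)
      where open +-*-Solver

    r^-suc≤ : ∀ n → r^ (suc n) ≤ r^ n
    r^-suc≤ n = subst (r^ n * r ≤_) (ℚₚ.*-identityʳ (r^ n)) (*-monoˡ (r^ n) (0≤r^ n) (ℚₚ.<⇒≤ r<1))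

    r^-anti : ∀ {m n} → m ℕ.≤ n → r^ n ≤ r^ m
    r^-anti m≤n = go (ℕₚ.≤⇒≤′ m≤n)
      where
      go : ∀ {m n} → m ℕ.≤′ n → r^ n ≤ r^ m
      go ℕ.≤′-refl           = ℚₚ.≤-refl
      go (ℕ.≤′-step {n} m≤n) = ℚₚ.≤-trans (r^-suc≤ n) (go m≤n)

    0≤ι : ∀ n → 0ℚ ≤ ι n
    0≤ι n = ℚₚ.nonNegative⁻¹ (ι n)

    -- The left side decreases by r^n h² (1 + n) at each step.
    bernoulli : ∀ n → r^ n * (1ℚ + ι n * h) ≤ 1ℚ
    bernoulli zero    = ℚₚ.≤-reflexive (trans (ℚₚ.*-identityˡ _)
      (trans (cong (1ℚ +_) (ℚₚ.*-zeroˡ h)) (ℚₚ.+-identityʳ 1ℚ)))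
    bernoulli (suc n) = ℚₚ.≤-trans (subst (_≤ r^ n * (1ℚ + ι n * h)) (sym step)
        (a-b≤a _ 0≤e))
      (bernoulli n)
      where
      open +-*-Solver
      e : ℚ
      e = r^ n * (h * h * (1ℚ + ι n))
      0≤e : 0ℚ ≤ e
      0≤e = *-nonNeg (0≤r^ n) (*-nonNeg (*-nonNeg 0≤h 0≤h) (+-nonNeg 0≤1 (0≤ι n)))
      step : r^ (suc n) * (1ℚ + ι (suc n) * h) ≡ r^ n * (1ℚ + ι n * h) - e
      step = trans (cong (λ k → r^ (suc n) * (1ℚ + k * h)) (ι-suc n))
        (solve 3 (λ p r i → let h = con 1ℚ :- r in
          p :* r :* (con 1ℚ :+ (con 1ℚ :+ i) :* h)
          := p :* (con 1ℚ :+ i :* h) :- p :* (h :* h :* (con 1ℚ :+ i))) refl (r^ n) r (ι n))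

    abstract
      -- By Bernoulli's inequality any n ≥ C/(εh) will do.
      r^-small : ∀ C ε → 0ℚ ≤ C → 0ℚ < ε → ∃ λ n → C * r^ n ≤ ε
      r^-small C ε 0≤C 0<ε =
        let b , 0<b , εhb≡1 = reciprocal (ε * h) (*-pos 0<ε 0<h)
            n , Cb≤n = archimedean (C * b)
            Cb≤ : C * b * (ε * h) ≤ ι n * (ε * h)
            Cb≤ = *-monoʳ (ε * h) (ℚₚ.<⇒≤ (*-pos 0<ε 0<h)) Cb≤n
        in n , (begin
          C * r^ n
            ≡⟨ cong (_* r^ n) (trans (sym (ℚₚ.*-identityʳ C)) (cong (C *_) (sym εhb≡1))) ⟩
          C * (ε * h * b) * r^ n
            ≡⟨ cong (_* r^ n) (solve 4 (λ C e h b → C :* (e :* h :* b) := C :* b :* (e :* h)) refl C ε h b) ⟩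
          C * b * (ε * h) * r^ n
            ≤⟨ *-monoʳ (r^ n) (0≤r^ n) Cb≤ ⟩
          ι n * (ε * h) * r^ n
            ≤⟨ ≤-+ˡ {ε * r^ n} _ (*-nonNeg (ℚₚ.<⇒≤ 0<ε) (0≤r^ n)) ⟩
          ε * r^ n + ι n * (ε * h) * r^ n
            ≡⟨ solve 4 (λ e p i h → e :* p :+ i :* (e :* h) :* p := e :* (p :* (con 1ℚ :+ i :* h))) refl ε (r^ n) (ι n) h ⟩
          ε * (r^ n * (1ℚ + ι n * h))
            ≤⟨ *-monoˡ ε (ℚₚ.<⇒≤ 0<ε) (bernoulli n) ⟩
          ε * 1ℚ
            ≡⟨ ℚₚ.*-identityʳ ε ⟩
          ε ∎)
        where
        open ℚₚ.≤-Reasoning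
        open +-*-Solver

    max-upto : ∀ (c : ℕ → ℚ) n → ∃ λ B → 0ℚ ≤ B × (∀ k → k ℕ.≤ n → c k ≤ B)
    max-upto c zero    = c 0 ℚ.⊔ 0ℚ , ℚₚ.p≤q⊔p (c 0) 0ℚ , λ { .0 ℕ.z≤n → ℚₚ.p≤p⊔q (c 0) 0ℚ }
    max-upto c (suc n) =
      let B , 0≤B , bound = max-upto c n
      in B ℚ.⊔ c (suc n) , ℚₚ.≤-trans 0≤B (ℚₚ.p≤p⊔q B _) , λ k k≤1+n → case bound k k≤1+n
      where
      case : ∀ {B} → (∀ k → k ℕ.≤ n → c k ≤ B) → ∀ k → k ℕ.≤ suc n → c k ≤ B ℚ.⊔ c (suc n)
      case {B} bound k k≤1+n with ℕₚ.m≤n⇒m<n∨m≡n k≤1+n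
      ... | inj₁ (ℕ.s≤s k≤n) = ℚₚ.≤-trans (bound k k≤n) (ℚₚ.p≤p⊔q B _)
      ... | inj₂ refl        = ℚₚ.p≤q⊔p B _

    ℕ-rec : ∀ {P : ℕ → Set} → P 0 → (∀ n → P n → P (suc n)) → ∀ n → P n
    ℕ-rec z s zero    = z
    ℕ-rec z s (suc n) = s n (ℕ-rec z s n)

    below-or-above : ∀ K n {c : ℕ → ℚ} {C} → (∀ k → k ℕ.≤ K → c k ≤ C) → (∀ i → c (i ℕ.+ K) ≤ C) → c n ≤ C
    below-or-above K n {c} {C} below above with ℕₚ.≤-total n K
    ... | inj₁ n≤K = below n n≤K
    ... | inj₂ K≤n = subst (λ k → c k ≤ C) (ℕₚ.m∸n+n≡m K≤n) (above (n ℕ.∸ K))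

    abstract
      -- From some K on B r^n ≤ ½, and then A + ½C ≤ C for every C ≥ 2A; M covers the finitely many
      -- earlier values.
      affine-bounded : ∀ A B (c : ℕ → ℚ) → 0ℚ ≤ A → 0ℚ ≤ B → (∀ n → 0ℚ ≤ c n) →
        (∀ n → c (suc n) ≤ A + B * r^ n * c n) → ∃ λ C → 0ℚ ≤ C × ∀ n → c n ≤ C
      affine-bounded A B c 0≤A 0≤B 0≤c step =
        let K , BK≤½ = r^-small B ½ 0≤B 0<½
            M , 0≤M , bound = max-upto c K
            C = M + (A + A)
            0≤C = +-nonNeg 0≤M (+-nonNeg 0≤A 0≤A)
            start : ∀ k → k ℕ.≤ K → c k ≤ C
            start k k≤K = ℚₚ.≤-trans (bound k k≤K) (≤-+ʳ M (+-nonNeg 0≤A 0≤A))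
            next : ∀ n → K ℕ.≤ n → c n ≤ C → c (suc n) ≤ C
            next n K≤n cn≤C = begin
              c (suc n)             ≤⟨ step n ⟩
              A + B * r^ n * c n    ≤⟨ ℚₚ.+-monoʳ-≤ A (*-mono (ℚₚ.<⇒≤ 0<½) (0≤c n)
                                        (ℚₚ.≤-trans (*-monoˡ B 0≤B (r^-anti K≤n)) BK≤½) cn≤C) ⟩
              A + ½ * C             ≡⟨ solve 2 (λ A M → A :+ con ½ :* (M :+ (A :+ A)) := con ½ :* M :+ (A :+ A)) refl A M ⟩
              ½ * M + (A + A)       ≤⟨ ℚₚ.+-monoˡ-≤ (A + A) (subst (½ * M ≤_)
                                        (solve 1 (λ M → con ½ :* M :+ con ½ :* M := M) refl M)
                                        (≤-+ʳ (½ * M) (*-nonNeg (ℚₚ.<⇒≤ 0<½) 0≤M))) ⟩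
              M + (A + A)           ∎
            go : ∀ i → c (i ℕ.+ K) ≤ C
            go = ℕ-rec {λ i → c (i ℕ.+ K) ≤ C} (start K ℕₚ.≤-refl) (λ i → next (i ℕ.+ K) (ℕₚ.m≤n+m K i))
            all : ∀ n → c n ≤ C
            all n = below-or-above K n start (λ i → go i)
        in C , 0≤C , all
        where
        open ℚₚ.≤-Reasoning
        open +-*-Solver

    -- Once W rᵏ is at most h/2, the remaining factors multiply to at most 2.
    abstract
      product-bounded : ∀ W (c : ℕ → ℚ) → 0ℚ ≤ W → (∀ n → 0ℚ ≤ c n) →
        (∀ n → c (suc n) ≤ c n * (1ℚ + W * r^ n)) → ∃ λ C → 0ℚ ≤ C × ∀ n → c n ≤ C
      product-bounded W c 0≤W 0≤c step =
        let K , WK≤ = r^-small W (½ * h) 0≤W (*-pos 0<½ 0<h)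
            M , 0≤M , bound = max-upto c K
            C = M + M
            0≤C = +-nonNeg 0≤M 0≤M
            start : ∀ k → k ℕ.≤ K → c k ≤ C
            start k k≤K = ℚₚ.≤-trans (bound k k≤K) (≤-+ʳ M 0≤M)
            -- The bound M(2 - r^i) can absorb the factor 1 + ½ h r^i because h r^i = r^i - r^(i+1).
            next : ∀ i → c (i ℕ.+ K) ≤ M * (1ℚ + (1ℚ - r^ i)) → c (suc (i ℕ.+ K)) ≤ M * (1ℚ + (1ℚ - r^ (suc i)))
            next i ih = begin
              c (suc (i ℕ.+ K))
                ≤⟨ step (i ℕ.+ K) ⟩
              c (i ℕ.+ K) * (1ℚ + W * r^ (i ℕ.+ K))
                ≤⟨ *-mono (*-nonNeg 0≤M (+-nonNeg 0≤1 (0≤b-a (r^-anti {0} {i} ℕ.z≤n))))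
                     (+-nonNeg 0≤1 (*-nonNeg 0≤W (0≤r^ (i ℕ.+ K)))) ih
                     (ℚₚ.+-monoʳ-≤ 1ℚ (subst (_≤ ½ * h * r^ i)
                       (trans (solve 3 (λ W a b → W :* b :* a := W :* (a :* b)) refl W (r^ i) (r^ K))
                         (cong (W *_) (sym (r^-+ i K))))
                       (*-monoʳ (r^ i) (0≤r^ i) WK≤))) ⟩
              M * (1ℚ + (1ℚ - r^ i)) * (1ℚ + ½ * h * r^ i)
                ≤⟨ ≤-+ʳ _ (*-nonNeg 0≤M (*-nonNeg (*-nonNeg (*-nonNeg (ℚₚ.<⇒≤ 0<½) 0≤h) (0≤r^ i)) (0≤r^ i))) ⟩
              M * (1ℚ + (1ℚ - r^ i)) * (1ℚ + ½ * h * r^ i) + M * (½ * h * r^ i * r^ i)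
                ≡⟨ solve 3 (λ M p r → let h = con 1ℚ :- r in
                     M :* (con 1ℚ :+ (con 1ℚ :- p)) :* (con 1ℚ :+ con ½ :* h :* p) :+ M :* (con ½ :* h :* p :* p)
                     := M :* (con 1ℚ :+ (con 1ℚ :- p :* r))) refl M (r^ i) r ⟩
              M * (1ℚ + (1ℚ - r^ (suc i))) ∎
            go : ∀ i → c (i ℕ.+ K) ≤ M * (1ℚ + (1ℚ - r^ i))
            go = ℕ-rec {λ i → c (i ℕ.+ K) ≤ M * (1ℚ + (1ℚ - r^ i))}
              (subst (c K ≤_) (solve 1 (λ M → M := M :* (con 1ℚ :+ (con 1ℚ :- con 1ℚ))) refl M) (bound K ℕₚ.≤-refl)) next
            above : ∀ i → c (i ℕ.+ K) ≤ C
            above i = ℚₚ.≤-trans (go i) (subst (M * (1ℚ + (1ℚ - r^ i)) ≤_)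
              (solve 1 (λ M → M :* (con 1ℚ :+ con 1ℚ) := M :+ M) refl M)
              (*-monoˡ M 0≤M (ℚₚ.+-monoʳ-≤ 1ℚ (a-b≤a 1ℚ (0≤r^ i)))))
        in C , 0≤C , λ n → below-or-above K n start above
        where
        open ℚₚ.≤-Reasoning
        open +-*-Solver

-- Gaussian rationals and their norm

module GaussianRationals where
  open import Data.Rational using (∣_∣; _+_; _*_; _-_; -_; _≤_; _<_)
  open ≡ using (refl; sym; trans; cong; cong₂; subst)
  open Rationals
  open +-*-Solver

  infixl 7 _⊗_
  infixl 6 _⊕_ _⊝_

  ℚ[i] : Set
  ℚ[i] = ℚ × ℚ

  _⊕_ _⊗_ _⊝_ : ℚ[i] → ℚ[i] → ℚ[i]
  (a , b) ⊕ (c , d) = a + c , b + d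
  (a , b) ⊗ (c , d) = a * c + - (b * d) , a * d + b * c
  (a , b) ⊝ (c , d) = a + - c , b + - d

  ⊖_ : ℚ[i] → ℚ[i]
  ⊖ (a , b) = - a , - b

  -- The sum norm has rational values and is submultiplicative; the modulus would require a square
  -- root.
  ‖_‖ : ℚ[i] → ℚ
  ‖ a , b ‖ = ∣ a ∣ + ∣ b ∣

  0≤‖_‖ : ∀ x → 0ℚ ≤ ‖ x ‖
  0≤‖ a , b ‖ = +-nonNeg (ℚₚ.0≤∣p∣ a) (ℚₚ.0≤∣p∣ b)

  ∣re∣≤ : ∀ x → ∣ proj₁ x ∣ ≤ ‖ x ‖
  ∣re∣≤ (a , b) = ≤-+ʳ ∣ a ∣ (ℚₚ.0≤∣p∣ b)

  ∣im∣≤ : ∀ x → ∣ proj₂ x ∣ ≤ ‖ x ‖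
  ∣im∣≤ (a , b) = ≤-+ˡ ∣ b ∣ (ℚₚ.0≤∣p∣ a)

  ‖⊕‖ : ∀ x y → ‖ x ⊕ y ‖ ≤ ‖ x ‖ + ‖ y ‖
  ‖⊕‖ (a , b) (c , d) = ℚₚ.≤-trans (ℚₚ.+-mono-≤ (ℚₚ.∣p+q∣≤∣p∣+∣q∣ a c) (ℚₚ.∣p+q∣≤∣p∣+∣q∣ b d))
    (ℚₚ.≤-reflexive (solve 4 (λ a b c d → (a :+ c) :+ (b :+ d) := (a :+ b) :+ (c :+ d)) refl
      (∣ a ∣) (∣ b ∣) (∣ c ∣) (∣ d ∣)))

  ‖⊖‖ : ∀ x → ‖ ⊖ x ‖ ≡ ‖ x ‖
  ‖⊖‖ (a , b) = cong₂ _+_ (ℚₚ.∣-p∣≡∣p∣ a) (ℚₚ.∣-p∣≡∣p∣ b)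

  ‖⊝‖ : ∀ x y → ‖ x ⊝ y ‖ ≤ ‖ x ‖ + ‖ y ‖
  ‖⊝‖ x y = subst (λ n → ‖ x ⊝ y ‖ ≤ ‖ x ‖ + n) (‖⊖‖ y) (‖⊕‖ x (⊖ y))

  ‖⊝‖-comm : ∀ x y → ‖ x ⊝ y ‖ ≡ ‖ y ⊝ x ‖
  ‖⊝‖-comm x@(a , b) y@(c , d) = trans (cong ‖_‖ (cong₂ _,_ (flip a c) (flip b d))) (‖⊖‖ (y ⊝ x))
    where
    flip : ∀ a c → a + - c ≡ - (c + - a)
    flip = solve 2 (λ a c → a :+ :- c := :- (c :+ :- a)) refl

  ‖⊗‖ : ∀ x y → ‖ x ⊗ y ‖ ≤ ‖ x ‖ * ‖ y ‖
  ‖⊗‖ (a , b) (c , d) = begin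
    ∣ a * c + - (b * d) ∣ + ∣ a * d + b * c ∣
      ≤⟨ ℚₚ.+-mono-≤ (ℚₚ.∣p+q∣≤∣p∣+∣q∣ (a * c) (- (b * d))) (ℚₚ.∣p+q∣≤∣p∣+∣q∣ (a * d) (b * c)) ⟩
    (∣ a * c ∣ + ∣ - (b * d) ∣) + (∣ a * d ∣ + ∣ b * c ∣)
      ≡⟨ cong₂ _+_
           (cong₂ _+_ (ℚₚ.∣p*q∣≡∣p∣*∣q∣ a c) (trans (ℚₚ.∣-p∣≡∣p∣ (b * d)) (ℚₚ.∣p*q∣≡∣p∣*∣q∣ b d)))
           (cong₂ _+_ (ℚₚ.∣p*q∣≡∣p∣*∣q∣ a d) (ℚₚ.∣p*q∣≡∣p∣*∣q∣ b c)) ⟩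
    (∣ a ∣ * ∣ c ∣ + ∣ b ∣ * ∣ d ∣) + (∣ a ∣ * ∣ d ∣ + ∣ b ∣ * ∣ c ∣)
      ≡⟨ solve 4 (λ a b c d → (a :* c :+ b :* d) :+ (a :* d :+ b :* c) := (a :+ b) :* (c :+ d)) refl
           (∣ a ∣) (∣ b ∣) (∣ c ∣) (∣ d ∣) ⟩
    (∣ a ∣ + ∣ b ∣) * (∣ c ∣ + ∣ d ∣) ∎
    where open ℚₚ.≤-Reasoning

  ⊝-through : ∀ x y z → x ⊝ z ≡ (x ⊝ y) ⊕ (y ⊝ z)
  ⊝-through (a , b) (c , d) (e , f) = cong₂ _,_ (through a c e) (through b d f)
    where
    through : ∀ a c e → a + - e ≡ (a + - c) + (c + - e)
    through = solve 3 (λ a c e → a :+ :- e := (a :+ :- c) :+ (c :+ :- e)) refl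

  ‖⊝‖-triangle : ∀ x y z → ‖ x ⊝ z ‖ ≤ ‖ x ⊝ y ‖ + ‖ y ⊝ z ‖
  ‖⊝‖-triangle x y z = subst (λ w → ‖ w ‖ ≤ ‖ x ⊝ y ‖ + ‖ y ⊝ z ‖) (sym (⊝-through x y z)) (‖⊕‖ (x ⊝ y) (y ⊝ z))

  ‖‖-near : ∀ x y → ‖ x ‖ ≤ ‖ y ‖ + ‖ x ⊝ y ‖
  ‖‖-near x@(a , b) y@(c , d) = subst (λ w → ‖ w ‖ ≤ ‖ y ‖ + ‖ x ⊝ y ‖) (cong₂ _,_ (eq a c) (eq b d)) (‖⊕‖ y (x ⊝ y))
    where
    eq : ∀ a c → c + (a + - c) ≡ a
    eq = solve 2 (λ a c → c :+ (a :+ :- c) := a) refl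

  ⊕-⊝ : ∀ x y z w → (x ⊕ y) ⊝ (z ⊕ w) ≡ (x ⊝ z) ⊕ (y ⊝ w)
  ⊕-⊝ (a , a′) (b , b′) (c , c′) (d , d′) = cong₂ _,_ (eq a b c d) (eq a′ b′ c′ d′)
    where
    eq : ∀ a b c d → (a + b) + - (c + d) ≡ (a + - c) + (b + - d)
    eq = solve 4 (λ a b c d → (a :+ b) :+ :- (c :+ d) := (a :+ :- c) :+ (b :+ :- d)) refl

  ⊗-⊝ : ∀ x y z w → (x ⊗ y) ⊝ (z ⊗ w) ≡ ((x ⊝ z) ⊗ y) ⊕ (z ⊗ (y ⊝ w))
  ⊗-⊝ (a , a′) (b , b′) (c , c′) (d , d′) = cong₂ _,_
    (solve 8 (λ a a′ b b′ c c′ d d′ →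
      (a :* b :+ :- (a′ :* b′)) :+ :- (c :* d :+ :- (c′ :* d′))
      := ((a :+ :- c) :* b :+ :- ((a′ :+ :- c′) :* b′)) :+ (c :* (b :+ :- d) :+ :- (c′ :* (b′ :+ :- d′))))
      refl a a′ b b′ c c′ d d′)
    (solve 8 (λ a a′ b b′ c c′ d d′ →
      (a :* b′ :+ a′ :* b) :+ :- (c :* d′ :+ c′ :* d)
      := ((a :+ :- c) :* b′ :+ (a′ :+ :- c′) :* b) :+ (c :* (b′ :+ :- d′) :+ c′ :* (b :+ :- d)))
      refl a a′ b b′ c c′ d d′)

  ⊖-⊝ : ∀ x y → (⊖ x) ⊝ (⊖ y) ≡ ⊖ (x ⊝ y)
  ⊖-⊝ (a , a′) (b , b′) = cong₂ _,_ (eq a b) (eq a′ b′)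
    where
    eq : ∀ a b → - a + - (- b) ≡ - (a + - b)
    eq = solve 2 (λ a b → :- a :+ :- (:- b) := :- (a :+ :- b)) refl

  ⊗-assoc : ∀ x y z → (x ⊗ y) ⊗ z ≡ x ⊗ (y ⊗ z)
  ⊗-assoc (a , a′) (b , b′) (c , c′) = cong₂ _,_
    (solve 6 (λ a a′ b b′ c c′ →
      (a :* b :+ :- (a′ :* b′)) :* c :+ :- ((a :* b′ :+ a′ :* b) :* c′)
      := a :* (b :* c :+ :- (b′ :* c′)) :+ :- (a′ :* (b :* c′ :+ b′ :* c))) refl a a′ b b′ c c′)
    (solve 6 (λ a a′ b b′ c c′ →
      (a :* b :+ :- (a′ :* b′)) :* c′ :+ (a :* b′ :+ a′ :* b) :* c
      := a :* (b :* c′ :+ b′ :* c) :+ a′ :* (b :* c :+ :- (b′ :* c′))) refl a a′ b b′ c c′)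

  ⊗-comm : ∀ x y → x ⊗ y ≡ y ⊗ x
  ⊗-comm (a , a′) (b , b′) = cong₂ _,_
    (solve 4 (λ a a′ b b′ → a :* b :+ :- (a′ :* b′) := b :* a :+ :- (b′ :* a′)) refl a a′ b b′)
    (solve 4 (λ a a′ b b′ → a :* b′ :+ a′ :* b := b :* a′ :+ b′ :* a) refl a a′ b b′)

  ⊗-identityˡ : ∀ x → (1ℚ , 0ℚ) ⊗ x ≡ x
  ⊗-identityˡ (a , b) = cong₂ _,_
    (solve 2 (λ a b → con 1ℚ :* a :+ :- (con 0ℚ :* b) := a) refl a b)
    (solve 2 (λ a b → con 1ℚ :* b :+ con 0ℚ :* a := b) refl a b)

  ⊗-distribˡ : ∀ x y z → x ⊗ (y ⊕ z) ≡ (x ⊗ y) ⊕ (x ⊗ z)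
  ⊗-distribˡ (a , a′) (b , b′) (c , c′) = cong₂ _,_
    (solve 6 (λ a a′ b b′ c c′ →
      a :* (b :+ c) :+ :- (a′ :* (b′ :+ c′))
      := (a :* b :+ :- (a′ :* b′)) :+ (a :* c :+ :- (a′ :* c′))) refl a a′ b b′ c c′)
    (solve 6 (λ a a′ b b′ c c′ →
      a :* (b′ :+ c′) :+ a′ :* (b :+ c)
      := (a :* b′ :+ a′ :* b) :+ (a :* c′ :+ a′ :* c)) refl a a′ b b′ c c′)

-- ℂ as a commutative ring

module ComplexRing where
  open import Data.Rational using (∣_∣; _≤_; _<_)
  open ≡ using (refl; sym; trans; cong; cong₂; subst; subst₂)
  open Rationals
  open GaussianRationals
  open Defs using (mkℝ; seq; cauchy; mk≈ʳ; close; IsCauchy; ℂ; _+i_; re; im; 0ℂ; 1ℂ)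
    renaming (_≈_ to _≈ᶜ_; _+_ to _+ᶜ_; _*_ to _*ᶜ_; -_ to -ᶜ_; _-_ to _-ᶜ_)

  Eventually : (ℕ → Set) → Set
  Eventually P = ∃ λ K → ∀ k → K ℕ.≤ k → P k

  eventually₁ : ∀ {P Q : ℕ → Set} → (∀ k → P k → Q k) → Eventually P → Eventually Q
  eventually₁ f (K , p) = K , λ k K≤k → f k (p k K≤k)

  eventually₂ : ∀ {P Q S : ℕ → Set} → (∀ k → P k → Q k → S k) → Eventually P → Eventually Q → Eventually S
  eventually₂ f (K , p) (L , q) = K ℕ.⊔ L , λ k h →
    f k (p k (ℕₚ.≤-trans (ℕₚ.m≤m⊔n K L) h)) (q k (ℕₚ.≤-trans (ℕₚ.m≤n⊔m K L) h))

  eventually₃ : ∀ {P Q S T : ℕ → Set} → (∀ k → P k → Q k → S k → T k) →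
    Eventually P → Eventually Q → Eventually S → Eventually T
  eventually₃ f p q = eventually₂ (λ k pq → f k (proj₁ pq) (proj₂ pq)) (eventually₂ (λ _ → _,_) p q)

  -- The operations of ℂ act on rational approximants index by index, so the ring laws reduce to
  -- those of ℚ[i].
  at : ℂ → ℕ → ℚ[i]
  at z k = seq (re z) k , seq (im z) k

  half-pos : ∀ {ε} → 0ℚ < ε → 0ℚ < ½ ℚ.* ε
  half-pos = *-pos 0<½

  halves : ∀ ε → ½ ℚ.* ε ℚ.+ ½ ℚ.* ε ≡ ε
  halves = +-*-Solver.solve 1 (λ ε → con ½ :* ε :+ con ½ :* ε := ε) refl
    where open +-*-Solver

  half< : ∀ {ε} → 0ℚ < ε → ½ ℚ.* ε < ε
  half< {ε} 0<ε = subst₂ _<_ (ℚₚ.+-identityˡ (½ ℚ.* ε)) (halves ε) (ℚₚ.+-monoˡ-< (½ ℚ.* ε) (half-pos 0<ε))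

  ≈⇒close : ∀ {z w} → z ≈ᶜ w → ∀ ε → 0ℚ < ε → Eventually (λ k → ‖ at z k ⊝ at w k ‖ ≤ ε)
  ≈⇒close {z} {w} (p , q) ε 0<ε = eventually₂
    (λ k a b → subst (‖ at z k ⊝ at w k ‖ ≤_) (halves ε) (ℚₚ.+-mono-≤ (ℚₚ.<⇒≤ a) (ℚₚ.<⇒≤ b)))
    (close p (½ ℚ.* ε) (half-pos 0<ε)) (close q (½ ℚ.* ε) (half-pos 0<ε))

  close⇒≈ : ∀ {z w} → (∀ ε → 0ℚ < ε → Eventually (λ k → ‖ at z k ⊝ at w k ‖ ≤ ε)) → z ≈ᶜ w
  close⇒≈ {z} {w} h = mk≈ʳ (λ ε 0<ε → eventually₁
      (λ k b → ℚₚ.≤-<-trans (ℚₚ.≤-trans (∣re∣≤ (at z k ⊝ at w k)) b) (half< 0<ε)) (h (½ ℚ.* ε) (half-pos 0<ε)))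
    , mk≈ʳ (λ ε 0<ε → eventually₁
      (λ k b → ℚₚ.≤-<-trans (ℚₚ.≤-trans (∣im∣≤ (at z k ⊝ at w k)) b) (half< 0<ε)) (h (½ ℚ.* ε) (half-pos 0<ε)))

  ‖x⊝x‖≡0 : ∀ x → ‖ x ⊝ x ‖ ≡ 0ℚ
  ‖x⊝x‖≡0 (a , b) = cong₂ (λ u v → ∣ u ∣ ℚ.+ ∣ v ∣) {a ℚ.+ ℚ.- a} {0ℚ} {b ℚ.+ ℚ.- b} {0ℚ} (ℚₚ.+-inverseʳ a) (ℚₚ.+-inverseʳ b)

  pointwise⇒≈ : ∀ {z w} → (∀ k → at z k ≡ at w k) → z ≈ᶜ w
  pointwise⇒≈ {z} {w} eq = close⇒≈ (λ ε 0<ε → 0 , λ k _ →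
    subst (_≤ ε) (trans (sym (‖x⊝x‖≡0 (at z k))) (cong (λ x → ‖ at z k ⊝ x ‖) (eq k))) (ℚₚ.<⇒≤ 0<ε))

  CauchyModulus : (ℕ → ℚ[i]) → Set
  CauchyModulus x = ∀ ε → 0ℚ < ε → ∃ λ K → ∀ j k → K ℕ.≤ j → K ℕ.≤ k → ‖ x j ⊝ x k ‖ ≤ ε

  abstract
    at-cauchy : ∀ z → CauchyModulus (at z)
    at-cauchy z ε 0<ε =
      let K , p = cauchy (re z) (½ ℚ.* ε) (half-pos 0<ε)
          L , q = cauchy (im z) (½ ℚ.* ε) (half-pos 0<ε)
          l : ∀ {k} → K ℕ.⊔ L ℕ.≤ k → K ℕ.≤ k
          l = ℕₚ.≤-trans (ℕₚ.m≤m⊔n K L)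
          r : ∀ {k} → K ℕ.⊔ L ℕ.≤ k → L ℕ.≤ k
          r = ℕₚ.≤-trans (ℕₚ.m≤n⊔m K L)
      in K ℕ.⊔ L , λ j k K≤j K≤k → subst (‖ at z j ⊝ at z k ‖ ≤_) (halves ε)
           (ℚₚ.+-mono-≤ (ℚₚ.<⇒≤ (p j k (l K≤j) (l K≤k))) (ℚₚ.<⇒≤ (q j k (r K≤j) (r K≤k))))

  assemble : (x : ℕ → ℚ[i]) → CauchyModulus x → ∃ λ z → ∀ k → at z k ≡ x k
  assemble x c = mkℝ (λ k → proj₁ (x k)) (part (λ k → proj₁ (x k)) (λ j k → ∣re∣≤ (x j ⊝ x k)))
              +i mkℝ (λ k → proj₂ (x k)) (part (λ k → proj₂ (x k)) (λ j k → ∣im∣≤ (x j ⊝ x k)))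
    , λ _ → refl
    where
    part : (s : ℕ → ℚ) → (∀ j k → ∣ s j ℚ.- s k ∣ ≤ ‖ x j ⊝ x k ‖) → IsCauchy s
    part s s≤ ε 0<ε =
      let K , p = c (½ ℚ.* ε) (half-pos 0<ε)
      in K , λ j k K≤j K≤k → ℚₚ.≤-<-trans (ℚₚ.≤-trans (s≤ j k) (p j k K≤j K≤k)) (half< 0<ε)

  abstract
    bounded : ∀ z → ∃ λ B → 0ℚ ≤ B × Eventually (λ k → ‖ at z k ‖ ≤ B)
    bounded z =
      let K , p = at-cauchy z 1ℚ 0<1
      in ‖ at z K ‖ ℚ.+ 1ℚ , +-nonNeg 0≤‖ at z K ‖ 0≤1 , K , λ k K≤k →
           ℚₚ.≤-trans (‖‖-near (at z k) (at z K)) (ℚₚ.+-monoʳ-≤ ‖ at z K ‖ (p k K K≤k ℕₚ.≤-refl))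

  -- The choice is δ = ε/(B + 1), which is defined also for B = 0.
  split : ∀ B ε → 0ℚ ≤ B → 0ℚ < ε → ∃ λ δ → 0ℚ < δ × δ ℚ.* B ≤ ε
  split B ε 0≤B 0<ε =
    let b , 0<b , eq = reciprocal (B ℚ.+ 1ℚ) (ℚₚ.+-mono-≤-< 0≤B 0<1)
    in ε ℚ.* b , *-pos 0<ε 0<b , ℚₚ.≤-trans
         (*-monoˡ (ε ℚ.* b) (ℚₚ.<⇒≤ (*-pos 0<ε 0<b)) (≤-+ʳ B 0≤1))
         (ℚₚ.≤-reflexive (trans (rearrange ε b B) (trans (cong (ε ℚ.*_) eq) (ℚₚ.*-identityʳ ε))))
    where
    rearrange : ∀ ε b B → ε ℚ.* b ℚ.* (B ℚ.+ 1ℚ) ≡ ε ℚ.* ((B ℚ.+ 1ℚ) ℚ.* b)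
    rearrange = +-*-Solver.solve 3 (λ ε b B → ε :* b :* (B :+ con 1ℚ) := ε :* ((B :+ con 1ℚ) :* b)) refl
      where open +-*-Solver

  abstract
    ≈-isEquivalence : IsEquivalence _≈ᶜ_
    ≈-isEquivalence = record
      { refl  = pointwise⇒≈ (λ _ → refl)
      ; sym   = λ {z} {w} p → close⇒≈ (λ ε 0<ε → eventually₁
          (λ k → subst (_≤ ε) (‖⊝‖-comm (at z k) (at w k))) (≈⇒close p ε 0<ε))
      ; trans = λ {x} {y} {z} p q → close⇒≈ (λ ε 0<ε → eventually₂
          (λ k a b → ℚₚ.≤-trans (‖⊝‖-triangle (at x k) (at y k) (at z k))
            (subst (‖ at x k ⊝ at y k ‖ ℚ.+ ‖ at y k ⊝ at z k ‖ ≤_) (halves ε) (ℚₚ.+-mono-≤ a b)))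
          (≈⇒close p (½ ℚ.* ε) (half-pos 0<ε)) (≈⇒close q (½ ℚ.* ε) (half-pos 0<ε)))
      }

    +-cong : ∀ {x y u v} → x ≈ᶜ y → u ≈ᶜ v → x +ᶜ u ≈ᶜ y +ᶜ v
    +-cong {x} {y} {u} {v} p q = close⇒≈ (λ ε 0<ε → eventually₂
      (λ k a b → subst₂ _≤_ (cong ‖_‖ (sym (⊕-⊝ (at x k) (at u k) (at y k) (at v k)))) (halves ε)
        (ℚₚ.≤-trans (‖⊕‖ (at x k ⊝ at y k) (at u k ⊝ at v k)) (ℚₚ.+-mono-≤ a b)))
      (≈⇒close p (½ ℚ.* ε) (half-pos 0<ε)) (≈⇒close q (½ ℚ.* ε) (half-pos 0<ε)))

    neg-cong : ∀ {x y} → x ≈ᶜ y → -ᶜ x ≈ᶜ -ᶜ y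
    neg-cong {x} {y} p = close⇒≈ (λ ε 0<ε → eventually₁
      (λ k → subst (_≤ ε) (trans (sym (‖⊖‖ (at x k ⊝ at y k))) (cong ‖_‖ (sym (⊖-⊝ (at x k) (at y k))))))
      (≈⇒close p ε 0<ε))

    *-cong : ∀ {x y u v} → x ≈ᶜ y → u ≈ᶜ v → x *ᶜ u ≈ᶜ y *ᶜ v
    *-cong {x} {y} {u} {v} p q = close⇒≈ λ ε 0<ε →
      let B , 0≤B , bu = bounded u
          C , 0≤C , by = bounded y
          0<ε/2 = half-pos 0<ε
          δ , 0<δ , δB = split B (½ ℚ.* ε) 0≤B 0<ε/2
          η , 0<η , ηC = split C (½ ℚ.* ε) 0≤C 0<ε/2
          first = eventually₂ (λ k a b → ℚₚ.≤-trans (‖⊗‖ (at x k ⊝ at y k) (at u k))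
                    (ℚₚ.≤-trans (*-mono (ℚₚ.<⇒≤ 0<δ) 0≤‖ at u k ‖ a b) δB)) (≈⇒close p δ 0<δ) bu
          second = eventually₂ (λ k a b → ℚₚ.≤-trans (‖⊗‖ (at y k) (at u k ⊝ at v k))
                    (ℚₚ.≤-trans (*-mono 0≤C 0≤‖ at u k ⊝ at v k ‖ b a)
                      (subst (_≤ ½ ℚ.* ε) (ℚₚ.*-comm η C) ηC))) (≈⇒close q η 0<η) by
      in eventually₂ (λ k a b → subst₂ _≤_ (cong ‖_‖ (sym (⊗-⊝ (at x k) (at u k) (at y k) (at v k)))) (halves ε)
           (ℚₚ.≤-trans (‖⊕‖ ((at x k ⊝ at y k) ⊗ at u k) (at y k ⊗ (at u k ⊝ at v k))) (ℚₚ.+-mono-≤ a b)))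
           first second

  ℂ-ring : CommutativeRing 0ℓ 0ℓ
  ℂ-ring = record
    { Carrier = ℂ ; _≈_ = _≈ᶜ_ ; _+_ = _+ᶜ_ ; _*_ = _*ᶜ_ ; -_ = -ᶜ_ ; 0# = 0ℂ ; 1# = 1ℂ
    ; isCommutativeRing = isCommutativeRing
    }
    where
    open import Algebra.Structures _≈ᶜ_
    open IsEquivalence ≈-isEquivalence using () renaming (trans to ≈-trans)
    *-comm′ : ∀ z w → z *ᶜ w ≈ᶜ w *ᶜ z
    *-comm′ z w = pointwise⇒≈ (λ k → ⊗-comm (at z k) (at w k))
    +-comm′ : ∀ z w → z +ᶜ w ≈ᶜ w +ᶜ z
    +-comm′ z w = pointwise⇒≈ (λ k → cong₂ _,_ (ℚₚ.+-comm (seq (re z) k) (seq (re w) k)) (ℚₚ.+-comm (seq (im z) k) (seq (im w) k)))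
    identityˡ : ∀ z → 1ℂ *ᶜ z ≈ᶜ z
    identityˡ z = pointwise⇒≈ (λ k → ⊗-identityˡ (at z k))
    +-identityˡ′ : ∀ z → 0ℂ +ᶜ z ≈ᶜ z
    +-identityˡ′ z = pointwise⇒≈ (λ k → cong₂ _,_ (ℚₚ.+-identityˡ (seq (re z) k)) (ℚₚ.+-identityˡ (seq (im z) k)))
    inverseˡ : ∀ z → -ᶜ z +ᶜ z ≈ᶜ 0ℂ
    inverseˡ z = pointwise⇒≈ (λ k → cong₂ _,_ (ℚₚ.+-inverseˡ (seq (re z) k)) (ℚₚ.+-inverseˡ (seq (im z) k)))
    distribˡ′ : ∀ x y z → x *ᶜ (y +ᶜ z) ≈ᶜ x *ᶜ y +ᶜ x *ᶜ z
    distribˡ′ x y z = pointwise⇒≈ (λ k → ⊗-distribˡ (at x k) (at y k) (at z k))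
    isCommutativeRing : IsCommutativeRing _+ᶜ_ _*ᶜ_ -ᶜ_ 0ℂ 1ℂ
    isCommutativeRing = record
      { isRing = record
        { +-isAbelianGroup = record
          { isGroup = record
            { isMonoid = record
              { isSemigroup = record
                { isMagma = record { isEquivalence = ≈-isEquivalence ; ∙-cong = +-cong }
                ; assoc = λ x y z → pointwise⇒≈ (λ k → cong₂ _,_
                    (ℚₚ.+-assoc (seq (re x) k) (seq (re y) k) (seq (re z) k))
                    (ℚₚ.+-assoc (seq (im x) k) (seq (im y) k) (seq (im z) k)))
                }
              ; identity = +-identityˡ′ , λ z → ≈-trans (+-comm′ z 0ℂ) (+-identityˡ′ z)
              }
            ; inverse = inverseˡ , λ z → ≈-trans (+-comm′ z (-ᶜ z)) (inverseˡ z)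
            ; ⁻¹-cong = neg-cong
            }
          ; comm = +-comm′
          }
        ; *-cong = *-cong
        ; *-assoc = λ x y z → pointwise⇒≈ (λ k → ⊗-assoc (at x k) (at y k) (at z k))
        ; *-identity = identityˡ , λ z → ≈-trans (*-comm′ z 1ℂ) (identityˡ z)
        ; distrib = distribˡ′ , λ x y z → ≈-trans (*-comm′ (y +ᶜ z) x)
            (≈-trans (distribˡ′ x y z) (+-cong (*-comm′ x y) (*-comm′ x z)))
        }
      ; *-comm = *-comm′
      }

-- Geometric bounds over ℂ

module ComplexBounds (r : ℚ) (0<r : 0ℚ ℚ.< r) (r<1 : r ℚ.< 1ℚ) where
  open import Data.Rational using (_≤_; _<_)
  open ≡ using (cong; subst)
  open Rationals
  open Powers r 0<r r<1
  open GaussianRationals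
  open ComplexRing
  open CommutativeRing ℂ-ring
  open ℚₚ.≤-Reasoning
  open +-*-Solver using (_:=_; _:+_; _:*_; _:-_; :-_; con) renaming (solve to solveℚ)

  -- The index k of the approximants has a threshold that may depend on m and n; the constant may
  -- not.
  Geo : (ℕ → ℕ → ℕ) → (ℕ → ℕ → Carrier) → Set
  Geo d x = ∃ λ C → 0ℚ ≤ C × ∀ m n → Eventually (λ k → ‖ at (x m n) k ‖ ≤ C ℚ.* r^ (d m n))

  private abstract
    geo-≈ : ∀ {d x y} → (∀ m n → x m n ≈ y m n) → Geo d x → Geo d y
    -- Equal numbers have approximants that are only eventually close; the extra 1 absorbs a
    -- discrepancy of r^(d m n).
    geo-≈ {d} {x} {y} eq (C , 0≤C , b) = C ℚ.+ 1ℚ , +-nonNeg 0≤C 0≤1 , λ m n →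
      let p = r^ (d m n) in
      eventually₂ (λ k u v → begin
          ‖ at (y m n) k ‖                                        ≤⟨ ‖‖-near (at (y m n) k) (at (x m n) k) ⟩
          ‖ at (x m n) k ‖ ℚ.+ ‖ at (y m n) k ⊝ at (x m n) k ‖    ≤⟨ ℚₚ.+-mono-≤ u v ⟩
          C ℚ.* p ℚ.+ p                                           ≡⟨ solveℚ 2 (λ C p → C :* p :+ p := (C :+ con 1ℚ) :* p) ≡.refl C p ⟩
          (C ℚ.+ 1ℚ) ℚ.* p                                        ∎)
        (b m n) (≈⇒close (sym (eq m n)) p (0<r^ (d m n)))

    geo-≤ : ∀ {d e x} → (∀ m n → e m n ℕ.≤ d m n) → Geo d x → Geo e x
    geo-≤ e≤d (C , 0≤C , b) = C , 0≤C , λ m n →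
      eventually₁ (λ k u → ℚₚ.≤-trans u (*-monoˡ C 0≤C (r^-anti (e≤d m n)))) (b m n)

    geo-reindex : ∀ {d x} (f g : ℕ → ℕ → ℕ) → Geo d x →
      Geo (λ m n → d (f m n) (g m n)) (λ m n → x (f m n) (g m n))
    geo-reindex f g (C , 0≤C , b) = C , 0≤C , λ m n → b (f m n) (g m n)

    geo-+ : ∀ {d x y} → Geo d x → Geo d y → Geo d (λ m n → x m n + y m n)
    geo-+ {d} {x} {y} (C , 0≤C , b) (D , 0≤D , c) = C ℚ.+ D , +-nonNeg 0≤C 0≤D , λ m n →
      eventually₂ (λ k u v → ℚₚ.≤-trans (‖⊕‖ (at (x m n) k) (at (y m n) k))
        (subst (‖ at (x m n) k ‖ ℚ.+ ‖ at (y m n) k ‖ ≤_) (≡.sym (ℚₚ.*-distribʳ-+ (r^ (d m n)) C D))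
          (ℚₚ.+-mono-≤ u v))) (b m n) (c m n)

    geo-neg : ∀ {d x} → Geo d x → Geo d (λ m n → - x m n)
    geo-neg {d} {x} (C , 0≤C , b) = C , 0≤C , λ m n →
      eventually₁ (λ k → subst (_≤ C ℚ.* r^ (d m n)) (≡.sym (‖⊖‖ (at (x m n) k)))) (b m n)

    geo-* : ∀ {d e x y} → Geo d x → Geo e y → Geo (λ m n → d m n ℕ.+ e m n) (λ m n → x m n * y m n)
    geo-* {d} {e} {x} {y} (C , 0≤C , b) (D , 0≤D , c) = C ℚ.* D , *-nonNeg 0≤C 0≤D , λ m n →
      eventually₂ (λ k u v → begin
          ‖ at (x m n) k ⊗ at (y m n) k ‖
            ≤⟨ ‖⊗‖ (at (x m n) k) (at (y m n) k) ⟩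
          ‖ at (x m n) k ‖ ℚ.* ‖ at (y m n) k ‖
            ≤⟨ *-mono (*-nonNeg 0≤C (0≤r^ (d m n))) 0≤‖ at (y m n) k ‖ u v ⟩
          (C ℚ.* r^ (d m n)) ℚ.* (D ℚ.* r^ (e m n))
            ≡⟨ solveℚ 4 (λ C p D q → (C :* p) :* (D :* q) := (C :* D) :* (p :* q)) ≡.refl C (r^ (d m n)) D (r^ (e m n)) ⟩
          C ℚ.* D ℚ.* (r^ (d m n) ℚ.* r^ (e m n))
            ≡⟨ cong (C ℚ.* D ℚ.*_) (≡.sym (r^-+ (d m n) (e m n))) ⟩
          C ℚ.* D ℚ.* r^ (d m n ℕ.+ e m n) ∎) (b m n) (c m n)

    geo-0 : ∀ {d} → Geo d (λ _ _ → 0#)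
    geo-0 {d} = 0ℚ , ℚₚ.≤-refl , λ m n → 0 , λ k _ → ℚₚ.≤-reflexive (≡.sym (ℚₚ.*-zeroˡ (r^ (d m n))))

    geo-const : ∀ a → Geo (λ _ _ → 0) (λ _ _ → a)
    geo-const a =
      let B , 0≤B , b = bounded a
      in B , 0≤B , λ _ _ → eventually₁ (λ k → subst (‖ at a k ‖ ≤_) (≡.sym (ℚₚ.*-identityʳ B))) b

    geo-separated : ∀ {x} → Geo (λ _ n → n) (λ _ _ → x) → x ≈ 0#
    geo-separated {x} (C , 0≤C , b) = close⇒≈ λ ε 0<ε →
      let n , C*r^n≤ε = r^-small C ε 0≤C 0<ε
      in eventually₁ (λ k u → ℚₚ.≤-trans (‖⊝‖ (at x k) (at 0# k))
           (subst (_≤ ε) (≡.sym (ℚₚ.+-identityʳ ‖ at x k ‖)) (ℚₚ.≤-trans u C*r^n≤ε))) (b 0 n)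

    -- Since h r^j = r^j - r^(j+1), increments bounded by C′ h r^j add up to C′ times a difference
    -- of powers.
    telescoping : ∀ (e : ℕ) (s : ℕ → Carrier) C′ →
      (∀ n → Eventually (λ k → ‖ at (s (suc n) - s n) k ‖ ≤ C′ ℚ.* h ℚ.* r^ (e ℕ.+ n))) → ∀ d n →
      Eventually (λ i → ‖ at (s (d ℕ.+ n)) i ⊝ at (s n) i ‖ ≤ C′ ℚ.* (r^ (e ℕ.+ n) ℚ.- r^ (e ℕ.+ (d ℕ.+ n))))
    telescoping e s C′ inc zero    n = 0 , λ i _ → ℚₚ.≤-reflexive (≡.trans (‖x⊝x‖≡0 (at (s n) i))
      (solveℚ 2 (λ C p → con 0ℚ := C :* (p :- p)) ≡.refl C′ (r^ (e ℕ.+ n))))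
    telescoping e s C′ inc (suc d) n = eventually₂ (λ i u v → begin
        ‖ at (s (suc d ℕ.+ n)) i ⊝ at (s n) i ‖
          ≤⟨ ‖⊝‖-triangle (at (s (suc d ℕ.+ n)) i) (at (s (d ℕ.+ n)) i) (at (s n) i) ⟩
        ‖ at (s (suc d ℕ.+ n)) i ⊝ at (s (d ℕ.+ n)) i ‖ ℚ.+ ‖ at (s (d ℕ.+ n)) i ⊝ at (s n) i ‖
          ≤⟨ ℚₚ.+-mono-≤ u v ⟩
        C′ ℚ.* h ℚ.* t ℚ.+ C′ ℚ.* (r^ (e ℕ.+ n) ℚ.- t)
          ≡⟨ solveℚ 4 (λ C t r p → C :* (con 1ℚ :- r) :* t :+ C :* (p :- t) := C :* (p :- t :* r)) ≡.refl C′ t r (r^ (e ℕ.+ n)) ⟩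
        C′ ℚ.* (r^ (e ℕ.+ n) ℚ.- t ℚ.* r)
          ≡⟨ cong (λ k → C′ ℚ.* (r^ (e ℕ.+ n) ℚ.- r^ k)) (≡.sym (ℕₚ.+-suc e (d ℕ.+ n))) ⟩
        C′ ℚ.* (r^ (e ℕ.+ n) ℚ.- r^ (e ℕ.+ (suc d ℕ.+ n))) ∎)
      (inc (d ℕ.+ n)) (telescoping e s C′ inc d n)
      where
      t : ℚ
      t = r^ (e ℕ.+ (d ℕ.+ n))

    -- The limit of s is the diagonal k ↦ (s k) at an index past which s k
    -- varies by at most rᵏ.
    complete : ∀ (e : ℕ) (s : ℕ → Carrier) C′ → 0ℚ ≤ C′ →
      (∀ n → Eventually (λ k → ‖ at (s (suc n) - s n) k ‖ ≤ C′ ℚ.* h ℚ.* r^ (e ℕ.+ n))) →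
      ∃ λ l → ∀ n → Eventually (λ k → ‖ at (l - s n) k ‖ ≤ (C′ ℚ.+ 1ℚ ℚ.+ 1ℚ) ℚ.* r^ (e ℕ.+ n))
    complete e s C′ 0≤C′ inc = proj₁ limit , λ n → eventually₁
        (λ k → subst (λ z → ‖ z ⊝ at (s n) k ‖ ≤ D ℚ.* r^ (e ℕ.+ n)) (≡.sym (proj₂ limit k))) (near n)
      where
      D : ℚ
      -- Three contributions separate the limit from s n: C′ from the increments, and 1 each from
      -- the Cauchy moduli of s k and of s n.
      D = C′ ℚ.+ 1ℚ ℚ.+ 1ℚ
      0≤D : 0ℚ ≤ D
      0≤D = +-nonNeg (+-nonNeg 0≤C′ 0≤1) 0≤1
      K : ℕ → ℕ
      K k = proj₁ (at-cauchy (s k) (r^ k) (0<r^ k))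
      l : ℕ → ℚ[i]
      l k = at (s k) (K k)
      L : ℕ → ℕ
      L n = proj₁ (at-cauchy (s n) (r^ (e ℕ.+ n)) (0<r^ (e ℕ.+ n)))
      near-at : ∀ d n → e ℕ.+ n ℕ.≤ d ℕ.+ n → L n ℕ.≤ d ℕ.+ n →
        ‖ l (d ℕ.+ n) ⊝ at (s n) (d ℕ.+ n) ‖ ≤ D ℚ.* r^ (e ℕ.+ n)
      near-at d n e+n≤k L≤k = begin
        ‖ l k ⊝ at (s n) k ‖
          ≤⟨ ‖⊝‖-triangle (l k) (at (s k) i) (at (s n) k) ⟩
        ‖ l k ⊝ at (s k) i ‖ ℚ.+ ‖ at (s k) i ⊝ at (s n) k ‖
          ≤⟨ ℚₚ.+-monoʳ-≤ ‖ l k ⊝ at (s k) i ‖ (‖⊝‖-triangle (at (s k) i) (at (s n) i) (at (s n) k)) ⟩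
        ‖ l k ⊝ at (s k) i ‖ ℚ.+ (‖ at (s k) i ⊝ at (s n) i ‖ ℚ.+ ‖ at (s n) i ⊝ at (s n) k ‖)
          ≤⟨ ℚₚ.+-mono-≤
               (ℚₚ.≤-trans (proj₂ (at-cauchy (s k) (r^ k) (0<r^ k)) (K k) i ℕₚ.≤-refl K≤i) (r^-anti e+n≤k))
               (ℚₚ.+-mono-≤ (ℚₚ.≤-trans (proj₂ tel i T≤i) (*-monoˡ C′ 0≤C′ (a-b≤a p (0≤r^ (e ℕ.+ k)))))
                 (proj₂ (at-cauchy (s n) p (0<r^ (e ℕ.+ n))) i k (ℕₚ.≤-trans L≤k k≤i) L≤k)) ⟩
        p ℚ.+ (C′ ℚ.* p ℚ.+ p)
          ≡⟨ solveℚ 2 (λ C p → p :+ (C :* p :+ p) := (C :+ con 1ℚ :+ con 1ℚ) :* p) ≡.refl C′ p ⟩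
        D ℚ.* p ∎
        where
        k : ℕ
        k = d ℕ.+ n
        p : ℚ
        p = r^ (e ℕ.+ n)
        tel : Eventually (λ i → ‖ at (s k) i ⊝ at (s n) i ‖ ≤ C′ ℚ.* (p ℚ.- r^ (e ℕ.+ k)))
        tel = telescoping e s C′ inc d n
        i : ℕ
        -- An auxiliary index past all thresholds, at which s k and s n can be compared.
        i = (K k ℕ.⊔ k) ℕ.⊔ proj₁ tel
        K⊔k≤i : K k ℕ.⊔ k ℕ.≤ i
        K⊔k≤i = ℕₚ.m≤m⊔n (K k ℕ.⊔ k) (proj₁ tel)
        K≤i : K k ℕ.≤ i
        K≤i = ℕₚ.≤-trans (ℕₚ.m≤m⊔n (K k) k) K⊔k≤i
        k≤i : k ℕ.≤ i
        k≤i = ℕₚ.≤-trans (ℕₚ.m≤n⊔m (K k) k) K⊔k≤i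
        T≤i : proj₁ tel ℕ.≤ i
        T≤i = ℕₚ.m≤n⊔m (K k ℕ.⊔ k) (proj₁ tel)
      near : ∀ n → Eventually (λ k → ‖ l k ⊝ at (s n) k ‖ ≤ D ℚ.* r^ (e ℕ.+ n))
      near n = (e ℕ.+ n) ℕ.⊔ L n , λ k M≤k →
        let e+n≤k = ℕₚ.≤-trans (ℕₚ.m≤m⊔n (e ℕ.+ n) (L n)) M≤k
            L≤k   = ℕₚ.≤-trans (ℕₚ.m≤n⊔m (e ℕ.+ n) (L n)) M≤k
            k≡    = ℕₚ.m∸n+n≡m (ℕₚ.≤-trans (ℕₚ.m≤n+m n e) e+n≤k)
        in subst (λ k → ‖ l k ⊝ at (s n) k ‖ ≤ D ℚ.* r^ (e ℕ.+ n)) k≡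
             (near-at (k ℕ.∸ n) n (subst (e ℕ.+ n ℕ.≤_) (≡.sym k≡) e+n≤k) (subst (L n ℕ.≤_) (≡.sym k≡) L≤k))
      l-cauchy : CauchyModulus l
      l-cauchy ε 0<ε =
        let E = D ℚ.+ 1ℚ ℚ.+ D
            0≤E = +-nonNeg (+-nonNeg 0≤D 0≤1) 0≤D
            n , E*r^n≤ε = r^-small E ε 0≤E 0<ε
            p = r^ (e ℕ.+ n)
            M , close = near n
        in M ℕ.⊔ L n , λ j k j≥ k≥ → begin
          ‖ l j ⊝ l k ‖
            ≤⟨ ‖⊝‖-triangle (l j) (at (s n) j) (l k) ⟩
          ‖ l j ⊝ at (s n) j ‖ ℚ.+ ‖ at (s n) j ⊝ l k ‖
            ≤⟨ ℚₚ.+-monoʳ-≤ ‖ l j ⊝ at (s n) j ‖ (‖⊝‖-triangle (at (s n) j) (at (s n) k) (l k)) ⟩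
          ‖ l j ⊝ at (s n) j ‖ ℚ.+ (‖ at (s n) j ⊝ at (s n) k ‖ ℚ.+ ‖ at (s n) k ⊝ l k ‖)
            ≤⟨ ℚₚ.+-mono-≤ (close j (ℕₚ.≤-trans (ℕₚ.m≤m⊔n M (L n)) j≥))
                 (ℚₚ.+-mono-≤
                   (proj₂ (at-cauchy (s n) p (0<r^ (e ℕ.+ n))) j k
                     (ℕₚ.≤-trans (ℕₚ.m≤n⊔m M (L n)) j≥) (ℕₚ.≤-trans (ℕₚ.m≤n⊔m M (L n)) k≥))
                   (subst (_≤ D ℚ.* p) (‖⊝‖-comm (l k) (at (s n) k))
                     (close k (ℕₚ.≤-trans (ℕₚ.m≤m⊔n M (L n)) k≥)))) ⟩
          D ℚ.* p ℚ.+ (p ℚ.+ D ℚ.* p)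
            ≡⟨ solveℚ 2 (λ D p → D :* p :+ (p :+ D :* p) := (D :+ con 1ℚ :+ D) :* p) ≡.refl D p ⟩
          E ℚ.* p
            ≤⟨ *-monoˡ E 0≤E (r^-anti (ℕₚ.m≤n+m n e)) ⟩
          E ℚ.* r^ n
            ≤⟨ E*r^n≤ε ⟩
          ε ∎
      limit : ∃ λ z → ∀ k → at z k ≡ l k
      limit = assemble l l-cauchy

    geo-complete : ∀ (e : ℕ → ℕ) (s : ℕ → ℕ → Carrier) →
      Geo (λ m n → e m ℕ.+ n) (λ m n → s m (suc n) - s m n) →
      ∃ λ (l : ℕ → Carrier) → Geo (λ m n → e m ℕ.+ n) (λ m n → l m - s m n)
    geo-complete e s (C , 0≤C , b) =
        (λ m → proj₁ (at-m m)) , C′ ℚ.+ 1ℚ ℚ.+ 1ℚ , +-nonNeg (+-nonNeg 0≤C′ 0≤1) 0≤1 , λ m → proj₂ (at-m m)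
      where
      1/h : ∃ λ b → 0ℚ < b × h ℚ.* b ≡ 1ℚ
      1/h = reciprocal h 0<h
      C′ : ℚ
      -- That is C/h, the value of the geometric series C(1 + r + r² + ⋯).
      C′ = C ℚ.* proj₁ 1/h
      0≤C′ : 0ℚ ≤ C′
      0≤C′ = *-nonNeg 0≤C (ℚₚ.<⇒≤ (proj₁ (proj₂ 1/h)))
      C′h≡C : C′ ℚ.* h ≡ C
      C′h≡C = ≡.trans (solveℚ 3 (λ C b h → C :* b :* h := C :* (h :* b)) ≡.refl C (proj₁ 1/h) h)
        (≡.trans (cong (C ℚ.*_) (proj₂ (proj₂ 1/h))) (ℚₚ.*-identityʳ C))
      at-m : ∀ m → ∃ λ l → ∀ n → Eventually (λ k → ‖ at (l - s m n) k ‖ ≤ (C′ ℚ.+ 1ℚ ℚ.+ 1ℚ) ℚ.* r^ (e m ℕ.+ n))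
      at-m m = complete (e m) (s m) C′ 0≤C′ (λ n → eventually₁
        (λ k → subst (λ c → ‖ at (s m (suc n) - s m n) k ‖ ≤ c ℚ.* r^ (e m ℕ.+ n)) (≡.sym C′h≡C)) (b m n))

    geo-recursion : ∀ (e : ℕ → ℕ) {x u σ} →
      Geo (λ m _ → e m) (λ m _ → x m 0) →
      Geo (λ m n → e m ℕ.+ n) u → Geo (λ _ n → n) σ →
      (∀ m n → x m (suc n) ≈ u m n + x m n * σ m n) →
      Geo (λ m n → e m ℕ.+ n) x
    geo-recursion e {x} {u} {σ} (X , 0≤X , x≤) (U , 0≤U , u≤) (S , 0≤S , σ≤) recursion =
      let C , 0≤C , c≤C = affine-bounded ((U ℚ.+ 1ℚ) ℚ.* b) (S ℚ.* b) c
            (*-nonNeg (+-nonNeg 0≤U 0≤1) 0≤b) (*-nonNeg 0≤S 0≤b) 0≤c c-suc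
      in C , 0≤C , λ m n → eventually₁ (λ k v → ℚₚ.≤-trans v (*-monoʳ (r^ (e m ℕ.+ n)) (0≤r^ (e m ℕ.+ n)) (c≤C n))) (bound m n)
      where
      1/r : ∃ λ b → 0ℚ < b × r ℚ.* b ≡ 1ℚ
      1/r = reciprocal r 0<r
      b : ℚ
      b = proj₁ 1/r
      0≤b : 0ℚ ≤ b
      0≤b = ℚₚ.<⇒≤ (proj₁ (proj₂ 1/r))
      c : ℕ → ℚ
      c zero    = X
      -- The bounds are relative to r^(e m + n), so passing to n + 1 costs a factor b = 1/r. The 1
      -- absorbs that the recursion holds only up to ≈.
      c (suc n) = (U ℚ.+ 1ℚ ℚ.+ c n ℚ.* (S ℚ.* r^ n)) ℚ.* b
      0≤c : ∀ n → 0ℚ ≤ c n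
      0≤c zero    = 0≤X
      0≤c (suc n) = *-nonNeg (+-nonNeg (+-nonNeg 0≤U 0≤1) (*-nonNeg (0≤c n) (*-nonNeg 0≤S (0≤r^ n)))) 0≤b
      c-suc : ∀ n → c (suc n) ≤ (U ℚ.+ 1ℚ) ℚ.* b ℚ.+ S ℚ.* b ℚ.* r^ n ℚ.* c n
      c-suc n = ℚₚ.≤-reflexive (solveℚ 5 (λ U c S p b →
        (U :+ con 1ℚ :+ c :* (S :* p)) :* b := (U :+ con 1ℚ) :* b :+ S :* b :* p :* c) ≡.refl U (c n) S (r^ n) b)
      bound : ∀ m n → Eventually (λ k → ‖ at (x m n) k ‖ ≤ c n ℚ.* r^ (e m ℕ.+ n))
      bound m zero    = subst (λ d → Eventually (λ k → ‖ at (x m 0) k ‖ ≤ X ℚ.* r^ d)) (≡.sym (ℕₚ.+-identityʳ (e m))) (x≤ m 0)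
      bound m (suc n) = eventually₂ (λ k v w → begin
          ‖ at (x m (suc n)) k ‖
            ≤⟨ ‖‖-near (at (x m (suc n)) k) (at y k) ⟩
          ‖ at y k ‖ ℚ.+ ‖ at (x m (suc n)) k ⊝ at y k ‖
            ≤⟨ ℚₚ.+-mono-≤ v w ⟩
          (U ℚ.* p ℚ.+ c n ℚ.* p ℚ.* (S ℚ.* r^ n)) ℚ.+ p
            ≡⟨ solveℚ 5 (λ U p c S t → (U :* p :+ c :* p :* (S :* t)) :+ p := (U :+ con 1ℚ :+ c :* (S :* t)) :* p) ≡.refl U p (c n) S (r^ n) ⟩
          (U ℚ.+ 1ℚ ℚ.+ c n ℚ.* (S ℚ.* r^ n)) ℚ.* p
            ≡⟨ ℚₚ.*-identityʳ _ ⟨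
          (U ℚ.+ 1ℚ ℚ.+ c n ℚ.* (S ℚ.* r^ n)) ℚ.* p ℚ.* 1ℚ
            ≡⟨ cong ((U ℚ.+ 1ℚ ℚ.+ c n ℚ.* (S ℚ.* r^ n)) ℚ.* p ℚ.*_) (≡.sym (proj₂ (proj₂ 1/r))) ⟩
          (U ℚ.+ 1ℚ ℚ.+ c n ℚ.* (S ℚ.* r^ n)) ℚ.* p ℚ.* (r ℚ.* b)
            ≡⟨ solveℚ 4 (λ y p r b → y :* p :* (r :* b) := y :* b :* (p :* r)) ≡.refl (U ℚ.+ 1ℚ ℚ.+ c n ℚ.* (S ℚ.* r^ n)) p r b ⟩
          c (suc n) ℚ.* (p ℚ.* r)
            ≡⟨ cong (λ k → c (suc n) ℚ.* r^ k) (≡.sym (ℕₚ.+-suc (e m) n)) ⟩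
          c (suc n) ℚ.* r^ (e m ℕ.+ suc n) ∎)
        (eventually₃ (λ k a b′ c′ → ℚₚ.≤-trans (‖⊕‖ (at (u m n) k) (at (x m n * σ m n) k))
            (ℚₚ.+-mono-≤ a (ℚₚ.≤-trans (‖⊗‖ (at (x m n) k) (at (σ m n) k))
              (*-mono (*-nonNeg (0≤c n) (0≤r^ (e m ℕ.+ n))) 0≤‖ at (σ m n) k ‖ b′ c′))))
          (u≤ m n) (bound m n) (σ≤ m n))
        (≈⇒close (recursion m n) p (0<r^ (e m ℕ.+ n)))
        where
        p : ℚ
        p = r^ (e m ℕ.+ n)
        y : Carrier
        y = u m n + x m n * σ m n

    geo-product : ∀ {x w} → Geo (λ _ n → n) w → (∀ m → x m 0 ≈ 1#) →
      (∀ m n → x m (suc n) ≈ x m n * (1# + w m n)) → Geo (λ _ _ → 0) x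
    geo-product {x} {w} (W , 0≤W , w≤) x0 recursion =
      let C , 0≤C , c≤C = product-bounded (W ℚ.+ 1ℚ) c (+-nonNeg 0≤W 0≤1) (λ n → ℚₚ.≤-trans 0≤1 (1≤c n)) (λ _ → ℚₚ.≤-refl)
      in C , 0≤C , λ m n → eventually₁ (λ k v → ℚₚ.≤-trans v (subst (c n ≤_) (≡.sym (ℚₚ.*-identityʳ C)) (c≤C n))) (bound m n)
      where
      c : ℕ → ℚ
      -- Starting at 2 leaves room for the approximants of `x m 0`. As c n ≥ 1, the error r^n of
      -- each step fits into the enlarged constant W + 1.
      c zero    = 1ℚ ℚ.+ 1ℚ
      c (suc n) = c n ℚ.* (1ℚ ℚ.+ (W ℚ.+ 1ℚ) ℚ.* r^ n)
      1≤c : ∀ n → 1ℚ ≤ c n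
      1≤c zero    = ≤-+ʳ 1ℚ 0≤1
      1≤c (suc n) = *-mono {1ℚ} {c n} {1ℚ} (ℚₚ.≤-trans 0≤1 (1≤c n)) 0≤1 (1≤c n)
        (≤-+ʳ 1ℚ (*-nonNeg (+-nonNeg 0≤W 0≤1) (0≤r^ n)))
      bound : ∀ m n → Eventually (λ k → ‖ at (x m n) k ‖ ≤ c n)
      bound m zero    = eventually₁ (λ k v → ℚₚ.≤-trans (‖‖-near (at (x m 0) k) (at 1# k)) (ℚₚ.+-monoʳ-≤ 1ℚ v))
        (≈⇒close (x0 m) 1ℚ 0<1)
      bound m (suc n) = eventually₃ (λ k a b d → begin
          ‖ at (x m (suc n)) k ‖
            ≤⟨ ‖‖-near (at (x m (suc n)) k) (at y k) ⟩
          ‖ at y k ‖ ℚ.+ ‖ at (x m (suc n)) k ⊝ at y k ‖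
            ≤⟨ ℚₚ.+-mono-≤ (‖⊗‖ (at (x m n) k) (at (1# + w m n) k)) d ⟩
          ‖ at (x m n) k ‖ ℚ.* ‖ at (1# + w m n) k ‖ ℚ.+ t
            ≤⟨ ℚₚ.+-monoˡ-≤ t (*-mono 0≤cn 0≤‖ at (1# + w m n) k ‖ a
                 (ℚₚ.≤-trans (‖⊕‖ (at 1# k) (at (w m n) k)) (ℚₚ.+-monoʳ-≤ 1ℚ b))) ⟩
          c n ℚ.* (1ℚ ℚ.+ W ℚ.* t) ℚ.+ t
            ≤⟨ ℚₚ.+-monoʳ-≤ (c n ℚ.* (1ℚ ℚ.+ W ℚ.* t)) (subst (_≤ c n ℚ.* t) (ℚₚ.*-identityˡ t) (*-monoʳ t (0≤r^ n) (1≤c n))) ⟩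
          c n ℚ.* (1ℚ ℚ.+ W ℚ.* t) ℚ.+ c n ℚ.* t
            ≡⟨ solveℚ 3 (λ c W t → c :* (con 1ℚ :+ W :* t) :+ c :* t := c :* (con 1ℚ :+ (W :+ con 1ℚ) :* t)) ≡.refl (c n) W t ⟩
          c (suc n) ∎)
        (bound m n) (w≤ m n) (≈⇒close (recursion m n) t (0<r^ n))
        where
        t : ℚ
        t = r^ n
        0≤cn : 0ℚ ≤ c n
        0≤cn = ℚₚ.≤-trans 0≤1 (1≤c n)
        y : Carrier
        y = x m n * (1# + w m n)

  ℂ-bounds : GeometricBounds ℂ-ring
  ℂ-bounds = record
    { Geo = Geo
    ; geo-≈ = λ {d} {x} {y} → geo-≈ {d} {x} {y}
    ; geo-≤ = λ {d} {e} {x} → geo-≤ {d} {e} {x}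
    ; geo-reindex = λ {d} {x} → geo-reindex {d} {x}
    ; geo-+ = λ {d} {x} {y} → geo-+ {d} {x} {y}
    ; geo-neg = λ {d} {x} → geo-neg {d} {x}
    ; geo-* = λ {d} {e} {x} {y} → geo-* {d} {e} {x} {y}
    ; geo-0 = λ {d} → geo-0 {d}
    ; geo-const = geo-const
    ; geo-separated = geo-separated
    ; geo-complete = geo-complete
    ; geo-recursion = λ e {x} {u} {σ} → geo-recursion e {x} {u} {σ}
    ; geo-product = λ {x} {w} → geo-product {x} {w}
    }

-- Modulus, apartness and cancellation in ℂ

module Modulus where
  open Defs using (ℂ; _#0; ∣_∣<_) renaming (_⟶_ to _⟶ᶜ_)
  open import Data.Rational using (∣_∣; _≤_; _<_)
  open ≡ using (cong; cong₂; subst)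
  open Rationals
  open GaussianRationals
  open ComplexRing
  open CommutativeRing ℂ-ring
  open ℚₚ.≤-Reasoning
  open +-*-Solver using (_:=_; _:+_; _:*_; _:-_; :-_; con) renaming (solve to solveℚ)

  sq : ℚ[i] → ℚ
  sq (a , b) = a ℚ.* a ℚ.+ b ℚ.* b

  private abstract
    ∣a∣²≡a² : ∀ a → ∣ a ∣ ℚ.* ∣ a ∣ ≡ a ℚ.* a
    ∣a∣²≡a² a with ℚₚ.∣p∣≡p∨∣p∣≡-p a
    ... | inj₁ eq = cong₂ ℚ._*_ eq eq
    ... | inj₂ eq = ≡.trans (cong₂ ℚ._*_ eq eq) (solveℚ 1 (λ a → (:- a) :* (:- a) := a :* a) ≡.refl a)

    0≤a² : ∀ a → 0ℚ ≤ a ℚ.* a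
    0≤a² a = subst (0ℚ ≤_) (∣a∣²≡a² a) (*-nonNeg (ℚₚ.0≤∣p∣ a) (ℚₚ.0≤∣p∣ a))

    sq≤‖‖² : ∀ x → sq x ≤ ‖ x ‖ ℚ.* ‖ x ‖
    sq≤‖‖² (a , b) = begin
      a ℚ.* a ℚ.+ b ℚ.* b
        ≡⟨ cong₂ ℚ._+_ (≡.sym (∣a∣²≡a² a)) (≡.sym (∣a∣²≡a² b)) ⟩
      ∣ a ∣ ℚ.* ∣ a ∣ ℚ.+ ∣ b ∣ ℚ.* ∣ b ∣
        ≤⟨ ≤-+ʳ (∣ a ∣ ℚ.* ∣ a ∣ ℚ.+ ∣ b ∣ ℚ.* ∣ b ∣) (+-nonNeg ab ab) ⟩
      ∣ a ∣ ℚ.* ∣ a ∣ ℚ.+ ∣ b ∣ ℚ.* ∣ b ∣ ℚ.+ (∣ a ∣ ℚ.* ∣ b ∣ ℚ.+ ∣ a ∣ ℚ.* ∣ b ∣)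
        ≡⟨ solveℚ 2 (λ a b → a :* a :+ b :* b :+ (a :* b :+ a :* b) := (a :+ b) :* (a :+ b)) ≡.refl (∣ a ∣) (∣ b ∣) ⟩
      (∣ a ∣ ℚ.+ ∣ b ∣) ℚ.* (∣ a ∣ ℚ.+ ∣ b ∣) ∎
      where
      ab : 0ℚ ≤ ∣ a ∣ ℚ.* ∣ b ∣
      ab = *-nonNeg (ℚₚ.0≤∣p∣ a) (ℚₚ.0≤∣p∣ b)

    ½‖‖²≤sq : ∀ x → ½ ℚ.* (‖ x ‖ ℚ.* ‖ x ‖) ≤ sq x
    ½‖‖²≤sq (a , b) = begin
      ½ ℚ.* (‖ a , b ‖ ℚ.* ‖ a , b ‖)
        ≤⟨ ≤-+ʳ _ (*-nonNeg (ℚₚ.<⇒≤ 0<½) (0≤a² (∣ a ∣ ℚ.- ∣ b ∣))) ⟩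
      ½ ℚ.* (‖ a , b ‖ ℚ.* ‖ a , b ‖) ℚ.+ ½ ℚ.* ((∣ a ∣ ℚ.- ∣ b ∣) ℚ.* (∣ a ∣ ℚ.- ∣ b ∣))
        ≡⟨ solveℚ 2 (λ a b → con ½ :* ((a :+ b) :* (a :+ b)) :+ con ½ :* ((a :- b) :* (a :- b))
             := a :* a :+ b :* b) ≡.refl (∣ a ∣) (∣ b ∣) ⟩
      ∣ a ∣ ℚ.* ∣ a ∣ ℚ.+ ∣ b ∣ ℚ.* ∣ b ∣
        ≡⟨ cong₂ ℚ._+_ (∣a∣²≡a² a) (∣a∣²≡a² b) ⟩
      a ℚ.* a ℚ.+ b ℚ.* b ∎

    a²≤b²⇒∣a∣≤b : ∀ a b → 0ℚ ≤ b → a ℚ.* a ≤ b ℚ.* b → ∣ a ∣ ≤ b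
    a²≤b²⇒∣a∣≤b a b 0≤b a²≤b² = ℚₚ.≮⇒≥ λ b<∣a∣ → ℚₚ.<-irrefl ≡.refl (begin-strict
      b ℚ.* b           ≤⟨ *-monoʳ b 0≤b (ℚₚ.<⇒≤ b<∣a∣) ⟩
      ∣ a ∣ ℚ.* b       <⟨ ℚₚ.*-monoʳ-<-pos (∣ a ∣) {{ℚ.positive (ℚₚ.≤-<-trans 0≤b b<∣a∣)}} b<∣a∣ ⟩
      ∣ a ∣ ℚ.* ∣ a ∣   ≡⟨ ∣a∣²≡a² a ⟩
      a ℚ.* a           ≤⟨ a²≤b² ⟩
      b ℚ.* b           ∎)

    sq-⊗ : ∀ x y → sq (x ⊗ y) ≡ sq x ℚ.* sq y
    sq-⊗ (a , b) (c , d) = solveℚ 4 (λ a b c d →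
      (a :* c :+ :- (b :* d)) :* (a :* c :+ :- (b :* d)) :+ (a :* d :+ b :* c) :* (a :* d :+ b :* c)
      := (a :* a :+ b :* b) :* (c :* c :+ d :* d)) ≡.refl a b c d

    sq-⊖ : ∀ x → sq (⊖ x) ≡ sq x
    sq-⊖ (a , b) = solveℚ 2 (λ a b → (:- a) :* (:- a) :+ (:- b) :* (:- b) := a :* a :+ b :* b) ≡.refl a b

    0≤sq : ∀ x → 0ℚ ≤ sq x
    0≤sq (a , b) = +-nonNeg (0≤a² a) (0≤a² b)

    ‖‖≤2√sq : ∀ x b → 0ℚ ≤ b → sq x ≤ b ℚ.* b → ‖ x ‖ ≤ b ℚ.+ b
    ‖‖≤2√sq (a , c) b 0≤b h = ℚₚ.+-mono-≤
      (a²≤b²⇒∣a∣≤b a b 0≤b (ℚₚ.≤-trans (≤-+ʳ (a ℚ.* a) (0≤a² c)) h))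
      (a²≤b²⇒∣a∣≤b c b 0≤b (ℚₚ.≤-trans (≤-+ˡ (c ℚ.* c) (0≤a² a)) h))

  abstract
    away⇒#0 : ∀ {z} c → 0ℚ < c → Eventually (λ k → c ≤ ‖ at z k ‖) → z #0
    away⇒#0 {z} c 0<c e = ½ ℚ.* (½ ℚ.* (c ℚ.* c)) , *-pos 0<½ 0<ε , eventually₁ (λ k c≤ → begin-strict
        0ℚ ℚ.+ ½ ℚ.* (½ ℚ.* (c ℚ.* c))              ≡⟨ ℚₚ.+-identityˡ _ ⟩
        ½ ℚ.* (½ ℚ.* (c ℚ.* c))                     <⟨ half< 0<ε ⟩
        ½ ℚ.* (c ℚ.* c)                             ≤⟨ *-monoˡ ½ (ℚₚ.<⇒≤ 0<½) (*-mono 0≤‖ at z k ‖ (ℚₚ.<⇒≤ 0<c) c≤ c≤) ⟩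
        ½ ℚ.* (‖ at z k ‖ ℚ.* ‖ at z k ‖)           ≤⟨ ½‖‖²≤sq (at z k) ⟩
        sq (at z k)                                 ∎) e
      where
      0<ε : 0ℚ < ½ ℚ.* (c ℚ.* c)
      0<ε = *-pos 0<½ (*-pos 0<c 0<c)

    -- If u is bounded by B and ‖z‖ fell below c with c B ≤ ½, then z u could not be near 1.
    unit⇒#0 : ∀ {z} u → z * u ≈ 1# → z #0
    unit⇒#0 {z} u zu≈1 =
      let B , 0≤B , u≤B = bounded u
          c , 0<c , cB≤½ = split B ½ 0≤B 0<½
      in away⇒#0 {z} c 0<c (eventually₂ (λ k u≤B near → ℚₚ.≮⇒≥ λ z<c → ℚₚ.<-irrefl ≡.refl (begin-strict
           1ℚ                                                   ≤⟨ ‖‖-near (at 1# k) (at (z * u) k) ⟩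
           ‖ at (z * u) k ‖ ℚ.+ ‖ at 1# k ⊝ at (z * u) k ‖      ≤⟨ ℚₚ.+-mono-≤ (ℚₚ.≤-trans (‖⊗‖ (at z k) (at u k))
                                                                     (ℚₚ.≤-trans (*-mono (ℚₚ.<⇒≤ 0<c) 0≤‖ at u k ‖ (ℚₚ.<⇒≤ z<c) u≤B) cB≤½)) near ⟩
           ½ ℚ.+ ½ ℚ.* ½                                        <⟨ ℚₚ.+-monoʳ-< ½ (half< 0<½) ⟩
           1ℚ                                                   ∎))
         u≤B (≈⇒close (sym zu≈1) (½ ℚ.* ½) (half-pos 0<½)))

    -- Multiplying by the conjugate recovers y from x y up to the factor ∣x∣², without a division.
    conj-⊗ : ∀ x y → ‖ (proj₁ x , ℚ.- proj₂ x) ⊗ (x ⊗ y) ‖ ≡ sq x ℚ.* ‖ y ‖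
    conj-⊗ x@(a , b) (c , d) = ≡.trans (cong₂ (λ u v → ∣ u ∣ ℚ.+ ∣ v ∣)
        (solveℚ 4 (λ a b c d → a :* (a :* c :+ :- (b :* d)) :+ :- ((:- b) :* (a :* d :+ b :* c))
          := (a :* a :+ b :* b) :* c) ≡.refl a b c d)
        (solveℚ 4 (λ a b c d → a :* (a :* d :+ b :* c) :+ (:- b) :* (a :* c :+ :- (b :* d))
          := (a :* a :+ b :* b) :* d) ≡.refl a b c d))
      (≡.trans (cong₂ ℚ._+_ (scale c) (scale d)) (≡.sym (ℚₚ.*-distribˡ-+ (sq x) (∣ c ∣) (∣ d ∣))))
      where
      scale : ∀ c → ∣ sq x ℚ.* c ∣ ≡ sq x ℚ.* ∣ c ∣
      scale c = ≡.trans (ℚₚ.∣p*q∣≡∣p∣*∣q∣ (sq x) c) (cong (ℚ._* ∣ c ∣) (ℚₚ.0≤p⇒∣p∣≡p (0≤sq x)))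

    #0-cancel : ∀ {z w} → z #0 → z * w ≈ 0# → w ≈ 0#
    #0-cancel {z} {w} (ε , 0<ε , z#0) zw≈0 = close⇒≈ λ η 0<η →
      let B , 0≤B , z≤B = bounded z
          δ , 0<δ , δB≤ = split B (ε ℚ.* η) 0≤B (*-pos 0<ε 0<η)
      in eventually₃ (λ k ε≤ z≤ zw≤ → ℚₚ.≤-trans
           (ℚₚ.≤-trans (‖⊝‖ (at w k) (at 0# k)) (ℚₚ.≤-reflexive (ℚₚ.+-identityʳ ‖ at w k ‖)))
           (ℚₚ.*-cancelˡ-≤-pos ε {{ℚ.positive 0<ε}} (begin
             ε ℚ.* ‖ at w k ‖
               ≤⟨ *-monoʳ ‖ at w k ‖ 0≤‖ at w k ‖ (ℚₚ.<⇒≤ (subst (_< sq (at z k)) (ℚₚ.+-identityˡ ε) ε≤)) ⟩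
             sq (at z k) ℚ.* ‖ at w k ‖
               ≡⟨ ≡.sym (conj-⊗ (at z k) (at w k)) ⟩
             ‖ conj k ⊗ at (z * w) k ‖
               ≤⟨ ‖⊗‖ (conj k) (at (z * w) k) ⟩
             ‖ conj k ‖ ℚ.* ‖ at (z * w) k ‖
               ≡⟨ cong (λ t → (∣ seq′ k ∣ ℚ.+ t) ℚ.* ‖ at (z * w) k ‖) (ℚₚ.∣-p∣≡∣p∣ (proj₂ (at z k))) ⟩
             ‖ at z k ‖ ℚ.* ‖ at (z * w) k ‖
               ≤⟨ *-mono 0≤B 0≤‖ at (z * w) k ‖ z≤ (ℚₚ.≤-trans (‖‖-near (at (z * w) k) (at 0# k))
                    (ℚₚ.≤-trans (ℚₚ.≤-reflexive (ℚₚ.+-identityˡ _)) zw≤)) ⟩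
             B ℚ.* δ
               ≡⟨ ℚₚ.*-comm B δ ⟩
             δ ℚ.* B
               ≤⟨ δB≤ ⟩
             ε ℚ.* η ∎)))
         z#0 z≤B (≈⇒close zw≈0 δ 0<δ)
      where
      seq′ : ℕ → ℚ
      seq′ k = proj₁ (at z k)
      conj : ℕ → ℚ[i]
      conj k = proj₁ (at z k) , ℚ.- proj₂ (at z k)

    -- For each ε one rational approximant decides. If its norm is at most ε/2, z stays within ε of
    -- 0; otherwise z stays at least ε/4 away from 0, against the hypothesis.
    ¬#0⇒≈0 : ∀ {z} → ¬ (z #0) → z ≈ 0#
    ¬#0⇒≈0 {z} ¬z#0 = close⇒≈ λ ε 0<ε → case ε 0<ε (at-cauchy z (½ ℚ.* (½ ℚ.* ε)) (half-pos (half-pos 0<ε)))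
      where
      case : ∀ ε → 0ℚ < ε →
        (∃ λ K → ∀ j k → K ℕ.≤ j → K ℕ.≤ k → ‖ at z j ⊝ at z k ‖ ≤ ½ ℚ.* (½ ℚ.* ε)) →
        Eventually (λ k → ‖ at z k ⊝ at 0# k ‖ ≤ ε)
      case ε 0<ε (K , near) with ‖ at z K ‖ ℚₚ.≤? ½ ℚ.* ε
      ... | yes small = K , λ k K≤k → begin
        ‖ at z k ⊝ at 0# k ‖                      ≤⟨ ‖⊝‖ (at z k) (at 0# k) ⟩
        ‖ at z k ‖ ℚ.+ 0ℚ                         ≡⟨ ℚₚ.+-identityʳ ‖ at z k ‖ ⟩
        ‖ at z k ‖                                ≤⟨ ‖‖-near (at z k) (at z K) ⟩
        ‖ at z K ‖ ℚ.+ ‖ at z k ⊝ at z K ‖        ≤⟨ ℚₚ.+-mono-≤ small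
                                                       (ℚₚ.≤-trans (near k K K≤k ℕₚ.≤-refl) (ℚₚ.<⇒≤ (half< (half-pos 0<ε)))) ⟩
        ½ ℚ.* ε ℚ.+ ½ ℚ.* ε                       ≡⟨ halves ε ⟩
        ε                                         ∎
      ... | no large = ⊥-elim (¬z#0 (away⇒#0 {z} e (half-pos (half-pos 0<ε)) (K , λ k K≤k →
        ℚₚ.≮⇒≥ λ z<e → large (begin
          ‖ at z K ‖                                ≤⟨ ‖‖-near (at z K) (at z k) ⟩
          ‖ at z k ‖ ℚ.+ ‖ at z K ⊝ at z k ‖        ≤⟨ ℚₚ.+-mono-≤ (ℚₚ.<⇒≤ z<e) (near K k ℕₚ.≤-refl K≤k) ⟩
          e ℚ.+ e                                   ≡⟨ halves (½ ℚ.* ε) ⟩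
          ½ ℚ.* ε                                   ∎))))
        where
        e : ℚ
        e = ½ ℚ.* (½ ℚ.* ε)

    ∣∣<1⇒ratio : ∀ q → ∣ q ∣< 1ℚ → ∃ λ r → 0ℚ < r × r < 1ℚ × Eventually (λ k → sq (at q k) ≤ r ℚ.* r)
    ∣∣<1⇒ratio q (ε , 0<ε , K , gap) = r
      , positive (gap K ℕₚ.≤-refl)
      , subst (r <_) (ℚₚ.+-identityʳ 1ℚ) (ℚₚ.+-monoʳ-< 1ℚ (ℚₚ.neg-antimono-< 0<½ε))
      , K , λ k K≤k → bound k (gap k K≤k)
      where
      r : ℚ
      -- As (1 - ε/2)² ≥ 1 - ε, the gap ε below 1 in the squared modulus yields a ratio without a
      -- square root.
      r = 1ℚ ℚ.- ½ ℚ.* ε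
      0<½ε : 0ℚ < ½ ℚ.* ε
      0<½ε = half-pos 0<ε
      positive : sq (at q K) ℚ.+ ε < 1ℚ ℚ.* 1ℚ → 0ℚ < r
      positive lt = subst (_< r) (ℚₚ.+-inverseʳ (½ ℚ.* ε)) (ℚₚ.+-monoˡ-< (ℚ.- (½ ℚ.* ε))
        (ℚₚ.<-trans (half< 0<ε) (ℚₚ.≤-<-trans (≤-+ˡ ε (0≤sq (at q K))) lt)))
      bound : ∀ k → sq (at q k) ℚ.+ ε < 1ℚ ℚ.* 1ℚ → sq (at q k) ≤ r ℚ.* r
      bound k lt = begin
        sq (at q k)                                                  ≡⟨ solveℚ 2 (λ s e → s := s :+ e :- e) ≡.refl (sq (at q k)) ε ⟩
        sq (at q k) ℚ.+ ε ℚ.- ε                                      ≤⟨ ℚₚ.+-monoˡ-≤ (ℚ.- ε) (ℚₚ.<⇒≤ lt) ⟩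
        1ℚ ℚ.* 1ℚ ℚ.- ε                                              ≤⟨ ≤-+ʳ _ (0≤a² (½ ℚ.* ε)) ⟩
        1ℚ ℚ.* 1ℚ ℚ.- ε ℚ.+ ½ ℚ.* ε ℚ.* (½ ℚ.* ε)                    ≡⟨ solveℚ 1 (λ e → con 1ℚ :* con 1ℚ :- e :+ con ½ :* e :* (con ½ :* e)
                                                                          := (con 1ℚ :- con ½ :* e) :* (con 1ℚ :- con ½ :* e)) ≡.refl ε ⟩
        r ℚ.* r                                                      ∎

    sq-neg : ∀ {q r} → Eventually (λ k → sq (at q k) ≤ r) → Eventually (λ k → sq (at (- q) k) ≤ r)
    sq-neg {q} {r} = eventually₁ (λ k → subst (_≤ r) (≡.sym (sq-⊖ (at q k))))

  module _ (r : ℚ) (0<r : 0ℚ < r) (r<1 : r < 1ℚ) where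
    open ComplexBounds r 0<r r<1
    open Powers r 0<r r<1
    open Limits ℂ-ring ℂ-bounds using (Small; _⟶_; _^_)

    abstract
      -- The norm ‖q‖ can exceed 1 although ∣q∣ < 1. The multiplicative `sq` therefore carries the
      -- powers, and the comparison with the norm comes last, at the cost of a factor 2.
      powers-small : ∀ {q} → Eventually (λ k → sq (at q k) ≤ r ℚ.* r) → Small (λ _ n → q ^ n)
      powers-small {q} (K , q≤) = 1ℚ ℚ.+ 1ℚ , +-nonNeg 0≤1 0≤1 , λ _ n → K , λ k K≤k →
        subst (‖ at (q ^ n) k ‖ ≤_) (solveℚ 1 (λ p → p :+ p := (con 1ℚ :+ con 1ℚ) :* p) ≡.refl (r^ n))
          (‖‖≤2√sq (at (q ^ n) k) (r^ n) (0≤r^ n) (bound n k K≤k))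
        where
        bound : ∀ n k → K ℕ.≤ k → sq (at (q ^ n) k) ≤ r^ n ℚ.* r^ n
        bound zero    k K≤k = ℚₚ.≤-refl
        bound (suc n) k K≤k = begin
          sq (at (q ^ n) k ⊗ at q k)               ≡⟨ sq-⊗ (at (q ^ n) k) (at q k) ⟩
          sq (at (q ^ n) k) ℚ.* sq (at q k)        ≤⟨ *-mono (*-nonNeg (0≤r^ n) (0≤r^ n)) (0≤sq (at q k)) (bound n k K≤k) (q≤ k K≤k) ⟩
          r^ n ℚ.* r^ n ℚ.* (r ℚ.* r)              ≡⟨ solveℚ 2 (λ p r → p :* p :* (r :* r) := p :* r :* (p :* r)) ≡.refl (r^ n) r ⟩
          r^ (suc n) ℚ.* r^ (suc n)                ∎

      ⟶⇒⟶ᶜ : ∀ {s l} → s ⟶ l → s ⟶ᶜ l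
      ⟶⇒⟶ᶜ {s} {l} (C , 0≤C , s-l≤) ε 0<ε =
        -- One δ² bounds the squared modulus and a second one is the gap that the strict inequality
        -- demands; together they make ε²/2 < ε².
        let δ = ½ ℚ.* ε
            0<δ = half-pos 0<ε
            N , Cr^N≤δ = r^-small C δ 0≤C 0<δ
        in N , λ n N≤n → δ ℚ.* δ , *-pos 0<δ 0<δ , eventually₁ (λ k u →
          let ‖‖≤δ = ℚₚ.≤-trans u (ℚₚ.≤-trans (*-monoˡ C 0≤C (r^-anti N≤n)) Cr^N≤δ)
              0≤‖‖ = 0≤‖ at (s n - l) k ‖
          in begin-strict
            sq (at (s n - l) k) ℚ.+ δ ℚ.* δ
              ≤⟨ ℚₚ.+-monoˡ-≤ (δ ℚ.* δ) (ℚₚ.≤-trans (sq≤‖‖² (at (s n - l) k)) (*-mono (ℚₚ.<⇒≤ 0<δ) 0≤‖‖ ‖‖≤δ ‖‖≤δ)) ⟩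
            δ ℚ.* δ ℚ.+ δ ℚ.* δ
              ≡⟨ solveℚ 1 (λ e → con ½ :* e :* (con ½ :* e) :+ con ½ :* e :* (con ½ :* e) := con ½ :* (e :* e)) ≡.refl ε ⟩
            ½ ℚ.* (ε ℚ.* ε)
              <⟨ half< (*-pos 0<ε 0<ε) ⟩
            ε ℚ.* ε ∎) (s-l≤ 0 n)

-- Transfer to the identities as stated

module Conclusion (ω q : Defs.ℂ) (ω-primitive : Defs.IsPrimitiveRoot 3 ω)
  (r : ℚ) (0<r : 0ℚ ℚ.< r) (r<1 : r ℚ.< 1ℚ)
  (q≤r : ComplexRing.Eventually (λ k → Modulus.sq (ComplexRing.at q k) ℚ.≤ r ℚ.* r)) where
  open Defs using (ℂ; _+i_; fromℚ; Partialℂ; ↑_; _·_; _÷_; ∑∞; ⟨_⨟_⟩_; ⟨_⨟_⟩∞; J; J₂; _≋_)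
  open ≡ using (cong; cong₂)
  open ComplexRing using (ℂ-ring; pointwise⇒≈)
  open ComplexBounds r 0<r r<1 using (ℂ-bounds)
  open Modulus
  open Products ℂ-ring ℂ-bounds
  open Pochhammer ℂ-ring ℂ-bounds

  ω≉1 : ¬ (ω - 1# ≈ 0#)
  ω≉1 ω-1≈0 = proj₂ ω-primitive 1 (ℕ.s≤s ℕ.z≤n) (ℕ.s≤s (ℕ.s≤s ℕ.z≤n)) (begin
    1# * ω           ≈⟨ solve 1 (λ ω → :1 :* ω := (ω :- :1) :+ :1) refl ω ⟩
    (ω - 1#) + 1#    ≈⟨ +-congʳ ω-1≈0 ⟩
    0# + 1#          ≈⟨ +-identityˡ 1# ⟩
    1#               ∎)

  abstract
    -- That ω ≠ 1 is a mere negation, which does not allow ω - 1 to be cancelled from ω³ - 1 = 0.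
    -- Instead, if 1 + ω + ω² were apart from 0 it could be cancelled, giving ω = 1.
    ω-relation : 1# + ω + ω * ω ≈ 0#
    ω-relation = ¬#0⇒≈0 {1# + ω + ω * ω} λ T#0 → ω≉1 (#0-cancel {1# + ω + ω * ω} {ω - 1#} T#0 (begin
      (1# + ω + ω * ω) * (ω - 1#)    ≈⟨ solve 1 (λ ω → (:1 :+ ω :+ ω :* ω) :* (ω :- :1) := :1 :* ω :* ω :* ω :- :1) refl ω ⟩
      1# * ω * ω * ω - 1#            ≈⟨ +-congʳ (proj₁ ω-primitive) ⟩
      1# - 1#                        ≈⟨ -‿inverseʳ 1# ⟩
      0#                             ∎))

    base-q : Base q
    base-q = powers-small r 0<r r<1 {q} q≤r
    base-Q : Base (- q)
    base-Q = powers-small r 0<r r<1 { - q} (sq-neg {q} {r ℚ.* r} q≤r)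

    half : (fromℚ ½ +i fromℚ 0ℚ) + (fromℚ ½ +i fromℚ 0ℚ) ≈ 1#
    half = pointwise⇒≈ (λ _ → ≡.refl)

  open Values ℂ-ring ℂ-bounds q ω base-q base-Q ω-relation (fromℚ ½ +i fromℚ 0ℚ) half using
    ( Σ₁; Σ₂; y₃; y₄; x₁; x₅; x₇; x₁₁; x₁₂; y₃⟶; y₄⟶; x₁⟶; x₅⟶; x₇⟶; x₁₁⟶; x₁₂⟶
    ; Σ₁-value; Σ₂-value; unit; first⟶; second⟶; power; power≡; numerator₁≡; denominator₁≡; numerator₂≡; denominator≡
    ; numerator₁; denominator₁; inverse₁; inverse₁-correct
    ; numerator₂; denominator; inverse; inverse-correct)

  abstract
    -- q may fail to be decidably nonzero, but Δ ≈ 0 is stable.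
    cancel : ∀ Δ → q * Δ ≈ 0# → (q ≈ 0# → Δ ≈ 0#) → Δ ≈ 0#
    cancel Δ qΔ≈0 degenerate = ¬#0⇒≈0 {Δ} λ Δ#0 → ω≉1 (#0-cancel {Δ} {ω - 1#} Δ#0 (begin
      Δ * (ω - 1#)     ≈⟨ *-congʳ (degenerate (#0-cancel {Δ} {q} Δ#0 (trans (*-comm Δ q) qΔ≈0))) ⟩
      0# * (ω - 1#)    ≈⟨ zeroˡ (ω - 1#) ⟩
      0#               ∎))

  -- The operations over an abstract ring and those of the statement are separate recursive
  -- definitions, equal by induction and not by conversion.
  ^-agrees : ∀ z n → z ^ n ≡ z Defs.^ n
  ^-agrees z zero    = ≡.refl
  ^-agrees z (suc n) = cong (_* z) (^-agrees z n)

  ∑-agrees : ∀ n f → ∑< n f ≡ Defs.∑< n f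
  ∑-agrees zero    f = ≡.refl
  ∑-agrees (suc n) f = cong (_+ f n) (∑-agrees n f)

  poch-agrees : ∀ {a b p r} → a ≡ b → p ≡ r → ∀ n → poch a p n ≡ ⟨ b ⨟ r ⟩ n
  poch-agrees         ≡.refl ≡.refl zero    = ≡.refl
  poch-agrees {a} {p = p} ≡.refl ≡.refl (suc n) =
    cong₂ (λ x y → x * (1# - a * y)) (poch-agrees {a} ≡.refl ≡.refl n) (^-agrees p n)

  product-value : ∀ {a b p r w} → a ≡ b → p ≡ r → poch a p ⟶ w → ⟨ b ⨟ r ⟩∞ w
  product-value {a} {b} {p} {r = s} {w} a≡b p≡s l = ⟶⇒⟶ᶜ r 0<r r<1 {⟨ b ⨟ s ⟩_} {w}
    (⟶-seq {poch a p} {⟨ b ⨟ s ⟩_} {w} (λ n → reflexive (poch-agrees a≡b p≡s n)) l)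

  sum-value : ∀ {t σ} {T : ℕ → Partialℂ} → (∀ n → T n (t n)) → (λ n → ∑< n t) ⟶ σ → ∑∞ T σ
  sum-value {t} {σ} Tt t⟶σ = t , Tt , ⟶⇒⟶ᶜ r 0<r r<1 {λ n → Defs.∑< n t} {σ}
    (⟶-seq {λ n → ∑< n t} {λ n → Defs.∑< n t} {σ} (λ n → reflexive (∑-agrees n t)) t⟶σ)

  quotient-value : ∀ {X Y : Partialℂ} {x y w} → X x → Y y → (∃ λ u → y * u ≈ 1#) → w * y ≈ x → (X ÷ Y) w
  quotient-value {x = x} {y} Xx Yy (u , yu≈1) wy≈x = x , y , Xx , Yy , unit⇒#0 {y} u yu≈1 , wy≈x

  summand-value : ∀ {a b c a′ b′ c′} u → b * u ≈ 1# → a ≡ a′ → b ≡ b′ → c ≡ c′ →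
    (↑ a′ ÷ ↑ b′ · ↑ c′) (a * u * c)
  summand-value {a} {b} {c} u bu≈1 ≡.refl ≡.refl ≡.refl =
    a * u , c , quotient-value {↑ a} {↑ b} {a} {b} {a * u} (refl {a}) (refl {b}) (u , bu≈1) aub≈a , refl {c} , refl {a * u * c}
    where
    aub≈a : a * u * b ≈ a
    aub≈a = begin
      a * u * b      ≈⟨ *-assoc a u b ⟩
      a * (u * b)    ≈⟨ *-congˡ (*-comm u b) ⟩
      a * (b * u)    ≈⟨ *-congˡ bu≈1 ⟩
      a * 1#         ≈⟨ *-identityʳ a ⟩
      a              ∎

  product-value₂ : ∀ {X Y : Partialℂ} {x y} → X x → Y y → (X · Y) (x * y)
  product-value₂ {x = x} {y} Xx Yy = x , y , Xx , Yy , refl {x * y}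

  power-product-value : ∀ a m {w} → poch (q ^ a) (q ^ m) ⟶ w → ⟨ q Defs.^ a ⨟ q Defs.^ m ⟩∞ w
  power-product-value a m {w} = product-value {q ^ a} {q Defs.^ a} {q ^ m} {q Defs.^ m} {w} (^-agrees q a) (^-agrees q m)

  ω-product-value : ∀ a m {w} → poch (ω * q ^ a) (q ^ m) ⟶ w → ⟨ ω Defs.* q Defs.^ a ⨟ q Defs.^ m ⟩∞ w
  ω-product-value a m {w} = product-value {ω * q ^ a} {ω Defs.* q Defs.^ a} {q ^ m} {q Defs.^ m} {w}
    (cong (ω *_) (^-agrees q a)) (^-agrees q m)

  denominator-value : ∀ k a m → k ≡ 3 → a ≡ 2 → m ≡ 4 → (J k q · ⟨ ω Defs.* q Defs.^ a ⨟ q Defs.^ m ⟩∞) (y₃ * y₄)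
  denominator-value k a m k≡ a≡ m≡ = product-value₂ {J k q} {⟨ ω Defs.* q Defs.^ a ⨟ q Defs.^ m ⟩∞} {y₃} {y₄}
    (power-product-value k k {y₃} (y₃⟶ k k≡)) (ω-product-value a m {y₄} (y₄⟶ a m a≡ m≡))

  J₂-value : ∀ a m {x y z} → poch (q ^ a) (q ^ m) ⟶ x → poch (q ^ (m ℕ.∸ a)) (q ^ m) ⟶ y →
    poch (q ^ m) (q ^ m) ⟶ z → J₂ a m q (x * y * z)
  J₂-value a m {x} {y} {z} x⟶ y⟶ z⟶ = product-value₂ {⟨ q Defs.^ a ⨟ q Defs.^ m ⟩∞ · ⟨ q Defs.^ (m ℕ.∸ a) ⨟ q Defs.^ m ⟩∞}
    {⟨ q Defs.^ m ⨟ q Defs.^ m ⟩∞} {x * y} {z}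
    (product-value₂ {⟨ q Defs.^ a ⨟ q Defs.^ m ⟩∞} {⟨ q Defs.^ (m ℕ.∸ a) ⨟ q Defs.^ m ⟩∞} {x} {y}
      (power-product-value a m {x} x⟶) (power-product-value (m ℕ.∸ a) m {y} y⟶))
    (power-product-value m m {z} z⟶)

  J₅-value : ∀ a m → a ≡ 5 → m ≡ 12 → m ℕ.∸ a ≡ 7 → J₂ a m q (x₅ * x₇ * x₁₂)
  J₅-value a m a≡ m≡ b≡ = J₂-value a m {x₅} {x₇} {x₁₂} (x₅⟶ a m a≡ m≡) (x₇⟶ (m ℕ.∸ a) m b≡ m≡) (x₁₂⟶ m m≡)

  J₁-value : ∀ a m → a ≡ 1 → m ≡ 12 → m ℕ.∸ a ≡ 11 → J₂ a m q (x₁ * x₁₁ * x₁₂)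
  J₁-value a m a≡ m≡ b≡ = J₂-value a m {x₁} {x₁₁} {x₁₂} (x₁⟶ a m a≡ m≡) (x₁₁⟶ (m ℕ.∸ a) m b≡ m≡) (x₁₂⟶ m m≡)

  *-agrees : ∀ {a a′ b b′} → a ≡ a′ → b ≡ b′ → a * b ≡ a′ Defs.* b′
  *-agrees = cong₂ Defs._*_

  numerator₁-agrees : ∀ j k n → poch (- ω) q n * poch (- (ω ^ j)) (q ^ k) n
    ≡ ⟨ Defs.- ω ⨟ q ⟩ n Defs.* ⟨ Defs.- (ω Defs.^ j) ⨟ q Defs.^ k ⟩ n
  numerator₁-agrees j k n = *-agrees {poch (- ω) q n} {⟨ Defs.- ω ⨟ q ⟩ n}
    {poch (- (ω ^ j)) (q ^ k) n} {⟨ Defs.- (ω Defs.^ j) ⨟ q Defs.^ k ⟩ n}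
    (poch-agrees {Defs.- ω} {Defs.- ω} {q} {q} ≡.refl ≡.refl n)
    (poch-agrees {Defs.- (ω ^ j)} {Defs.- (ω Defs.^ j)} {q ^ k} {q Defs.^ k} (cong Defs.-_ (^-agrees ω j)) (^-agrees q k) n)

  ωq-agrees : ∀ j k n → poch (ω ^ j * q) (q ^ k) n ≡ ⟨ ω Defs.^ j Defs.* q ⨟ q Defs.^ k ⟩ n
  ωq-agrees j k = poch-agrees {ω ^ j * q} {ω Defs.^ j Defs.* q} {q ^ k} {q Defs.^ k} (cong (Defs._* q) (^-agrees ω j)) (^-agrees q k)

  q-agrees : ∀ k n → poch (q ^ k) (q ^ k) n ≡ ⟨ q Defs.^ k ⨟ q Defs.^ k ⟩ n
  q-agrees k = poch-agrees {q ^ k} {q Defs.^ k} {q ^ k} {q Defs.^ k} (^-agrees q k) (^-agrees q k)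

  denominator₁-agrees : ∀ j k l n → poch (ω ^ j * q) (q ^ k) n * poch (q ^ l) (q ^ l) n
    ≡ ⟨ ω Defs.^ j Defs.* q ⨟ q Defs.^ k ⟩ n Defs.* ⟨ q Defs.^ l ⨟ q Defs.^ l ⟩ n
  denominator₁-agrees j k l n = *-agrees {poch (ω ^ j * q) (q ^ k) n} {⟨ ω Defs.^ j Defs.* q ⨟ q Defs.^ k ⟩ n}
    {poch (q ^ l) (q ^ l) n} {⟨ q Defs.^ l ⨟ q Defs.^ l ⟩ n} (ωq-agrees j k n) (q-agrees l n)

  power-agrees : ∀ m n → ω ^ m * q ^ n ≡ ω Defs.^ m Defs.* q Defs.^ n
  power-agrees m n = *-agrees {ω ^ m} {ω Defs.^ m} {q ^ n} {q Defs.^ n} (^-agrees ω m) (^-agrees q n)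

  numerator₂-agrees : ∀ j k n → poch (ω * q ^ j) (q ^ k) n ≡ ⟨ ω Defs.* q Defs.^ j ⨟ q Defs.^ k ⟩ n
  numerator₂-agrees j k = poch-agrees {ω * q ^ j} {ω Defs.* q Defs.^ j} {q ^ k} {q Defs.^ k} (cong (ω Defs.*_) (^-agrees q j)) (^-agrees q k)

  denominator₂-agrees : ∀ j k l n → poch (q ^ l) (q ^ l) n * poch (ω * q) q (suc n) * poch (ω ^ j * q) (q ^ k) (suc n)
    ≡ ⟨ q Defs.^ l ⨟ q Defs.^ l ⟩ n Defs.* ⟨ ω Defs.* q ⨟ q ⟩ (suc n) Defs.* ⟨ ω Defs.^ j Defs.* q ⨟ q Defs.^ k ⟩ (suc n)
  denominator₂-agrees j k l n = *-agrees {poch (q ^ l) (q ^ l) n * poch (ω * q) q (suc n)}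
    {⟨ q Defs.^ l ⨟ q Defs.^ l ⟩ n Defs.* ⟨ ω Defs.* q ⨟ q ⟩ (suc n)}
    {poch (ω ^ j * q) (q ^ k) (suc n)} {⟨ ω Defs.^ j Defs.* q ⨟ q Defs.^ k ⟩ (suc n)}
    (*-agrees {poch (q ^ l) (q ^ l) n} {⟨ q Defs.^ l ⨟ q Defs.^ l ⟩ n} {poch (ω * q) q (suc n)} {⟨ ω Defs.* q ⨟ q ⟩ (suc n)}
      (q-agrees l n) (poch-agrees {ω Defs.* q} {ω Defs.* q} {q} {q} ≡.refl ≡.refl (suc n)))
    (ωq-agrees j k (suc n))

  -- Sequences and values are all arguments, so the assembly of an identity is checked with
  -- variables in place of the actual products.
  identity-value : ∀ (num den inv pow num′ den′ pow′ : ℕ → ℂ) (X Y : Partialℂ) (σ x y : ℂ) →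
    (∀ n → den n * inv n ≈ 1#) → (∀ n → num n ≡ num′ n) → (∀ n → den n ≡ den′ n) → (∀ n → pow n ≡ pow′ n) →
    (λ n → ∑< n (λ k → num k * inv k * pow k)) ⟶ σ →
    X x → Y y → (∃ λ u → y * u ≈ 1#) → σ * y ≈ x →
    ∑∞ (λ n → ↑ num′ n ÷ ↑ den′ n · ↑ pow′ n) ≋ X ÷ Y
  identity-value num den inv pow num′ den′ pow′ X Y σ x y den-inv num≡ den≡ pow≡ sum⟶ Xx Yy unit-y value = σ
    , sum-value {λ n → num n * inv n * pow n} {σ} {λ n → ↑ num′ n ÷ ↑ den′ n · ↑ pow′ n}
        (λ n → summand-value {num n} {den n} {pow n} {num′ n} {den′ n} {pow′ n} (inv n) (den-inv n) (num≡ n) (den≡ n) (pow≡ n))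
        sum⟶
    , quotient-value {X} {Y} {x} {y} {σ} Xx Yy unit-y value

  abstract
    num₁≡ : ∀ j → j ≡ 2 → ∀ n → numerator₁ n ≡ ⟨ Defs.- ω ⨟ q ⟩ n Defs.* ⟨ Defs.- (ω Defs.^ j) ⨟ q Defs.^ j ⟩ n
    num₁≡ j j≡ n = ≡.trans (numerator₁≡ j j≡ n) (numerator₁-agrees j j n)
    den₁≡ : ∀ j k → j ≡ 2 → k ≡ 3 → ∀ n →
      denominator₁ n ≡ ⟨ ω Defs.^ j Defs.* q ⨟ q Defs.^ j ⟩ n Defs.* ⟨ q Defs.^ k ⨟ q Defs.^ k ⟩ n
    den₁≡ j k j≡ k≡ n = ≡.trans (denominator₁≡ j k j≡ k≡ n) (denominator₁-agrees j j k n)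
    num₂≡ : ∀ j → j ≡ 4 → ∀ n → numerator₂ n ≡ ⟨ ω Defs.* q Defs.^ j ⨟ q Defs.^ j ⟩ n
    num₂≡ j j≡ n = ≡.trans (numerator₂≡ j j≡ n) (numerator₂-agrees j j n)
    den₂≡ : ∀ j k → j ≡ 2 → k ≡ 3 → ∀ n →
      denominator n ≡ ⟨ q Defs.^ k ⨟ q Defs.^ k ⟩ n Defs.* ⟨ ω Defs.* q ⨟ q ⟩ (suc n) Defs.* ⟨ ω Defs.^ j Defs.* q ⨟ q Defs.^ j ⟩ (suc n)
    den₂≡ j k j≡ k≡ n = ≡.trans (denominator≡ j k j≡ k≡ n) (denominator₂-agrees j j k n)
    pow≡ : ∀ n → power n ≡ ω Defs.^ n Defs.* q Defs.^ ((n ℕ.* (n ℕ.+ 3)) ℕ./ 2)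
    pow≡ n = ≡.trans (power≡ n) (power-agrees n ((n ℕ.* (n ℕ.+ 3)) ℕ./ 2))

    first : ∀ a m i k j d → a ≡ 5 → m ≡ 12 → m ℕ.∸ a ≡ 7 → i ≡ 3 → k ≡ 2 → j ≡ 2 → d ≡ 4 →
      ∑∞ (λ n →
        ↑ (⟨ Defs.- ω ⨟ q ⟩ n Defs.* ⟨ Defs.- (ω Defs.^ j) ⨟ q Defs.^ j ⟩ n)
        ÷ ↑ (⟨ ω Defs.^ j Defs.* q ⨟ q Defs.^ j ⟩ n Defs.* ⟨ q Defs.^ i ⨟ q Defs.^ i ⟩ n)
        · ↑ (ω Defs.^ n Defs.* q Defs.^ ((n ℕ.* (n ℕ.+ 3)) ℕ./ 2)))
      ≋ J₂ a m q ÷ (J i q · ⟨ ω Defs.* q Defs.^ k ⨟ q Defs.^ d ⟩∞)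
    first a m i k j d a≡ m≡ b≡ i≡ k≡ j≡ d≡ = identity-value numerator₁ denominator₁ inverse₁ power
      (λ n → ⟨ Defs.- ω ⨟ q ⟩ n Defs.* ⟨ Defs.- (ω Defs.^ j) ⨟ q Defs.^ j ⟩ n)
      (λ n → ⟨ ω Defs.^ j Defs.* q ⨟ q Defs.^ j ⟩ n Defs.* ⟨ q Defs.^ i ⨟ q Defs.^ i ⟩ n)
      (λ n → ω Defs.^ n Defs.* q Defs.^ ((n ℕ.* (n ℕ.+ 3)) ℕ./ 2))
      (J₂ a m q) (J i q · ⟨ ω Defs.* q Defs.^ k ⨟ q Defs.^ d ⟩∞) Σ₁ (x₅ * x₇ * x₁₂) (y₃ * y₄)
      inverse₁-correct (num₁≡ j j≡) (den₁≡ j i j≡ i≡) pow≡ first⟶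
      (J₅-value a m a≡ m≡ b≡) (denominator-value i k d i≡ k≡ d≡) unit Σ₁-value

    second : ∀ a m i k j d → a ≡ 1 → m ≡ 12 → m ℕ.∸ a ≡ 11 → i ≡ 3 → k ≡ 2 → j ≡ 2 → d ≡ 4 →
      ∑∞ (λ n →
        ↑ (⟨ ω Defs.* q Defs.^ d ⨟ q Defs.^ d ⟩ n)
        ÷ ↑ (⟨ q Defs.^ i ⨟ q Defs.^ i ⟩ n Defs.* ⟨ ω Defs.* q ⨟ q ⟩ (suc n) Defs.* ⟨ ω Defs.^ j Defs.* q ⨟ q Defs.^ j ⟩ (suc n))
        · ↑ (ω Defs.^ n Defs.* q Defs.^ ((n ℕ.* (n ℕ.+ 3)) ℕ./ 2)))
      ≋ J₂ a m q ÷ (J i q · ⟨ ω Defs.* q Defs.^ k ⨟ q Defs.^ d ⟩∞)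
    second a m i k j d a≡ m≡ b≡ i≡ k≡ j≡ d≡ = identity-value numerator₂ denominator inverse power
      (λ n → ⟨ ω Defs.* q Defs.^ d ⨟ q Defs.^ d ⟩ n)
      (λ n → ⟨ q Defs.^ i ⨟ q Defs.^ i ⟩ n Defs.* ⟨ ω Defs.* q ⨟ q ⟩ (suc n) Defs.* ⟨ ω Defs.^ j Defs.* q ⨟ q Defs.^ j ⟩ (suc n))
      (λ n → ω Defs.^ n Defs.* q Defs.^ ((n ℕ.* (n ℕ.+ 3)) ℕ./ 2))
      (J₂ a m q) (J i q · ⟨ ω Defs.* q Defs.^ k ⨟ q Defs.^ d ⟩∞) Σ₂ (x₁ * x₁₁ * x₁₂) (y₃ * y₄)
      inverse-correct (num₂≡ d d≡) (den₂≡ j i j≡ i≡) pow≡ second⟶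
      (J₁-value a m a≡ m≡ b≡) (denominator-value i k d i≡ k≡ d≡) unit (Σ₂-value cancel)

open import Defs

theorem4p2 : (ω q : ℂ) → IsPrimitiveRoot 3 ω → ∣ q ∣< 1ℚ →
    (∑∞ (λ n →
    ↑ (⟨ - ω ⨟ q ⟩ n * ⟨ - (ω ^ 2) ⨟ q ^ 2 ⟩ n)
    ÷ ↑ (⟨ ω ^ 2 * q ⨟ q ^ 2 ⟩ n * ⟨ q ^ 3 ⨟ q ^ 3 ⟩ n)
    · ↑ (ω ^ n * q ^ ((n ℕ.* (n ℕ.+ 3)) ℕ./ 2)))
    ≋ J₂ 5 12 q ÷ (J 3 q · ⟨ ω * q ^ 2 ⨟ q ^ 4 ⟩∞))
    ×
    (∑∞ (λ n →
    ↑ (⟨ ω * q ^ 4 ⨟ q ^ 4 ⟩ n)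
    ÷ ↑ (⟨ q ^ 3 ⨟ q ^ 3 ⟩ n * ⟨ ω * q ⨟ q ⟩ (suc n) * ⟨ ω ^ 2 * q ⨟ q ^ 2 ⟩ (suc n))
    · ↑ (ω ^ n * q ^ ((n ℕ.* (n ℕ.+ 3)) ℕ./ 2)))
    ≋ J₂ 1 12 q ÷ (J 3 q · ⟨ ω * q ^ 2 ⨟ q ^ 4 ⟩∞))
theorem4p2 ω q ω-primitive ∣q∣<1 =
    first 5 12 3 2 2 4 ≡.refl ≡.refl ≡.refl ≡.refl ≡.refl ≡.refl ≡.refl
  , second 1 12 3 2 2 4 ≡.refl ≡.refl ≡.refl ≡.refl ≡.refl ≡.refl ≡.refl
  where
  ratio = Modulus.∣∣<1⇒ratio q ∣q∣<1
  open Conclusion ω q ω-primitive (proj₁ ratio) (proj₁ (proj₂ ratio))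
    (proj₁ (proj₂ (proj₂ ratio))) (proj₂ (proj₂ (proj₂ ratio)))
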